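{- Let $q$ be a complex number with $|q|<1$ and let $k\geqslant 1$ be an integer. Then $$\frac{(-q;q^2)_\infty}{(q^2;q^2)_\infty} \sum_{j=0}^{k-1}(-1)^jq^{j(2j+1)}(1-q^{2j+1}) =1+(-1)^{k-1} \sum_{n=k}^\infty \frac{(-q;q^2)_{k}\, (-q;q^2)_{n-k}\,q^{2(k+1)n-k}} {(q^2;q^2)_n}{n-1\brack k-1}_{q^2}.$$
   Context: For a base $x$ with $|x|<1$, the shifted factorials are $(a;x)_\infty=\prod_{n=0}^{\infty}(1-ax^n)$ and, for integers $M\geqslant 0$, $(a;x)_M=\dfrac{(a;x)_\infty}{(ax^M;x)_\infty}=\prod_{i=0}^{M-1}(1-ax^i)$. The Gaussian binomial coefficient with base $x$ is, for integers $0\leqslant N\leqslant M$, ${M\brack N}_x=\dfrac{(x;x)_M}{(x;x)_N (x;x)_{M-N}}$. In the claim the base is $x=q^2$. -}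

module Defs where

open import Data.Nat.Base as ℕ using (ℕ; zero; suc; _∸_)
import Data.Nat.Properties as ℕ
open import Data.Rational.Base as ℚ using (ℚ; 0ℚ; 1ℚ; ½)
import Data.Rational.Properties as ℚ
open import Data.Rational.Solver using (module +-*-Solver)
open import Data.Product.Base using (Σ; Σ-syntax; ∃-syntax; _×_; _,_; proj₁; proj₂)
open import Algebra.Bundles.Raw using (RawSemiring)
import Algebra.Definitions.RawSemiring as Exponentiation
open import Level using (0ℓ)
open import Relation.Binary.PropositionalEquality
  using (_≡_; refl; sym; trans; cong; cong₂; subst; subst₂)

private
  open +-*-Solver

  ½-pos : ∀ {ε} → 0ℚ ℚ.< ε → 0ℚ ℚ.< ½ ℚ.* ε
  ½-pos {ε} h = subst (ℚ._< ½ ℚ.* ε) (ℚ.*-zeroʳ ½) (ℚ.*-monoʳ-<-pos ½ h)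

  *-pos : ∀ {p q} → 0ℚ ℚ.< p → 0ℚ ℚ.< q → 0ℚ ℚ.< p ℚ.* q
  *-pos {p} {q} hp hq =
    subst (ℚ._< p ℚ.* q) (ℚ.*-zeroʳ p)
      (ℚ.*-monoʳ-<-pos p {{ℚ.positive hp}} hq)

  halves : ∀ ε → ½ ℚ.* ε ℚ.+ ½ ℚ.* ε ≡ ε
  halves ε = trans (sym (ℚ.*-distribʳ-+ ε ½ ½)) (ℚ.*-identityˡ ε)

  *-mono-≤ : ∀ {p q r s} → 0ℚ ℚ.≤ p → 0ℚ ℚ.≤ s → p ℚ.≤ q → r ℚ.≤ s →
             p ℚ.* r ℚ.≤ q ℚ.* s
  *-mono-≤ {p} {q} {r} {s} hp hs pq rs = ℚ.≤-trans
    (ℚ.*-monoˡ-≤-nonNeg p {{ℚ.nonNegative hp}} rs)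
    (ℚ.*-monoʳ-≤-nonNeg s {{ℚ.nonNegative hs}} pq)

  0≤p*p : ∀ p → 0ℚ ℚ.≤ p ℚ.* p
  0≤p*p p = subst (0ℚ ℚ.≤_) (∣p∣*∣p∣≡p*p p)
    (subst (ℚ._≤ ℚ.∣ p ∣ ℚ.* ℚ.∣ p ∣) (ℚ.*-zeroʳ 0ℚ)
      (*-mono-≤ ℚ.≤-refl (ℚ.0≤∣p∣ p) (ℚ.0≤∣p∣ p) (ℚ.0≤∣p∣ p)))
    where
    open import Data.Sum.Base using (inj₁; inj₂)
    ∣p∣*∣p∣≡p*p : ∀ p → ℚ.∣ p ∣ ℚ.* ℚ.∣ p ∣ ≡ p ℚ.* p
    ∣p∣*∣p∣≡p*p p with ℚ.∣p∣≡p∨∣p∣≡-p p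
    ... | inj₁ eq = cong₂ ℚ._*_ eq eq
    ... | inj₂ eq = trans (cong₂ ℚ._*_ eq eq)
      (solve 1 (λ p → (:- p) :* (:- p) := p :* p) refl p)

  p≤p+q : ∀ p {q} → 0ℚ ℚ.≤ q → p ℚ.≤ p ℚ.+ q
  p≤p+q p {q} h = subst (ℚ._≤ p ℚ.+ q) (ℚ.+-identityʳ p) (ℚ.+-monoʳ-≤ p h)

  p≤q+p : ∀ p {q} → 0ℚ ℚ.≤ q → p ℚ.≤ q ℚ.+ p
  p≤q+p p {q} h = subst (ℚ._≤ q ℚ.+ p) (ℚ.+-identityˡ p) (ℚ.+-monoˡ-≤ p h)

  0≤p*p+q*q : ∀ p q → 0ℚ ℚ.≤ p ℚ.* p ℚ.+ q ℚ.* q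
  0≤p*p+q*q p q = ℚ.≤-trans (0≤p*p p) (p≤p+q (p ℚ.* p) (0≤p*p q))

  0<1 : 0ℚ ℚ.< 1ℚ
  0<1 = ℚ.positive⁻¹ 1ℚ

  m≤m⊔n⊔o : ∀ m n o → m ℕ.≤ m ℕ.⊔ n ℕ.⊔ o
  m≤m⊔n⊔o m n o = ℕ.≤-trans (ℕ.m≤m⊔n m n) (ℕ.m≤m⊔n (m ℕ.⊔ n) o)

  n≤m⊔n⊔o : ∀ m n o → n ℕ.≤ m ℕ.⊔ n ℕ.⊔ o
  n≤m⊔n⊔o m n o = ℕ.≤-trans (ℕ.m≤n⊔m m n) (ℕ.m≤m⊔n (m ℕ.⊔ n) o)

IsCauchy : (ℕ → ℚ) → Set
IsCauchy s = ∀ ε → 0ℚ ℚ.< ε →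
  ∃[ N ] (∀ m n → N ℕ.≤ m → N ℕ.≤ n → ℚ.∣ s m ℚ.- s n ∣ ℚ.< ε)

-- A real number is a Cauchy sequence of rationals; equality of reals is _≈ℝ_.
record ℝ : Set where
  constructor mkℝ
  field
    seq    : ℕ → ℚ
    cauchy : IsCauchy seq

open ℝ public

infix 4 _≈ℝ_ _<ℝ_

_≈ℝ_ : ℝ → ℝ → Set
x ≈ℝ y = ∀ ε → 0ℚ ℚ.< ε →
  ∃[ N ] (∀ n → N ℕ.≤ n → ℚ.∣ seq x n ℚ.- seq y n ∣ ℚ.< ε)

-- The rational gap ε is what makes _<ℝ_ respect _≈ℝ_.
_<ℝ_ : ℝ → ℝ → Set
x <ℝ y = Σ[ ε ∈ ℚ ] (0ℚ ℚ.< ε) ×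
  ∃[ N ] (∀ n → N ℕ.≤ n → seq x n ℚ.+ ε ℚ.≤ seq y n)

private abstract
  const-cauchy : ∀ p → IsCauchy (λ _ → p)
  const-cauchy p ε 0<ε = 0 , λ _ _ _ _ →
    subst (ℚ._< ε) (sym (cong ℚ.∣_∣ (ℚ.+-inverseʳ p))) 0<ε

  +-cauchy : ∀ s t → IsCauchy s → IsCauchy t → IsCauchy (λ n → s n ℚ.+ t n)
  +-cauchy s t hs ht ε 0<ε
    with hs (½ ℚ.* ε) (½-pos 0<ε) | ht (½ ℚ.* ε) (½-pos 0<ε)
  ... | M , hM | N , hN = M ℕ.⊔ N , λ m n m≥ n≥ →
    ℚ.≤-<-trans
      (subst (λ z → ℚ.∣ z ∣ ℚ.≤ ℚ.∣ s m ℚ.- s n ∣ ℚ.+ ℚ.∣ t m ℚ.- t n ∣)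
        (solve 4 (λ a b c d → (a :- c) :+ (b :- d) := (a :+ b) :- (c :+ d))
          refl (s m) (t m) (s n) (t n))
        (ℚ.∣p+q∣≤∣p∣+∣q∣ (s m ℚ.- s n) (t m ℚ.- t n)))
      (subst (ℚ.∣ s m ℚ.- s n ∣ ℚ.+ ℚ.∣ t m ℚ.- t n ∣ ℚ.<_) (halves ε)
        (ℚ.+-mono-<
          (hM m n (ℕ.≤-trans (ℕ.m≤m⊔n M N) m≥) (ℕ.≤-trans (ℕ.m≤m⊔n M N) n≥))
          (hN m n (ℕ.≤-trans (ℕ.m≤n⊔m M N) m≥) (ℕ.≤-trans (ℕ.m≤n⊔m M N) n≥))))

  neg-cauchy : ∀ s → IsCauchy s → IsCauchy (λ n → ℚ.- s n)
  neg-cauchy s hs ε 0<ε with hs ε 0<ε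
  ... | N , hN = N , λ m n m≥ n≥ →
    subst (ℚ._< ε)
      (trans (sym (ℚ.∣-p∣≡∣p∣ (s m ℚ.- s n)))
        (cong ℚ.∣_∣ (solve 2 (λ a b → :- (a :- b) := (:- a) :- (:- b)) refl (s m) (s n))))
      (hN m n m≥ n≥)

  bound : ∀ p q → ℚ.∣ p ℚ.- q ∣ ℚ.< 1ℚ → ℚ.∣ p ∣ ℚ.≤ 1ℚ ℚ.+ ℚ.∣ q ∣
  bound p q h = ℚ.≤-trans
    (subst (λ z → ℚ.∣ z ∣ ℚ.≤ ℚ.∣ p ℚ.- q ∣ ℚ.+ ℚ.∣ q ∣)
      (solve 2 (λ a b → (a :- b) :+ b := a) refl p q)
      (ℚ.∣p+q∣≤∣p∣+∣q∣ (p ℚ.- q) q))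
    (ℚ.+-monoˡ-≤ ℚ.∣ q ∣ (ℚ.<⇒≤ h))

  eventually-bounded : ∀ s → IsCauchy s →
    Σ[ K ∈ ℚ ] (0ℚ ℚ.< K) × ∃[ N ] (∀ n → N ℕ.≤ n → ℚ.∣ s n ∣ ℚ.≤ K)
  eventually-bounded s hs = 1ℚ ℚ.+ ℚ.∣ s N ∣
    , ℚ.<-≤-trans 0<1 (p≤p+q 1ℚ {ℚ.∣ s N ∣} (ℚ.0≤∣p∣ (s N)))
    , N , λ n n≥ → bound (s n) (s N) (proj₂ (hs 1ℚ 0<1) n N n≥ ℕ.≤-refl)
    where
    N : ℕ
    N = proj₁ (hs 1ℚ 0<1)

  *-estimate : ∀ {K δ ε} → 0ℚ ℚ.< K → K ℚ.* δ ℚ.+ K ℚ.* δ ≡ ε → ∀ a b c d →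
    ℚ.∣ a ∣ ℚ.≤ K → ℚ.∣ d ∣ ℚ.≤ K → ℚ.∣ a ℚ.- c ∣ ℚ.< δ → ℚ.∣ b ℚ.- d ∣ ℚ.< δ →
    ℚ.∣ a ℚ.* b ℚ.- c ℚ.* d ∣ ℚ.< ε
  *-estimate {K} {δ} {ε} 0<K eq a b c d a≤ d≤ ac< bd< =
    ℚ.≤-<-trans split (ℚ.≤-<-trans
      (ℚ.+-mono-≤
        (ℚ.*-monoʳ-≤-nonNeg B {{ℚ.nonNegative (ℚ.0≤∣p∣ (b ℚ.- d))}} a≤)
        (ℚ.*-monoʳ-≤-nonNeg A {{ℚ.nonNegative (ℚ.0≤∣p∣ (a ℚ.- c))}} d≤))
      (subst (K ℚ.* B ℚ.+ K ℚ.* A ℚ.<_) eq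
        (ℚ.+-mono-< (ℚ.*-monoʳ-<-pos K {{ℚ.positive 0<K}} bd<)
                    (ℚ.*-monoʳ-<-pos K {{ℚ.positive 0<K}} ac<))))
    where
    A B : ℚ
    A = ℚ.∣ a ℚ.- c ∣
    B = ℚ.∣ b ℚ.- d ∣
    split : ℚ.∣ a ℚ.* b ℚ.- c ℚ.* d ∣ ℚ.≤ ℚ.∣ a ∣ ℚ.* B ℚ.+ ℚ.∣ d ∣ ℚ.* A
    split = subst₂ ℚ._≤_
      (cong ℚ.∣_∣ (solve 4 (λ a b c d → a :* (b :- d) :+ d :* (a :- c) := a :* b :- c :* d)
        refl a b c d))
      (cong₂ ℚ._+_ (ℚ.∣p*q∣≡∣p∣*∣q∣ a (b ℚ.- d)) (ℚ.∣p*q∣≡∣p∣*∣q∣ d (a ℚ.- c)))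
      (ℚ.∣p+q∣≤∣p∣+∣q∣ (a ℚ.* (b ℚ.- d)) (d ℚ.* (a ℚ.- c)))

  divide : ∀ K ε → 0ℚ ℚ.< K → 0ℚ ℚ.< ε → Σ[ δ ∈ ℚ ] (0ℚ ℚ.< δ) × K ℚ.* δ ≡ ε
  divide K ε 0<K 0<ε = ε ℚ.* i , *-pos 0<ε 0<i
    , trans (solve 3 (λ k e i → k :* (e :* i) := e :* (k :* i)) refl K ε i)
        (trans (cong (ε ℚ.*_) (ℚ.*-inverseʳ K)) (ℚ.*-identityʳ ε))
    where
    instance
      posK : ℚ.Positive K
      posK = ℚ.positive 0<K
      nzK : ℚ.NonZero K
      nzK = ℚ.pos⇒nonZero K
    i : ℚ
    i = ℚ.1/ K
    0<i : 0ℚ ℚ.< i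
    0<i = ℚ.positive⁻¹ i {{ℚ.1/pos⇒pos K}}

  *-cauchy : ∀ s t → IsCauchy s → IsCauchy t → IsCauchy (λ n → s n ℚ.* t n)
  *-cauchy s t hs ht ε 0<ε =
    from-bounds (eventually-bounded s hs) (eventually-bounded t ht)
    where
    Goal : Set
    Goal = ∃[ N ] (∀ m n → N ℕ.≤ m → N ℕ.≤ n → ℚ.∣ s m ℚ.* t m ℚ.- s n ℚ.* t n ∣ ℚ.< ε)

    from-moduli : ∀ K δ N₁ N₂ → 0ℚ ℚ.< K → K ℚ.* δ ℚ.+ K ℚ.* δ ≡ ε →
      (∀ n → N₁ ℕ.≤ n → ℚ.∣ s n ∣ ℚ.≤ K) → (∀ n → N₂ ℕ.≤ n → ℚ.∣ t n ∣ ℚ.≤ K) →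
      ∃[ M ] (∀ m n → M ℕ.≤ m → M ℕ.≤ n → ℚ.∣ s m ℚ.- s n ∣ ℚ.< δ) →
      ∃[ M ] (∀ m n → M ℕ.≤ m → M ℕ.≤ n → ℚ.∣ t m ℚ.- t n ∣ ℚ.< δ) → Goal
    from-moduli K δ N₁ N₂ 0<K eq b₁ b₂ (M₁ , h₁) (M₂ , h₂) = N , λ m n m≥ n≥ →
      *-estimate {K} {δ} {ε} 0<K eq (s m) (t m) (s n) (t n)
        (b₁ m (ℕ.≤-trans (m≤m⊔n⊔o N₁ N₂ M) m≥))
        (b₂ n (ℕ.≤-trans (n≤m⊔n⊔o N₁ N₂ M) n≥))
        (h₁ m n (ℕ.≤-trans M₁≤ m≥) (ℕ.≤-trans M₁≤ n≥))
        (h₂ m n (ℕ.≤-trans M₂≤ m≥) (ℕ.≤-trans M₂≤ n≥))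
      where
      M N : ℕ
      M = M₁ ℕ.⊔ M₂
      N = N₁ ℕ.⊔ N₂ ℕ.⊔ M
      M₁≤ : M₁ ℕ.≤ N
      M₁≤ = ℕ.≤-trans (ℕ.m≤m⊔n M₁ M₂) (ℕ.m≤n⊔m (N₁ ℕ.⊔ N₂) M)
      M₂≤ : M₂ ℕ.≤ N
      M₂≤ = ℕ.≤-trans (ℕ.m≤n⊔m M₁ M₂) (ℕ.m≤n⊔m (N₁ ℕ.⊔ N₂) M)

    from-bounds :
      Σ[ K ∈ ℚ ] (0ℚ ℚ.< K) × ∃[ N ] (∀ n → N ℕ.≤ n → ℚ.∣ s n ∣ ℚ.≤ K) →
      Σ[ K ∈ ℚ ] (0ℚ ℚ.< K) × ∃[ N ] (∀ n → N ℕ.≤ n → ℚ.∣ t n ∣ ℚ.≤ K) → Goal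
    from-bounds (K₁ , 0<K₁ , N₁ , b₁) (K₂ , 0<K₂ , N₂ , b₂) =
      from-quotient (divide (K₁ ℚ.+ K₂) (½ ℚ.* ε) 0<K (½-pos 0<ε))
      where
      0<K : 0ℚ ℚ.< K₁ ℚ.+ K₂
      0<K = ℚ.<-≤-trans 0<K₁ (p≤p+q K₁ {K₂} (ℚ.<⇒≤ 0<K₂))
      from-quotient : Σ[ δ ∈ ℚ ] (0ℚ ℚ.< δ) × (K₁ ℚ.+ K₂) ℚ.* δ ≡ ½ ℚ.* ε → Goal
      from-quotient (δ , 0<δ , Kδ) = from-moduli (K₁ ℚ.+ K₂) δ N₁ N₂ 0<K
        (trans (cong₂ ℚ._+_ Kδ Kδ) (halves ε))
        (λ n n≥ → ℚ.≤-trans (b₁ n n≥) (p≤p+q K₁ {K₂} (ℚ.<⇒≤ 0<K₂)))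
        (λ n n≥ → ℚ.≤-trans (b₂ n n≥) (p≤q+p K₂ {K₁} (ℚ.<⇒≤ 0<K₁)))
        (hs δ 0<δ) (ht δ 0<δ)

  recip-estimate : ∀ {ε η a b u v} e → 0ℚ ℚ.< e → ε ℚ.* e ≡ 1ℚ → ε ℚ.≤ a → ε ℚ.≤ b →
    0ℚ ℚ.< u → 0ℚ ℚ.< v → a ℚ.* u ≡ 1ℚ → b ℚ.* v ≡ 1ℚ →
    ℚ.∣ b ℚ.- a ∣ ℚ.< η ℚ.* (ε ℚ.* ε) → ℚ.∣ u ℚ.- v ∣ ℚ.< η
  recip-estimate {ε} {η} {a} {b} {u} {v} e 0<e εe ε≤a ε≤b 0<u 0<v au bv d< = ℚ.≤-<-trans
      (subst (ℚ._≤ e ℚ.* e ℚ.* ℚ.∣ d ∣) (sym ∣uvd∣)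
        (ℚ.*-monoʳ-≤-nonNeg ℚ.∣ d ∣ {{ℚ.nonNegative (ℚ.0≤∣p∣ d)}}
          (*-mono-≤ {u} {e} {v} {e} (ℚ.<⇒≤ 0<u) (ℚ.<⇒≤ 0<e) (≤e 0<u ε≤a au) (≤e 0<v ε≤b bv))))
      (subst (e ℚ.* e ℚ.* ℚ.∣ d ∣ ℚ.<_) cancel
        (ℚ.*-monoʳ-<-pos (e ℚ.* e) {{ℚ.positive (*-pos {e} {e} 0<e 0<e)}} d<))
    where
    d : ℚ
    d = b ℚ.- a
    uvd : u ℚ.* v ℚ.* d ≡ u ℚ.- v
    uvd = trans
      (solve 4 (λ a b u v → u :* v :* (b :- a) := u :* (b :* v) :- v :* (a :* u)) refl a b u v)
      (cong₂ ℚ._-_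
        (trans (cong (u ℚ.*_) bv) (ℚ.*-identityʳ u))
        (trans (cong (v ℚ.*_) au) (ℚ.*-identityʳ v)))
    ∣uvd∣ : ℚ.∣ u ℚ.- v ∣ ≡ u ℚ.* v ℚ.* ℚ.∣ d ∣
    ∣uvd∣ = trans (cong ℚ.∣_∣ (sym uvd))
      (trans (ℚ.∣p*q∣≡∣p∣*∣q∣ (u ℚ.* v) d)
        (cong (ℚ._* ℚ.∣ d ∣) (ℚ.0≤p⇒∣p∣≡p (ℚ.<⇒≤ (*-pos {u} {v} 0<u 0<v)))))
    ≤e : ∀ {x y} → 0ℚ ℚ.< y → ε ℚ.≤ x → x ℚ.* y ≡ 1ℚ → y ℚ.≤ e
    ≤e {x} {y} 0<y ε≤x xy = subst₂ ℚ._≤_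
      (trans (solve 3 (λ y ε e → ε :* y :* e := y :* (ε :* e)) refl y ε e)
        (trans (cong (y ℚ.*_) εe) (ℚ.*-identityʳ y)))
      (trans (cong (ℚ._* e) xy) (ℚ.*-identityˡ e))
      (ℚ.*-monoʳ-≤-nonNeg e {{ℚ.nonNegative (ℚ.<⇒≤ 0<e)}}
        (ℚ.*-monoʳ-≤-nonNeg y {{ℚ.nonNegative (ℚ.<⇒≤ 0<y)}} ε≤x))
    cancel : e ℚ.* e ℚ.* (η ℚ.* (ε ℚ.* ε)) ≡ η
    cancel = trans
      (solve 3 (λ e ε η → e :* e :* (η :* (ε :* ε)) := η :* ((ε :* e) :* (ε :* e))) refl e ε η)
      (trans (cong (λ z → η ℚ.* (z ℚ.* z)) εe) (ℚ.*-identityʳ η))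

ratℝ : ℚ → ℝ
ratℝ p = mkℝ (λ _ → p) (const-cauchy p)

0ℝ 1ℝ : ℝ
0ℝ = ratℝ 0ℚ
1ℝ = ratℝ 1ℚ

infixl 6 _+ℝ_
infixl 7 _*ℝ_
infix  8 -ℝ_

_+ℝ_ _*ℝ_ : ℝ → ℝ → ℝ
x +ℝ y = mkℝ (λ n → seq x n ℚ.+ seq y n) (+-cauchy (seq x) (seq y) (cauchy x) (cauchy y))
x *ℝ y = mkℝ (λ n → seq x n ℚ.* seq y n) (*-cauchy (seq x) (seq y) (cauchy x) (cauchy y))

-ℝ_ : ℝ → ℝ
-ℝ x = mkℝ (λ n → ℚ.- seq x n) (neg-cauchy (seq x) (cauchy x))

-- Reciprocal of a sequence bounded below by ε from the index N on; the
-- sequence is shifted by N so that every term is invertible.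
module Reciprocal (s : ℕ → ℚ) (hs : IsCauchy s) (ε : ℚ) (0<ε : 0ℚ ℚ.< ε)
                  (N : ℕ) (ε≤s : ∀ n → N ℕ.≤ n → 0ℚ ℚ.+ ε ℚ.≤ s n) where

  ε≤s+ : ∀ n → ε ℚ.≤ s (N ℕ.+ n)
  ε≤s+ n = subst (ℚ._≤ s (N ℕ.+ n)) (ℚ.+-identityˡ ε) (ε≤s (N ℕ.+ n) (ℕ.m≤m+n N n))

  s+-pos : ∀ n → ℚ.Positive (s (N ℕ.+ n))
  s+-pos n = ℚ.positive (ℚ.<-≤-trans 0<ε (ε≤s+ n))

  recip : ℕ → ℚ
  recip n = ℚ.1/_ (s (N ℕ.+ n)) {{ℚ.pos⇒nonZero (s (N ℕ.+ n)) {{s+-pos n}}}}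

  abstract
    recip-inverse : ∀ n → s (N ℕ.+ n) ℚ.* recip n ≡ 1ℚ
    recip-inverse n = ℚ.*-inverseʳ (s (N ℕ.+ n)) {{ℚ.pos⇒nonZero (s (N ℕ.+ n)) {{s+-pos n}}}}

    recip-cauchy : IsCauchy recip
    recip-cauchy η 0<η = from (divide ε 1ℚ 0<ε 0<1)
      (hs (η ℚ.* (ε ℚ.* ε)) (*-pos {η} 0<η (*-pos {ε} {ε} 0<ε 0<ε)))
      where
      recip-pos : ∀ n → 0ℚ ℚ.< recip n
      recip-pos n = ℚ.positive⁻¹ (recip n) {{ℚ.1/pos⇒pos (s (N ℕ.+ n)) {{s+-pos n}}}}
      from : Σ[ e ∈ ℚ ] (0ℚ ℚ.< e) × ε ℚ.* e ≡ 1ℚ →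
        ∃[ M ] (∀ m n → M ℕ.≤ m → M ℕ.≤ n → ℚ.∣ s m ℚ.- s n ∣ ℚ.< η ℚ.* (ε ℚ.* ε)) →
        ∃[ M ] (∀ m n → M ℕ.≤ m → M ℕ.≤ n → ℚ.∣ recip m ℚ.- recip n ∣ ℚ.< η)
      from (e , 0<e , εe) (M , hM) = M , λ m n m≥ n≥ →
        recip-estimate {ε} {η} {s (N ℕ.+ m)} {s (N ℕ.+ n)} {recip m} {recip n}
          e 0<e εe (ε≤s+ m) (ε≤s+ n) (recip-pos m) (recip-pos n)
          (recip-inverse m) (recip-inverse n)
          (hM (N ℕ.+ n) (N ℕ.+ m) (ℕ.≤-trans n≥ (ℕ.m≤n+m n N)) (ℕ.≤-trans m≥ (ℕ.m≤n+m m N)))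

1/ℝ : (x : ℝ) → 0ℝ <ℝ x → ℝ
1/ℝ x (ε , 0<ε , N , ε≤x) = mkℝ recip recip-cauchy
  where open Reciprocal (seq x) (cauchy x) ε 0<ε N ε≤x

record ℂ : Set where
  constructor _+i_
  field
    re im : ℝ

open ℂ public

infix  4 _≈_ _#0 ∣_∣<_
infixl 6 _+_ _-_
infixl 7 _*_ _/_[_]
infix  8 -_

_≈_ : ℂ → ℂ → Set
z ≈ w = (re z ≈ℝ re w) × (im z ≈ℝ im w)

0ℂ 1ℂ : ℂ
0ℂ = 0ℝ +i 0ℝ
1ℂ = 1ℝ +i 0ℝ

_+_ _*_ : ℂ → ℂ → ℂ
z + w = (re z +ℝ re w) +i (im z +ℝ im w)
z * w = (re z *ℝ re w +ℝ -ℝ (im z *ℝ im w)) +i (re z *ℝ im w +ℝ im z *ℝ re w)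

-_ : ℂ → ℂ
- z = (-ℝ re z) +i (-ℝ im z)

_-_ : ℂ → ℂ → ℂ
_-_ z w = z + (- w)

ℂ-rawSemiring : RawSemiring 0ℓ 0ℓ
ℂ-rawSemiring = record
  { Carrier = ℂ ; _≈_ = _≈_ ; _+_ = _+_ ; _*_ = _*_ ; 0# = 0ℂ ; 1# = 1ℂ }

open Exponentiation ℂ-rawSemiring public using (_^_)

∣_∣² : ℂ → ℝ
∣ z ∣² = re z *ℝ re z +ℝ im z *ℝ im z

-- |z| < r with both sides squared, so that no square root is needed.
∣_∣<_ : ℂ → ℝ → Set
∣ z ∣< r = (0ℝ <ℝ r) × (∣ z ∣² <ℝ r *ℝ r)

-- Apartness from zero, i.e. "z ≠ 0" in the form needed to invert z.
_#0 : ℂ → Set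
z #0 = 0ℝ <ℝ ∣ z ∣²

-- z / w = z · w̄ · |w|⁻²
_/_[_] : (z w : ℂ) → w #0 → ℂ
z / w [ w#0 ] = z * ((re w *ℝ r) +i (-ℝ im w *ℝ r))
  where
  r : ℝ
  r = 1/ℝ ∣ w ∣² w#0

infix 4 _⟶_

_⟶_ : (ℕ → ℂ) → ℂ → Set
f ⟶ L = ∀ ε → 0ℝ <ℝ ε → ∃[ N ] (∀ n → N ℕ.≤ n → ∣ f n - L ∣< ε)

-- ∑< n f = f 0 + ⋯ + f (n - 1), and likewise ∏<.
∑< ∏< : ℕ → (ℕ → ℂ) → ℂ
∑< zero    f = 0ℂ
∑< (suc n) f = ∑< n f + f n
∏< zero    f = 1ℂ
∏< (suc n) f = ∏< n f * f n

-- f k + f (k + 1) + f (k + 2) + ⋯ converges to S.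
∑[_≤∞]_⟶_ : ℕ → (ℕ → ℂ) → ℂ → Set
∑[ k ≤∞] f ⟶ S = (λ n → ∑< n (λ i → f (k ℕ.+ i))) ⟶ S

private abstract
  ∣∣²-* : ∀ z w n → seq ∣ z * w ∣² n ≡ seq ∣ z ∣² n ℚ.* seq ∣ w ∣² n
  ∣∣²-* z w n = solve 4
    (λ a b c d →
      (a :* c :+ :- (b :* d)) :* (a :* c :+ :- (b :* d)) :+ (a :* d :+ b :* c) :* (a :* d :+ b :* c)
      := (a :* a :+ b :* b) :* (c :* c :+ d :* d))
    refl (seq (re z) n) (seq (im z) n) (seq (re w) n) (seq (im w) n)

  0≤∣∣² : ∀ z n → 0ℚ ℚ.≤ seq ∣ z ∣² n
  0≤∣∣² z n = 0≤p*p+q*q (seq (re z) n) (seq (im z) n)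

abstract
  1#0 : 1ℂ #0
  1#0 = 1ℚ , 0<1 , 0 , λ _ _ → ℚ.≤-refl

  *-#0 : ∀ z w → z #0 → w #0 → z * w #0
  *-#0 z w (ε , 0<ε , M , hM) (η , 0<η , N , hN) =
    ε ℚ.* η , *-pos 0<ε 0<η , M ℕ.⊔ N , λ n n≥ →
      subst₂ ℚ._≤_ (sym (ℚ.+-identityˡ (ε ℚ.* η))) (sym (∣∣²-* z w n))
        (*-mono-≤ (ℚ.<⇒≤ 0<ε) (0≤∣∣² w n)
          (subst (ℚ._≤ seq ∣ z ∣² n) (ℚ.+-identityˡ ε) (hM n (ℕ.≤-trans (ℕ.m≤m⊔n M N) n≥)))
          (subst (ℚ._≤ seq ∣ w ∣² n) (ℚ.+-identityˡ η) (hN n (ℕ.≤-trans (ℕ.m≤n⊔m M N) n≥))))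

  ∏<-#0 : ∀ n f → (∀ i → f i #0) → ∏< n f #0
  ∏<-#0 zero    f h = 1#0
  ∏<-#0 (suc n) f h = *-#0 (∏< n f) (f n) (∏<-#0 n f h) (h n)

  ∣z^1+n∣<1 : ∀ z n → ∣ z ∣< 1ℝ → ∣ z ^ suc n ∣< 1ℝ
  ∣z^1+n∣<1 z zero (p , ε , 0<ε , N , hN) = p , ε , 0<ε , N , λ n n≥ →
    subst (λ x → x ℚ.+ ε ℚ.≤ 1ℚ)
      (sym (trans (∣∣²-* z 1ℂ n) (ℚ.*-identityʳ (seq ∣ z ∣² n)))) (hN n n≥)
  ∣z^1+n∣<1 z (suc m) ∣z∣<1@(p , ε , 0<ε , M , hM)
    with ∣z^1+n∣<1 z m ∣z∣<1
  ... | _ , η , 0<η , N , hN = p , ε , 0<ε , M ℕ.⊔ N , λ n n≥ →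
    let
      Z = seq ∣ z ∣² n
      W = seq ∣ z ^ suc m ∣² n
      W≤1 : W ℚ.≤ 1ℚ
      W≤1 = ℚ.≤-trans (p≤p+q W (ℚ.<⇒≤ 0<η)) (hN n (ℕ.≤-trans (ℕ.m≤n⊔m M N) n≥))
      ZW≤Z : Z ℚ.* W ℚ.≤ Z
      ZW≤Z = subst (Z ℚ.* W ℚ.≤_) (ℚ.*-identityʳ Z)
        (ℚ.*-monoˡ-≤-nonNeg Z {{ℚ.nonNegative (0≤∣∣² z n)}} W≤1)
    in ℚ.≤-trans
         (ℚ.+-monoˡ-≤ ε (subst (ℚ._≤ Z) (sym (∣∣²-* z (z ^ suc m) n)) ZW≤Z))
         (hM n (ℕ.≤-trans (ℕ.m≤m⊔n M N) n≥))

  -- From |z|² + ε ≤ 1 and a = re z: 2(1 - a) = (1 - a²) + (1 - a)² ≥ ε.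
  1-z#0 : ∀ z → ∣ z ∣< 1ℝ → 1ℂ - z #0
  1-z#0 z (_ , ε , 0<ε , N , hN) =
    δ ℚ.* δ , *-pos (½-pos 0<ε) (½-pos 0<ε) , N , λ n n≥ →
      let
        a = seq (re z) n
        b = seq (im z) n
        c = 1ℚ ℚ.- a
        ε≤2c : ε ℚ.≤ c ℚ.+ c
        ε≤2c = subst (ε ℚ.≤_)
          (trans (solve 2 (λ a l → (l :* l :- a :* a) :+ (l :- a) :* (l :- a)
                              := l :* (l :- a) :+ l :* (l :- a)) refl a 1ℚ)
            (cong₂ ℚ._+_ (ℚ.*-identityˡ c) (ℚ.*-identityˡ c)))
          (ℚ.≤-trans
            (subst₂ ℚ._≤_
              (solve 3 (λ a b e → (a :* a :+ b :* b :+ e) :+ :- (a :* a :+ b :* b) := e) refl a b ε)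
              refl
              (ℚ.+-monoˡ-≤ (ℚ.- (a ℚ.* a ℚ.+ b ℚ.* b)) (hN n n≥)))
            (ℚ.≤-trans
              (ℚ.+-monoʳ-≤ 1ℚ (ℚ.neg-antimono-≤ (p≤p+q (a ℚ.* a) (0≤p*p b))))
              (p≤p+q (1ℚ ℚ.- a ℚ.* a) (0≤p*p c))))
        δ≤c : δ ℚ.≤ c
        δ≤c = subst (δ ℚ.≤_) (trans (ℚ.*-distribˡ-+ ½ c c) (halves c))
          (ℚ.*-monoˡ-≤-nonNeg ½ ε≤2c)
        0≤δ = ℚ.<⇒≤ (½-pos 0<ε)
      in subst (ℚ._≤ seq ∣ 1ℂ - z ∣² n) (sym (ℚ.+-identityˡ (δ ℚ.* δ)))
           (ℚ.≤-trans (*-mono-≤ 0≤δ (ℚ.≤-trans 0≤δ δ≤c) δ≤c δ≤c)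
             (p≤p+q (c ℚ.* c) (0≤p*p (0ℚ ℚ.- b))))
    where
    δ : ℚ
    δ = ½ ℚ.* ε

-- (a ; x)_M
⟨_⨾_⟩_ : ℂ → ℂ → ℕ → ℂ
⟨ a ⨾ x ⟩ M = ∏< M (λ i → 1ℂ - a * x ^ i)

-- (a ; x)_∞ = L, as convergence of the infinite product.
⟨_⨾_⟩∞⟶_ : ℂ → ℂ → ℂ → Set
⟨ a ⨾ x ⟩∞⟶ L = (λ M → ⟨ a ⨾ x ⟩ M) ⟶ L

⟨x⨾x⟩#0 : ∀ x → ∣ x ∣< 1ℝ → ∀ M → ⟨ x ⨾ x ⟩ M #0
⟨x⨾x⟩#0 x ∣x∣<1 M =
  ∏<-#0 M (λ i → 1ℂ - x * x ^ i) (λ i → 1-z#0 (x * x ^ i) (∣z^1+n∣<1 x i ∣x∣<1))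

-- Meaningful for N ≤ M only (∸ is truncated subtraction).
gauss : (x : ℂ) → ∣ x ∣< 1ℝ → (M N : ℕ) → ℂ
gauss x ∣x∣<1 M N =
  ⟨ x ⨾ x ⟩ M / ⟨ x ⨾ x ⟩ N * ⟨ x ⨾ x ⟩ (M ∸ N)
    [ *-#0 (⟨ x ⨾ x ⟩ N) (⟨ x ⨾ x ⟩ (M ∸ N)) (⟨x⨾x⟩#0 x ∣x∣<1 N) (⟨x⨾x⟩#0 x ∣x∣<1 (M ∸ N)) ]

module Submission where

{-
Write x = q², a_n = (-q;x)_n, b_n = (x;x)_n, p_n = a_n / b_n and F_j = Σ_m p_m x^{jm}, and let t_k(m)
be the summand of the right-hand series at n = k + m, with the convention that the series for k = 0
is 1 + 0 + 0 + ⋯.  Consecutive series combine termwise: with G_k = a_k q^{k(2k+1)} / b_k,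

  t_k(m) + t_{k+1}(m - 1) = G_k (p_m x^{(k+1)m} - q^{4k+2} p_{m-1} x^{(k+1)(m-1)}),

so that T_k = Σ_m t_k(m) satisfies T_k + T_{k+1} = G_k (1 - q^{4k+2}) F_{k+1}.  The q-binomial
recurrence (1 - x^j) F_j = (1 + q x^j) F_{j+1} holds for partial sums up to a boundary term
x^{jN} p_N (1 - x^N); at j = 0 this boundary term is all that is left, which evaluates F_1, and then
a_{k+1} F_{k+1} = P b_k with P = lim p_N = (-q;x)_∞ / (x;x)_∞.  Hence
T_k + T_{k+1} = P q^{k(2k+1)} (1 - q^{2k+1}), and the theorem follows by induction on k from T_0 = 1.
-}

-- Every identity between series is proved first for partial sums, exactly and for each N, so no
-- convergence test for series enters: the analytic input is p_N → P and x^N → 0. The first of these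
-- is the costly one. It needs both infinite products to converge and B = (x;x)_∞ to be apart from
-- zero, all with explicit rational bounds. The termwise combination works because, over the common
-- denominator (1 - x^m)(1 - x^(k+m)), the numerator turns out to be divisible by 1 - x^(k+m). No
-- division by 1 + q^(2k+1) ever occurs: in 1 - q^(4k+2) = (1 - q^(2k+1))(1 + q^(2k+1)) the last
-- factor turns the a_k inside G_k into a_(k+1), and it is the product a_(k+1) F_(k+1), not F_(k+1),
-- whose limit is computed. The algebra lives over an arbitrary commutative ring with an abstract
-- convergence relation, which keeps Cauchy sequences out of the ring identities; complex numbers
-- come in only at the end.

open import Algebra.Bundles using (CommutativeRing)
open import Data.Nat.Base as ℕ using (ℕ; zero; suc; _∸_)
import Data.Nat.Properties as ℕ
import Relation.Binary.PropositionalEquality as ≡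
open ≡ using (_≡_)

-- A ring solver with integer coefficients for any commutative ring.

module IntegerCoefficients {c ℓ} (R : CommutativeRing c ℓ) where
  open CommutativeRing R
  open import Algebra.Properties.Ring ring
  open import Algebra.Properties.AbelianGroup +-abelianGroup using (⁻¹-∙-comm)
  open import Algebra.Properties.Semiring.Mult.TCOptimised semiring
  open import Relation.Binary.Reasoning.Setoid setoid
  open import Algebra.Solver.Ring.AlmostCommutativeRing
  open import Data.Integer.Base as ℤ using (ℤ; +_; -[1+_]; _⊖_; _◃_)
  import Data.Integer.Properties as ℤ
  import Data.Sign.Base as Sign
  open import Data.Maybe.Base using (map)
  open import Relation.Nullary.Decidable.Core using (dec⇒maybe)

  -- With the optimised multiple, `1 × 1#` computes to `1#`, so `con (+ 1)` in a solver equation is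
  -- the `1#` of the goal itself, and `0-homo`, `1-homo` are `refl`.
  ⟦_⟧ℤ : ℤ → Carrier
  ⟦ + n      ⟧ℤ = n × 1#
  ⟦ -[1+ n ] ⟧ℤ = - (suc n × 1#)

  suc-× : ∀ n → suc n × 1# ≈ 1# + n × 1#
  suc-× n = ×-homo-+ 1# 1 n

  ⊖-homo : ∀ m n → ⟦ m ⊖ n ⟧ℤ ≈ m × 1# - n × 1#
  ⊖-homo m zero = sym (trans (+-congˡ -0#≈0#) (+-identityʳ _))
  ⊖-homo zero (suc n) = sym (+-identityˡ _)
  ⊖-homo (suc m) (suc n) = begin
    ⟦ suc m ⊖ suc n ⟧ℤ                     ≡⟨ ≡.cong ⟦_⟧ℤ (ℤ.[1+m]⊖[1+n]≡m⊖n m n) ⟩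
    ⟦ m ⊖ n ⟧ℤ                             ≈⟨ ⊖-homo m n ⟩
    m × 1# - n × 1#                        ≈⟨ +-congʳ (sym (trans (+-congʳ (-‿inverseʳ 1#)) (+-identityˡ _))) ⟩
    (1# - 1# + m × 1#) - n × 1#            ≈⟨ +-congʳ (trans (+-assoc _ _ _) (trans (+-congˡ (+-comm _ _)) (sym (+-assoc _ _ _)))) ⟩
    (1# + m × 1# - 1#) - n × 1#            ≈⟨ +-assoc _ _ _ ⟩
    (1# + m × 1#) + (- 1# - n × 1#)        ≈⟨ +-congˡ (⁻¹-∙-comm _ _) ⟩
    (1# + m × 1#) - (1# + n × 1#)          ≈⟨ +-cong (suc-× m) (-‿cong (suc-× n)) ⟨
    suc m × 1# - suc n × 1#                ∎

  +-homo : ∀ i j → ⟦ i ℤ.+ j ⟧ℤ ≈ ⟦ i ⟧ℤ + ⟦ j ⟧ℤ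
  +-homo (+ m)    (+ n)    = ×-homo-+ 1# m n
  +-homo (+ m)    -[1+ n ] = ⊖-homo m (suc n)
  +-homo -[1+ m ] (+ n)    = trans (⊖-homo n (suc m)) (+-comm _ _)
  +-homo -[1+ m ] -[1+ n ] = begin
    - (suc (suc (m ℕ.+ n)) × 1#)           ≡⟨ ≡.cong (λ k → - (k × 1#)) (≡.cong suc (≡.sym (ℕ.+-suc m n))) ⟩
    - ((suc m ℕ.+ suc n) × 1#)             ≈⟨ -‿cong (×-homo-+ 1# (suc m) (suc n)) ⟩
    - (suc m × 1# + suc n × 1#)            ≈⟨ ⁻¹-∙-comm _ _ ⟨
    - (suc m × 1#) - (suc n × 1#)          ∎

  -‿homo : ∀ i → ⟦ ℤ.- i ⟧ℤ ≈ - ⟦ i ⟧ℤ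
  -‿homo (+ zero)  = sym -0#≈0#
  -‿homo (+ suc n) = refl
  -‿homo -[1+ n ]  = sym (-‿involutive _)

  +◃-homo : ∀ n → ⟦ Sign.+ ◃ n ⟧ℤ ≈ n × 1#
  +◃-homo n = reflexive (≡.cong ⟦_⟧ℤ (ℤ.+◃n≡+n n))

  -◃-homo : ∀ n → ⟦ Sign.- ◃ n ⟧ℤ ≈ - (n × 1#)
  -◃-homo zero    = sym -0#≈0#
  -◃-homo (suc n) = refl

  *-homo : ∀ i j → ⟦ i ℤ.* j ⟧ℤ ≈ ⟦ i ⟧ℤ * ⟦ j ⟧ℤ
  *-homo (+ m)    (+ n)    = trans (+◃-homo (m ℕ.* n)) (×1-homo-* m n)
  *-homo (+ m)    -[1+ n ] = trans (-◃-homo (m ℕ.* suc n))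
    (trans (-‿cong (×1-homo-* m (suc n))) (-‿distribʳ-* _ _))
  *-homo -[1+ m ] (+ n)    = trans (-◃-homo (suc m ℕ.* n))
    (trans (-‿cong (×1-homo-* (suc m) n)) (-‿distribˡ-* _ _))
  *-homo -[1+ m ] -[1+ n ] = begin
    ⟦ Sign.+ ◃ (suc m ℕ.* suc n) ⟧ℤ        ≈⟨ +◃-homo (suc m ℕ.* suc n) ⟩
    (suc m ℕ.* suc n) × 1#                 ≈⟨ ×1-homo-* (suc m) (suc n) ⟩
    (suc m × 1#) * (suc n × 1#)            ≈⟨ -‿involutive _ ⟨
    - - ((suc m × 1#) * (suc n × 1#))      ≈⟨ -‿cong (-‿distribˡ-* _ _) ⟩
    - (- (suc m × 1#) * (suc n × 1#))      ≈⟨ -‿distribʳ-* _ _ ⟩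
    - (suc m × 1#) * - (suc n × 1#)        ∎

  -- The solver must recognise vanishing coefficients in order to cancel terms. Equality in the ring
  -- itself may be undecidable, as it is for Cauchy reals, whereas on integers it can be decided.
  morphism : ℤ.+-*-rawRing -Raw-AlmostCommutative⟶ fromCommutativeRing R
  morphism = record
    { ⟦_⟧    = ⟦_⟧ℤ
    ; +-homo = +-homo
    ; *-homo = *-homo
    ; -‿homo = -‿homo
    ; 0-homo = refl
    ; 1-homo = refl
    }

  open import Algebra.Solver.Ring ℤ.+-*-rawRing (fromCommutativeRing R) morphism
    (λ i j → map (λ i≡j → reflexive (≡.cong ⟦_⟧ℤ i≡j)) (dec⇒maybe (i ℤ.≟ j)))
    public

module RingLemmas {ℓ₁ ℓ₂} (R : CommutativeRing ℓ₁ ℓ₂) where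
  open CommutativeRing R
  open IntegerCoefficients R using (solve; _:=_; _:+_; _:*_; _:-_; :-_; con)
  open import Data.Integer.Base using (+_)
  open import Relation.Binary.Reasoning.Setoid setoid

  -- This is 1/g = (1/g)(1/b)(b - g) + 1/b. It exhibits 1/g as 1/b plus an error proportional to b -
  -- g, which gives continuity of inversion.
  inverse-difference : ∀ {b w g u} → b * w ≈ 1# → g * u ≈ 1# → u * (w * (b - g)) + w ≈ u
  inverse-difference {b} {w} {g} {u} bw gu = begin
    u * (w * (b - g)) + w
      ≈⟨ solve 4 (λ b w g u → u :* (w :* (b :- g)) :+ w := u :* (b :* w) :- (g :* u) :* w :+ w) refl b w g u ⟩
    u * (b * w) - (g * u) * w + w
      ≈⟨ +-congʳ (+-cong (*-congˡ bw) (-‿cong (*-congʳ gu))) ⟩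
    u * 1# - 1# * w + w
      ≈⟨ solve 2 (λ u w → u :* con (+ 1) :- con (+ 1) :* w :+ w := u) refl u w ⟩
    u ∎

  w*[b+-1*b]≈0 : ∀ b w → w * (b + - 1# * b) ≈ 0#
  w*[b+-1*b]≈0 = solve 2 (λ b w → w :* (b :+ :- con (+ 1) :* b) := con (+ 0)) refl

  w*[b+-1*g]≈w*[b-g] : ∀ b w g → w * (b + - 1# * g) ≈ w * (b - g)
  w*[b+-1*g]≈w*[b-g] = solve 3 (λ b w g → w :* (b :+ :- con (+ 1) :* g) := w :* (b :- g)) refl

-- Exact identities for the partial sums of the series.

module Powers {ℓ₁ ℓ₂} (R : CommutativeRing ℓ₁ ℓ₂) where
  open CommutativeRing R
  open import Algebra.Properties.Semiring.Exp semiring using (_^_; ^-congˡ; ^-homo-*; ^-assocʳ)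

  -- The shifted factorials are present only through their recurrences, and `ι` plays 1/b, so that
  -- every quotient is a product in the ring.
  module QSeries (q x : Carrier) (q^2≈x : q ^ 2 ≈ x) (a b ι : ℕ → Carrier)
    (a-zero : a 0 ≈ 1#) (a-suc : ∀ n → a (suc n) ≈ a n * (1# - - q * x ^ n))
    (b-zero : b 0 ≈ 1#) (b-suc : ∀ n → b (suc n) ≈ b n * (1# - x * x ^ n))
    (b*ι : ∀ n → b n * ι n ≈ 1#) where

    open IntegerCoefficients R
      using (solve; _:=_; _:+_; _:*_; _:-_; :-_; con)
    open import Data.Integer.Base using (+_)
    open import Relation.Binary.Reasoning.Setoid setoid
    open import Data.Nat.Solver using (module +-*-Solver)

    q*q≈x : q * q ≈ x
    q*q≈x = trans (*-congˡ (sym (*-identityʳ q))) q^2≈x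

    x^≈q^ : ∀ k → x ^ k ≈ q ^ (2 ℕ.* k)
    x^≈q^ k = trans (^-congˡ k (sym q^2≈x)) (^-assocʳ q 2 k)

    -- This is 1/(1 - x^(n+1)), assembled from the inverses already at hand.
    d : ℕ → Carrier
    d n = b n * ι (suc n)

    p : ℕ → Carrier
    p n = a n * ι n

    E : ℕ → Carrier
    E k = q ^ (k ℕ.* (2 ℕ.* k ℕ.+ 1))

    -- t (k , n - k) in the paper's numbering; the empty k = 0 series is taken to be 1 + 0 + 0 + ⋯.
    t : ℕ → ℕ → Carrier
    t zero    zero    = 1#
    t zero    (suc m) = 0#
    t (suc k) m       = a (suc k) * ι k * p m * (E (suc k) * x ^ (suc (suc k) ℕ.* m)) * d (k ℕ.+ m)

    Σ< : ℕ → (ℕ → Carrier) → Carrier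
    Σ< zero    f = 0#
    Σ< (suc n) f = Σ< n f + f n

    F : ℕ → ℕ → Carrier
    F j N = Σ< N (λ m → p m * x ^ (j ℕ.* m))

    ι-zero : ι 0 ≈ 1#
    ι-zero = begin
      ι 0        ≈⟨ *-identityˡ _ ⟨
      1# * ι 0   ≈⟨ *-congʳ b-zero ⟨
      b 0 * ι 0  ≈⟨ b*ι 0 ⟩
      1#         ∎

    d-inverse : ∀ n → (1# - x * x ^ n) * d n ≈ 1#
    d-inverse n = begin
      (1# - x * x ^ n) * (b n * ι (suc n))
        ≈⟨ solve 3 (λ u v w → u :* (v :* w) := v :* u :* w) refl (1# - x * x ^ n) (b n) (ι (suc n)) ⟩
      b n * (1# - x * x ^ n) * ι (suc n)    ≈⟨ *-congʳ (b-suc n) ⟨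
      b (suc n) * ι (suc n)                 ≈⟨ b*ι (suc n) ⟩
      1#                                    ∎

    ι-suc : ∀ n → ι (suc n) ≈ ι n * d n
    ι-suc n = begin
      ι (suc n)              ≈⟨ *-identityˡ _ ⟨
      1# * ι (suc n)         ≈⟨ *-congʳ (b*ι n) ⟨
      b n * ι n * ι (suc n)  ≈⟨ solve 3 (λ u v w → u :* v :* w := v :* (u :* w)) refl (b n) (ι n) (ι (suc n)) ⟩
      ι n * d n              ∎

    ι-pred : ∀ n → ι n ≈ ι (suc n) * (1# - x * x ^ n)
    ι-pred n = begin
      ι n                                 ≈⟨ *-identityʳ _ ⟨
      ι n * 1#                            ≈⟨ *-congˡ (d-inverse n) ⟨
      ι n * ((1# - x * x ^ n) * d n)      ≈⟨ solve 3 (λ u v w → u :* (v :* w) := u :* w :* v) refl (ι n) (1# - x * x ^ n) (d n) ⟩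
      ι n * d n * (1# - x * x ^ n)        ≈⟨ *-congʳ (ι-suc n) ⟨
      ι (suc n) * (1# - x * x ^ n)        ∎

    p-zero : p 0 ≈ 1#
    p-zero = trans (*-cong a-zero ι-zero) (*-identityˡ 1#)

    p-suc : ∀ n → p (suc n) ≈ p n * (1# + q * x ^ n) * d n
    p-suc n = trans (*-cong (a-suc n) (ι-suc n))
      (solve 5 (λ u v q z w → u :* (con (+ 1) :- :- q :* z) :* (v :* w)
                            := u :* v :* (con (+ 1) :+ q :* z) :* w)
        refl (a n) (ι n) q (x ^ n) (d n))

    p-suc′ : ∀ n → p (suc n) * (1# - x ^ suc n) ≈ p n * (1# + q * x ^ n)
    p-suc′ n = begin
      p (suc n) * (1# - x ^ suc n)                          ≈⟨ *-congʳ (p-suc n) ⟩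
      p n * (1# + q * x ^ n) * d n * (1# - x * x ^ n)       ≈⟨ trans (*-assoc _ _ _) (*-congˡ (*-comm _ _)) ⟩
      p n * (1# + q * x ^ n) * ((1# - x * x ^ n) * d n)     ≈⟨ trans (*-congˡ (d-inverse n)) (*-identityʳ _) ⟩
      p n * (1# + q * x ^ n)                                ∎

    x^-*suc : ∀ j n → x ^ (j ℕ.* suc n) ≈ x ^ (j ℕ.* n) * x ^ j
    x^-*suc j n = trans (reflexive (≡.cong (x ^_) (≡.trans (ℕ.*-suc j n) (ℕ.+-comm j _))))
      (^-homo-* x (j ℕ.* n) j)

    x^-suc* : ∀ j n → x ^ (suc j ℕ.* n) ≈ x ^ (j ℕ.* n) * x ^ n
    x^-suc* j n = trans (^-homo-* x n (j ℕ.* n)) (*-comm _ _)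

    E-suc : ∀ k → E (suc k) ≈ E k * (x ^ k * x ^ k * (q * x))
    E-suc k = begin
      q ^ (suc k ℕ.* (2 ℕ.* suc k ℕ.+ 1))                ≡⟨ ≡.cong (q ^_) (+-*-Solver.solve 1 (λ k →
         (con′ 1 :+′ k) :*′ (con′ 2 :*′ (con′ 1 :+′ k) :+′ con′ 1)
         :=′ k :*′ (con′ 2 :*′ k :+′ con′ 1) :+′ (con′ 2 :*′ k :+′ con′ 2 :*′ k :+′ con′ 3)) ≡.refl k) ⟩
      q ^ (k ℕ.* (2 ℕ.* k ℕ.+ 1) ℕ.+ (2 ℕ.* k ℕ.+ 2 ℕ.* k ℕ.+ 3)) ≈⟨ ^-homo-* q (k ℕ.* (2 ℕ.* k ℕ.+ 1)) _ ⟩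
      E k * q ^ (2 ℕ.* k ℕ.+ 2 ℕ.* k ℕ.+ 3)              ≈⟨ *-congˡ (trans (^-homo-* q (2 ℕ.* k ℕ.+ 2 ℕ.* k) 3) (*-congˡ (*-congˡ q^2≈x))) ⟩
      E k * (q ^ (2 ℕ.* k ℕ.+ 2 ℕ.* k) * (q * x))        ≈⟨ *-congˡ (*-congʳ (trans (^-homo-* q (2 ℕ.* k) (2 ℕ.* k))
                                                              (sym (*-cong (x^≈q^ k) (x^≈q^ k))))) ⟩
      E k * (x ^ k * x ^ k * (q * x))                    ∎
      where open +-*-Solver using () renaming (con to con′; _:+_ to _:+′_; _:*_ to _:*′_; _:=_ to _:=′_)

    -- The q-binomial recurrence F(c) - F(xc) = c F(c) + q c F(xc) at c = x ^ j, with its boundary term.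
    F-recurrence : ∀ j N →
      (1# - x ^ j) * F j N + x ^ (j ℕ.* N) * (p N * (1# - x ^ N)) ≈ (1# + q * x ^ j) * F (suc j) N
    F-recurrence j zero =
      solve 4 (λ w c p q → (con (+ 1) :- w) :* con (+ 0) :+ c :* (p :* (con (+ 1) :- con (+ 1)))
                         := (con (+ 1) :+ q :* w) :* con (+ 0))
        refl (x ^ j) (x ^ (j ℕ.* 0)) (p 0) q
    F-recurrence j (suc N) = begin
      (1# - w) * (F j N + p N * c) + x ^ (j ℕ.* suc N) * (p (suc N) * (1# - x ^ suc N))
        ≈⟨ +-congˡ (*-cong (x^-*suc j N) (p-suc′ N)) ⟩
      (1# - w) * (F j N + p N * c) + c * w * (p N * (1# + q * z))
        ≈⟨ solve 6 (λ w f p c z q →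
             (con (+ 1) :- w) :* (f :+ p :* c) :+ c :* w :* (p :* (con (+ 1) :+ q :* z))
             := ((con (+ 1) :- w) :* f :+ c :* (p :* (con (+ 1) :- z)))
                :+ (con (+ 1) :+ q :* w) :* (p :* (c :* z)))
             refl w (F j N) (p N) c z q ⟩
      ((1# - w) * F j N + c * (p N * (1# - z))) + (1# + q * w) * (p N * (c * z))
        ≈⟨ +-cong (F-recurrence j N) (*-congˡ (*-congˡ (sym (x^-suc* j N)))) ⟩
      (1# + q * w) * F (suc j) N + (1# + q * w) * (p N * x ^ (suc j ℕ.* N))
        ≈⟨ distribˡ _ _ _ ⟨
      (1# + q * w) * F (suc j) (suc N) ∎
      where
      w = x ^ j
      z = x ^ N
      c = x ^ (j ℕ.* N)

    G : ℕ → Carrier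
    G k = a k * ι k * E k

    t-zeroʳ : ∀ k → t k 0 ≈ G k
    t-zeroʳ zero = sym (trans (*-identityʳ _) p-zero)
    t-zeroʳ (suc k) = begin
      a (suc k) * ι k * p 0 * (E (suc k) * x ^ (suc (suc k) ℕ.* 0)) * d (k ℕ.+ 0)
        ≈⟨ *-cong (*-cong (*-congˡ p-zero)
                          (*-congˡ (reflexive (≡.cong (x ^_) (ℕ.*-zeroʳ (suc (suc k)))))))
                  (reflexive (≡.cong d (ℕ.+-identityʳ k))) ⟩
      a (suc k) * ι k * 1# * (E (suc k) * 1#) * d k
        ≈⟨ solve 4 (λ u v w e → u :* v :* con (+ 1) :* (e :* con (+ 1)) :* w := u :* (v :* w) :* e)
             refl (a (suc k)) (ι k) (d k) (E (suc k)) ⟩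
      a (suc k) * (ι k * d k) * E (suc k)  ≈⟨ *-congʳ (*-congˡ (ι-suc k)) ⟨
      G (suc k) ∎

    -- The factor `1# - x ^ k` appears when 1/b_(k-1) is rewritten as (1 - x^k)/b_k to expose `G k`.
    -- At k = 0 it vanishes, which is why the convention 1 + 0 + 0 + ⋯ for `t zero` fits the same
    -- formula.
    t-sucʳ : ∀ k m → t k (suc m) ≈
      G k * (1# - x ^ k) * (p m * (1# + q * x ^ m) * d m) * (x ^ (suc k ℕ.* m) * (x * x ^ k)) * d (k ℕ.+ m)
    t-sucʳ zero m = solve 5 (λ g u c x d →
      con (+ 0) := g :* (con (+ 1) :- con (+ 1)) :* u :* (c :* (x :* con (+ 1))) :* d)
      refl (G 0) (p m * (1# + q * x ^ m) * d m) (x ^ (1 ℕ.* m)) x (d m)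
    t-sucʳ (suc k) m = begin
      a (suc k) * ι k * p (suc m) * (E (suc k) * x ^ (suc (suc k) ℕ.* suc m)) * d (k ℕ.+ suc m)
        ≈⟨ *-cong (*-cong (*-cong (*-congˡ (ι-pred k)) (p-suc m)) (*-congˡ (x^-*suc (suc (suc k)) m)))
                  (reflexive (≡.cong d (ℕ.+-suc k m))) ⟩
      a (suc k) * (ι (suc k) * X) * P * (E (suc k) * (c * C)) * d (suc k ℕ.+ m)
        ≈⟨ solve 8 (λ a ι X P E c C d → a :* (ι :* X) :* P :* (E :* (c :* C)) :* d
                                     := a :* ι :* E :* X :* P :* (c :* C) :* d)
             refl (a (suc k)) (ι (suc k)) X P (E (suc k)) c C (d (suc k ℕ.+ m)) ⟩
      G (suc k) * X * P * (c * C) * d (suc k ℕ.+ m) ∎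
      where
      X = 1# - x ^ suc k
      P = p m * (1# + q * x ^ m) * d m
      c = x ^ (suc (suc k) ℕ.* m)
      C = x ^ suc (suc k)

    -- Exposes the same factor `G k` as in `t-sucʳ`: `a-suc` contributes 1 + q x^k, and `E-suc` the
    -- power q^(4k+3).
    t-sucˡ : ∀ k m → t (suc k) m ≈
      G k * (1# + q * x ^ k) * p m * (x ^ k * x ^ k * (q * x) * (x ^ (suc k ℕ.* m) * x ^ m)) * d (k ℕ.+ m)
    t-sucˡ k m = trans
      (*-congʳ (*-cong (*-congʳ (*-congʳ (a-suc k))) (*-cong (E-suc k) (x^-suc* (suc k) m))))
      (solve 10 (λ a q X ι p E Q c z d →
        a :* (con (+ 1) :- :- q :* X) :* ι :* p :* (E :* Q :* (c :* z)) :* d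
        := a :* ι :* E :* (con (+ 1) :+ q :* X) :* p :* (Q :* (c :* z)) :* d)
        refl (a k) q (x ^ k) (ι k) (p m) (E k) (x ^ k * x ^ k * (q * x)) (x ^ (suc k ℕ.* m)) (x ^ m) (d (k ℕ.+ m)))

    -- The cancellation at the heart of `t-pair`. Multiplying the second term by (1 - q²z) δ = 1
    -- gives both terms the denominator (1 - q²z)(1 - q²Xz). The joint numerator is then ((1 + qz) -
    -- X(1 - q²z))(1 - q²Xz), so `d` disappears.
    insert-inverses : ∀ q X z δ d →
      (1# - q * q * z) * δ ≈ 1# → (1# - q * q * (X * z)) * d ≈ 1# →
      (1# - X) * (1# + q * z) * δ * d + (1# + q * X) * X * q * z * d ≈ (1# + q * z) * δ - X
    insert-inverses q X z δ d hδ hd = begin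
      (1# - X) * (1# + q * z) * δ * d + (1# + q * X) * X * q * z * d
        ≈⟨ +-congˡ (trans (sym (*-identityʳ _)) (*-congˡ (sym hδ))) ⟩
      (1# - X) * (1# + q * z) * δ * d + (1# + q * X) * X * q * z * d * ((1# - q * q * z) * δ)
        ≈⟨ solve 5 (λ q X z δ d → let 1' = con (+ 1) in
             (1' :- X) :* (1' :+ q :* z) :* δ :* d
               :+ (1' :+ q :* X) :* X :* q :* z :* d :* ((1' :- q :* q :* z) :* δ)
             := ((1' :+ q :* z) :* δ :- X :* ((1' :- q :* q :* z) :* δ))
               :* ((1' :- q :* q :* (X :* z)) :* d))
             refl q X z δ d ⟩
      ((1# + q * z) * δ - X * ((1# - q * q * z) * δ)) * ((1# - q * q * (X * z)) * d)
        ≈⟨ trans (*-cong (+-congˡ (-‿cong (trans (*-congˡ hδ) (*-identityʳ X)))) hd) (*-identityʳ _) ⟩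
      (1# + q * z) * δ - X ∎

    t-pair : ∀ k m →
      t k (suc m) + t (suc k) m ≈
        G k * (p (suc m) * x ^ (suc k ℕ.* suc m) - x ^ k * (x * x ^ k) * (p m * x ^ (suc k ℕ.* m)))
    t-pair k m = begin
      t k (suc m) + t (suc k) m
        ≈⟨ +-cong (t-sucʳ k m) (t-sucˡ k m) ⟩
      G k * (1# - X) * (p m * (1# + q * z) * δ) * (c * (x * X)) * D
        + G k * (1# + q * X) * p m * (X * X * (q * x) * (c * z)) * D
        ≈⟨ solve 9 (λ G X p q z δ c x D → let 1' = con (+ 1) in
             G :* (1' :- X) :* (p :* (1' :+ q :* z) :* δ) :* (c :* (x :* X)) :* D
               :+ G :* (1' :+ q :* X) :* p :* (X :* X :* (q :* x) :* (c :* z)) :* D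
             := G :* p :* c :* (x :* X) :* ((1' :- X) :* (1' :+ q :* z) :* δ :* D
               :+ (1' :+ q :* X) :* X :* q :* z :* D))
             refl (G k) X (p m) q z δ c x D ⟩
      G k * p m * c * (x * X) * ((1# - X) * (1# + q * z) * δ * D + (1# + q * X) * X * q * z * D)
        ≈⟨ *-congˡ (insert-inverses q X z δ D
             (trans (*-congʳ (+-congˡ (-‿cong (*-congʳ q*q≈x)))) (d-inverse m))
             (trans (*-congʳ (+-congˡ (-‿cong (*-cong q*q≈x (sym (^-homo-* x k m)))))) (d-inverse (k ℕ.+ m)))) ⟩
      G k * p m * c * (x * X) * ((1# + q * z) * δ - X)
        ≈⟨ solve 7 (λ G p c C Z δ X → G :* p :* c :* C :* (Z :* δ :- X)
                      := G :* (p :* Z :* δ :* (c :* C) :- X :* C :* (p :* c)))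
             refl (G k) (p m) c (x * X) (1# + q * z) δ X ⟩
      G k * (p m * (1# + q * z) * δ * (c * (x * X)) - X * (x * X) * (p m * c))
        ≈⟨ *-congˡ (+-congʳ (sym (*-cong (p-suc m) (x^-*suc (suc k) m)))) ⟩
      G k * (p (suc m) * x ^ (suc k ℕ.* suc m) - X * (x * X) * (p m * c)) ∎
      where
      X = x ^ k
      z = x ^ m
      δ = d m
      D = d (k ℕ.+ m)
      c = x ^ (suc k ℕ.* m)

    -- Term m + 1 of one series is paired with term m of the next, so the first sum is one term
    -- longer. The unpaired `t k 0` equals `G k` and supplies the m = 0 term of `F`.
    Σt-pair : ∀ k N →
      Σ< (suc N) (t k) + Σ< N (t (suc k)) ≈ G k * (F (suc k) (suc N) - x ^ k * (x * x ^ k) * F (suc k) N)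
    Σt-pair k zero = begin
      0# + t k 0 + 0#
        ≈⟨ +-congʳ (+-congˡ (t-zeroʳ k)) ⟩
      0# + G k + 0#
        ≈⟨ solve 2 (λ G Y → con (+ 0) :+ G :+ con (+ 0)
                         := G :* ((con (+ 0) :+ con (+ 1) :* con (+ 1)) :- Y :* con (+ 0)))
             refl (G k) (x ^ k * (x * x ^ k)) ⟩
      G k * (0# + 1# * 1# - x ^ k * (x * x ^ k) * 0#)
        ≈⟨ *-congˡ (+-congʳ (+-congˡ (*-cong (sym p-zero)
             (reflexive (≡.cong (x ^_) (≡.sym (ℕ.*-zeroʳ (suc k)))))))) ⟩
      G k * (F (suc k) 1 - x ^ k * (x * x ^ k) * 0#) ∎
    Σt-pair k (suc N) = begin
      S₁ + t k (suc N) + (S₂ + t (suc k) N)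
        ≈⟨ solve 4 (λ u v w z → u :+ v :+ (w :+ z) := u :+ w :+ (v :+ z)) refl S₁ (t k (suc N)) S₂ (t (suc k) N) ⟩
      S₁ + S₂ + (t k (suc N) + t (suc k) N)
        ≈⟨ +-cong (Σt-pair k N) (t-pair k N) ⟩
      G k * (F₁ - Y * F₀) + G k * (f₁ - Y * f₀)
        ≈⟨ solve 6 (λ G Y F₁ F₀ f₁ f₀ → G :* (F₁ :- Y :* F₀) :+ G :* (f₁ :- Y :* f₀)
                     := G :* (F₁ :+ f₁ :- Y :* (F₀ :+ f₀))) refl (G k) Y F₁ F₀ f₁ f₀ ⟩
      G k * (F₁ + f₁ - Y * (F₀ + f₀)) ∎
      where
      S₁ = Σ< (suc N) (t k)
      S₂ = Σ< N (t (suc k))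
      Y = x ^ k * (x * x ^ k)
      F₁ = F (suc k) (suc N)
      F₀ = F (suc k) N
      f₁ = p (suc N) * x ^ (suc k ℕ.* suc N)
      f₀ = p N * x ^ (suc k ℕ.* N)

    -- The binomial coefficient over b_n is b_(n-1) / (b_n b_(k-1) b_(n-k)), and b_(n-1) / b_n
    -- collapses to a single `d`. Indices are variables tied by equations because the truncated
    -- subtractions of the statement do not reduce.
    term≈t : ∀ k m {Q l l′ n M N u w} → q ^ (2 ℕ.* (suc k ℕ.+ 1) ℕ.* (suc k ℕ.+ m) ∸ suc k) ≈ Q →
      l ≡ m → l′ ≡ m → n ≡ suc k ℕ.+ m → M ≡ k ℕ.+ m → N ≡ k → b n * u ≈ 1# → b N * b l′ * w ≈ 1# →
      a (suc k) * a l * Q * u * (b M * w) ≈ t (suc k) m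
    term≈t k m {Q} {u = u} {w} q^≈Q ≡.refl ≡.refl ≡.refl ≡.refl ≡.refl bu bbw = begin
      a (suc k) * a m * Q * u * (b (k ℕ.+ m) * w)
        ≈⟨ *-cong (*-cong (*-congˡ (trans (sym q^≈Q) q^e)) u≈) (*-congˡ w≈) ⟩
      a (suc k) * a m * (E (suc k) * x ^ (suc (suc k) ℕ.* m)) * ι (suc (k ℕ.+ m)) * (b (k ℕ.+ m) * (ι k * ι m))
        ≈⟨ solve 7 (λ a a′ e i b i′ i″ → a :* a′ :* e :* i :* (b :* (i′ :* i″)) := a :* i′ :* (a′ :* i″) :* e :* (b :* i))
             refl (a (suc k)) (a m) (E (suc k) * x ^ (suc (suc k) ℕ.* m)) (ι (suc (k ℕ.+ m))) (b (k ℕ.+ m)) (ι k) (ι m) ⟩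
      t (suc k) m ∎
      where
      open +-*-Solver using () renaming (con to con′; _:+_ to _:+′_; _:*_ to _:*′_; _:=_ to _:=′_)
      -- The subtraction is exact: with K = k + 1, 2(K+1)(K+m) = K(2K+1) + 2(K+1)m + K.
      exponent : 2 ℕ.* (suc k ℕ.+ 1) ℕ.* (suc k ℕ.+ m) ∸ suc k
               ≡ suc k ℕ.* (2 ℕ.* suc k ℕ.+ 1) ℕ.+ 2 ℕ.* (suc (suc k) ℕ.* m)
      exponent = ≡.trans
        (≡.cong (_∸ suc k) (+-*-Solver.solve 2 (λ k m →
          con′ 2 :*′ (con′ 1 :+′ k :+′ con′ 1) :*′ (con′ 1 :+′ k :+′ m)
          :=′ (con′ 1 :+′ k) :*′ (con′ 2 :*′ (con′ 1 :+′ k) :+′ con′ 1)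
              :+′ con′ 2 :*′ ((con′ 2 :+′ k) :*′ m) :+′ (con′ 1 :+′ k)) ≡.refl k m))
        (ℕ.m+n∸n≡m _ (suc k))
      q^e : q ^ (2 ℕ.* (suc k ℕ.+ 1) ℕ.* (suc k ℕ.+ m) ∸ suc k) ≈ E (suc k) * x ^ (suc (suc k) ℕ.* m)
      q^e = trans (reflexive (≡.cong (q ^_) exponent))
        (trans (^-homo-* q (suc k ℕ.* (2 ℕ.* suc k ℕ.+ 1)) (2 ℕ.* (suc (suc k) ℕ.* m)))
          (*-congˡ (sym (x^≈q^ (suc (suc k) ℕ.* m)))))
      -- Inverses are unique, so those produced by the divisions in the statement agree with `ι`;
      -- likewise for `w`.
      u≈ : u ≈ ι (suc (k ℕ.+ m))
      u≈ = begin
        u                                               ≈⟨ *-identityˡ u ⟨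
        1# * u                                          ≈⟨ *-congʳ (b*ι (suc (k ℕ.+ m))) ⟨
        b (suc (k ℕ.+ m)) * ι (suc (k ℕ.+ m)) * u       ≈⟨ solve 3 (λ b i u → b :* i :* u := b :* u :* i) refl (b (suc (k ℕ.+ m))) (ι (suc (k ℕ.+ m))) u ⟩
        b (suc (k ℕ.+ m)) * u * ι (suc (k ℕ.+ m))       ≈⟨ trans (*-congʳ bu) (*-identityˡ _) ⟩
        ι (suc (k ℕ.+ m))                               ∎
      w≈ : w ≈ ι k * ι m
      w≈ = begin
        w                                ≈⟨ trans (*-congʳ (*-identityˡ 1#)) (*-identityˡ w) ⟨
        1# * 1# * w                      ≈⟨ *-congʳ (*-cong (b*ι k) (b*ι m)) ⟨
        b k * ι k * (b m * ι m) * w      ≈⟨ solve 5 (λ b i b′ i′ w → b :* i :* (b′ :* i′) :* w := b :* b′ :* w :* (i :* i′))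
                                              refl (b k) (ι k) (b m) (ι m) w ⟩
        b k * b m * w * (ι k * ι m)      ≈⟨ trans (*-congʳ bbw) (*-identityˡ _) ⟩
        ι k * ι m                        ∎

    -- Passing to the limit, for an abstract convergence relation.

    module Limits {ℓ₃} (_⇝_ : (ℕ → Carrier) → Carrier → Set ℓ₃)
      (⇝-cong  : ∀ {f g L} → (∀ n → f n ≈ g n) → f ⇝ L → g ⇝ L)
      (⇝-congʳ : ∀ {f L M} → L ≈ M → f ⇝ L → f ⇝ M)
      (⇝-const : ∀ L → (λ _ → L) ⇝ L)
      (⇝-+ : ∀ {f g L M} → f ⇝ L → g ⇝ M → (λ n → f n + g n) ⇝ (L + M))
      (⇝-* : ∀ {f g L M} → f ⇝ L → g ⇝ M → (λ n → f n * g n) ⇝ (L * M))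
      (⇝-suc : ∀ {f L} → f ⇝ L → (λ n → f (suc n)) ⇝ L)
      (P : Carrier) (p⇝P : p ⇝ P) (x^⇝0 : (x ^_) ⇝ 0#) where

      scale : ∀ {f L} u → f ⇝ L → (λ n → u * f n) ⇝ (u * L)
      scale u = ⇝-* (⇝-const u)

      ⇝-- : ∀ {f g L M} → f ⇝ L → g ⇝ M → (λ n → f n - g n) ⇝ (L - M)
      ⇝-- f⇝L g⇝M = ⇝-cong (λ _ → +-congˡ (negate _)) (⇝-congʳ (+-congˡ (negate _)) (⇝-+ f⇝L (scale (- 1#) g⇝M)))
        where
        negate : ∀ u → - 1# * u ≈ - u
        negate = solve 1 (λ u → :- con (+ 1) :* u := :- u) refl

      x^[1+j]*⇝0 : ∀ j → (λ N → x ^ (suc j ℕ.* N)) ⇝ 0#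
      x^[1+j]*⇝0 zero    = ⇝-cong (λ N → reflexive (≡.cong (x ^_) (≡.sym (ℕ.+-identityʳ N)))) x^⇝0
      x^[1+j]*⇝0 (suc j) = ⇝-cong (λ N → sym (x^-suc* (suc j) N))
        (⇝-congʳ (zeroˡ 0#) (⇝-* (x^[1+j]*⇝0 j) x^⇝0))

      p[1-x^]⇝P : (λ N → p N * (1# - x ^ N)) ⇝ P
      p[1-x^]⇝P = ⇝-congʳ (solve 1 (λ P → P :* (con (+ 1) :- con (+ 0)) := P) refl P)
        (⇝-* p⇝P (⇝-- (⇝-const 1#) x^⇝0))

      -- Multiplying the recurrence by a_j turns its factor 1 + q x^j into a_(j+1), so nothing has
      -- to be divided. The boundary term tends to P at exponent 0, the base case, and to 0 at every
      -- later step because of its power of x.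
      a*F⇝P*b : ∀ j → (λ N → a (suc j) * F (suc j) N) ⇝ (P * b j)
      a*F⇝P*b zero = ⇝-cong eq (⇝-congʳ (trans (sym (*-identityʳ P)) (*-congˡ (sym b-zero))) p[1-x^]⇝P)
        where
        eq : ∀ N → p N * (1# - x ^ N) ≈ a 1 * F 1 N
        eq N = begin
          p N * (1# - x ^ N)
            ≈⟨ solve 2 (λ f u → u := (con (+ 1) :- con (+ 1)) :* f :+ con (+ 1) :* u) refl (F 0 N) (p N * (1# - x ^ N)) ⟩
          (1# - 1#) * F 0 N + 1# * (p N * (1# - x ^ N))  ≈⟨ F-recurrence 0 N ⟩
          (1# + q * 1#) * F 1 N
            ≈⟨ *-congʳ (solve 1 (λ q → con (+ 1) :+ q :* con (+ 1) := con (+ 1) :* (con (+ 1) :- :- q :* con (+ 1))) refl q) ⟩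
          1# * (1# - - q * 1#) * F 1 N                   ≈⟨ *-congʳ (trans (a-suc 0) (*-congʳ a-zero)) ⟨
          a 1 * F 1 N                                    ∎
      a*F⇝P*b (suc j) = ⇝-cong eq (⇝-congʳ lim
        (⇝-+ (scale (1# - x ^ suc j) (a*F⇝P*b j)) (scale (a (suc j)) (⇝-* (x^[1+j]*⇝0 j) p[1-x^]⇝P))))
        where
        lim : (1# - x ^ suc j) * (P * b j) + a (suc j) * (0# * P) ≈ P * b (suc j)
        lim = trans
          (solve 4 (λ u P b a → u :* (P :* b) :+ a :* (con (+ 0) :* P) := P :* (b :* u))
            refl (1# - x ^ suc j) P (b j) (a (suc j)))
          (*-congˡ (sym (b-suc j)))
        eq : ∀ N → (1# - x ^ suc j) * (a (suc j) * F (suc j) N)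
                     + a (suc j) * (x ^ (suc j ℕ.* N) * (p N * (1# - x ^ N)))
                   ≈ a (suc (suc j)) * F (suc (suc j)) N
        eq N = begin
          (1# - x ^ suc j) * (a (suc j) * F (suc j) N) + a (suc j) * (x ^ (suc j ℕ.* N) * (p N * (1# - x ^ N)))
            ≈⟨ solve 4 (λ u a f r → u :* (a :* f) :+ a :* r := a :* (u :* f :+ r))
                 refl (1# - x ^ suc j) (a (suc j)) (F (suc j) N) (x ^ (suc j ℕ.* N) * (p N * (1# - x ^ N))) ⟩
          a (suc j) * ((1# - x ^ suc j) * F (suc j) N + x ^ (suc j ℕ.* N) * (p N * (1# - x ^ N)))
            ≈⟨ *-congˡ (F-recurrence (suc j) N) ⟩
          a (suc j) * ((1# + q * x ^ suc j) * F (suc (suc j)) N)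
            ≈⟨ solve 4 (λ a q X f → a :* ((con (+ 1) :+ q :* X) :* f) := a :* (con (+ 1) :- :- q :* X) :* f)
                 refl (a (suc j)) q (x ^ suc j) (F (suc (suc j)) N) ⟩
          a (suc j) * (1# - - q * x ^ suc j) * F (suc (suc j)) N
            ≈⟨ *-congʳ (a-suc (suc j)) ⟨
          a (suc (suc j)) * F (suc (suc j)) N ∎

      -- The value of T_k, obtained by solving the two-term relation for T_(k+1); thus the sum is
      -- available before convergence is shown.
      s : ℕ → Carrier
      s zero    = 1#
      s (suc k) = P * (E k * (1# - q ^ (2 ℕ.* k ℕ.+ 1))) - s k

      q^[2k+1] : ∀ k → q ^ (2 ℕ.* k ℕ.+ 1) ≈ q * x ^ k
      q^[2k+1] k = trans (reflexive (≡.cong (q ^_) (ℕ.+-comm (2 ℕ.* k) 1))) (*-congˡ (sym (x^≈q^ k)))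

      -- With X = x^k, (1 - qX)(1 + qX) = 1 - q²X², and the factor 1 + qX completes a_k to a_(k+1),
      -- so `a*F⇝P*b` applies and its b_k cancels `ι k`. The mismatch between N + 1 and N terms is a
      -- single term p_N x^((k+1)N), which tends to zero.
      G*F⇝ : ∀ k → (λ N → G k * (F (suc k) (suc N) - x ^ k * (x * x ^ k) * F (suc k) N))
                   ⇝ (P * (E k * (1# - q * x ^ k)))
      G*F⇝ k = ⇝-cong eq (⇝-congʳ lim
        (scale (ι k * E k)
          (⇝-+ (scale (1# - q * x ^ k) (a*F⇝P*b k)) (scale (a k) (⇝-* p⇝P (x^[1+j]*⇝0 k))))))
        where
        lim : ι k * E k * ((1# - q * x ^ k) * (P * b k) + a k * (P * 0#)) ≈ P * (E k * (1# - q * x ^ k))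
        lim = trans
          (solve 6 (λ ι E u P b a → ι :* E :* (u :* (P :* b) :+ a :* (P :* con (+ 0))) := b :* ι :* (P :* (E :* u)))
            refl (ι k) (E k) (1# - q * x ^ k) P (b k) (a k))
          (trans (*-congʳ (b*ι k)) (*-identityˡ _))
        eq : ∀ N →
          ι k * E k * ((1# - q * x ^ k) * (a (suc k) * F (suc k) N) + a k * (p N * x ^ (suc k ℕ.* N)))
          ≈ G k * (F (suc k) (suc N) - x ^ k * (x * x ^ k) * F (suc k) N)
        eq N = begin
          ι k * E k * ((1# - q * X) * (a (suc k) * f) + a k * r)
            ≈⟨ *-congˡ (+-congʳ (*-congˡ (*-congʳ (a-suc k)))) ⟩
          ι k * E k * ((1# - q * X) * (a k * (1# - - q * X) * f) + a k * r)
            ≈⟨ solve 7 (λ ι E q X a f r → let 1' = con (+ 1) in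
                 ι :* E :* ((1' :- q :* X) :* (a :* (1' :- :- q :* X) :* f) :+ a :* r)
                 := a :* ι :* E :* (f :+ r :- X :* (q :* q :* X) :* f))
                 refl (ι k) (E k) q X (a k) f r ⟩
          G k * (f + r - X * (q * q * X) * f)
            ≈⟨ *-congˡ (+-congˡ (-‿cong (*-congʳ (*-congˡ (*-congʳ q*q≈x))))) ⟩
          G k * (f + r - X * (x * X) * f) ∎
          where
          X = x ^ k
          f = F (suc k) N
          r = p N * x ^ (suc k ℕ.* N)

      Σt-step : ∀ k → (λ N → Σ< (suc N) (t k)) ⇝ s k → (λ N → Σ< N (t (suc k))) ⇝ s (suc k)
      Σt-step k h = ⇝-cong eq (⇝-congʳ
        (+-congʳ (*-congˡ (*-congˡ (+-congˡ (-‿cong (sym (q^[2k+1] k)))))))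
        (⇝-- (G*F⇝ k) h))
        where
        eq : ∀ N → G k * (F (suc k) (suc N) - x ^ k * (x * x ^ k) * F (suc k) N) - Σ< (suc N) (t k)
                   ≈ Σ< N (t (suc k))
        eq N = trans (+-congʳ (sym (Σt-pair k N)))
          (solve 2 (λ u v → u :+ v :- u := v) refl (Σ< (suc N) (t k)) (Σ< N (t (suc k))))

      Σt⇝s : ∀ k → (λ N → Σ< N (t (suc k))) ⇝ s (suc k)
      Σt⇝s zero    = Σt-step 0 (⇝-cong eq (⇝-const 1#))
        where
        eq : ∀ N → 1# ≈ Σ< (suc N) (t 0)
        eq zero    = sym (+-identityˡ 1#)
        eq (suc N) = trans (eq N) (sym (+-identityʳ _))
      -- `Σt-step` takes partial sums that are one term longer, hence the shift.
      Σt⇝s (suc k) = Σt-step (suc k) (⇝-suc (Σt⇝s k))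

      -- By the definition of `s`, P E_k (1 - q^(2k+1)) is s_(k+1) + s_k, so the alternating sum
      -- telescopes down to s_0 = 1.
      P*Σ≈1-s : ∀ k →
        P * Σ< k (λ j → (- 1#) ^ j * E j * (1# - q ^ (2 ℕ.* j ℕ.+ 1))) ≈ 1# - (- 1#) ^ k * s k
      P*Σ≈1-s zero = solve 1 (λ P → P :* con (+ 0) := con (+ 1) :- con (+ 1) :* con (+ 1)) refl P
      P*Σ≈1-s (suc k) = begin
        P * (S + ε * E k * u)           ≈⟨ solve 5 (λ P S ε E u → P :* (S :+ ε :* E :* u) := P :* S :+ ε :* (P :* (E :* u)))
                                             refl P S ε (E k) u ⟩
        P * S + ε * (P * (E k * u))     ≈⟨ +-congʳ (P*Σ≈1-s k) ⟩
        1# - ε * s k + ε * (P * (E k * u))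
          ≈⟨ solve 3 (λ ε s w → con (+ 1) :- ε :* s :+ ε :* w := con (+ 1) :- :- con (+ 1) :* ε :* (w :- s))
               refl ε (s k) (P * (E k * u)) ⟩
        1# - - 1# * ε * (P * (E k * u) - s k) ∎
        where
        ε = (- 1#) ^ k
        u = 1# - q ^ (2 ℕ.* k ℕ.+ 1)
        S = Σ< k (λ j → (- 1#) ^ j * E j * (1# - q ^ (2 ℕ.* j ℕ.+ 1)))

      sum-identity : ∀ k →
        P * Σ< (suc k) (λ j → (- 1#) ^ j * E j * (1# - q ^ (2 ℕ.* j ℕ.+ 1))) ≈ 1# + (- 1#) ^ k * s (suc k)
      sum-identity k = trans (P*Σ≈1-s (suc k))
        (solve 2 (λ ε s → con (+ 1) :- :- con (+ 1) :* ε :* s := con (+ 1) :+ ε :* s) refl ((- 1#) ^ k) (s (suc k)))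

open import Data.Integer.Base as ℤ using (+_; -[1+_])
import Data.Integer.Properties as ℤ
import Data.Nat.Coprimality as Coprime
open import Data.Product.Base using (Σ-syntax; ∃-syntax; _×_; _,_; proj₁; proj₂)
open import Data.Rational.Base as ℚ using (ℚ; 0ℚ; 1ℚ; ½; mkℚ)
import Data.Rational.Properties as ℚ
open import Data.Rational.Solver using (module +-*-Solver)
open import Data.Rational.Unnormalised.Base using (*≤*; *≡*)
import Data.Rational.Unnormalised.Properties as ℚᵘ
open import Data.Sum.Base using (inj₁; inj₂)
open import Defs
open import Level using (0ℓ)
open ≡ using (refl; sym; trans; cong; cong₂; subst; subst₂)
open import Relation.Nullary using (yes; no; contradiction)
open import Algebra.Definitions.RawSemiring ℚ.+-*-rawSemiring using ()
  renaming (_^_ to _^ℚ_; _×_ to _×ℚ_)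

open +-*-Solver using (solve; _:=_; _:+_; _:*_; _:-_; :-_; con)

-- Rational inequalities, the Archimedean property and geometric decay.

abstract
  0≤q-p : ∀ {p q} → p ℚ.≤ q → 0ℚ ℚ.≤ q ℚ.- p
  0≤q-p {p} {q} p≤q = subst (ℚ._≤ q ℚ.- p) (ℚ.+-inverseʳ p) (ℚ.+-monoˡ-≤ (ℚ.- p) p≤q)

  difference : ∀ {p q d} → 0ℚ ℚ.≤ d → d ≡ q ℚ.- p → p ℚ.≤ q
  difference {p} {q} {d} 0≤d d≡ = subst₂ ℚ._≤_ (ℚ.+-identityʳ p)
    (trans (cong (p ℚ.+_) d≡) (solve 2 (λ p q → p :+ (q :- p) := q) refl p q)) (ℚ.+-monoʳ-≤ p 0≤d)

  0<½ε : ∀ {ε} → 0ℚ ℚ.< ε → 0ℚ ℚ.< ½ ℚ.* ε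
  0<½ε {ε} h = subst (ℚ._< ½ ℚ.* ε) (ℚ.*-zeroʳ ½) (ℚ.*-monoʳ-<-pos ½ h)

  ½ε+½ε≡ε : ∀ ε → ½ ℚ.* ε ℚ.+ ½ ℚ.* ε ≡ ε
  ½ε+½ε≡ε ε = trans (sym (ℚ.*-distribʳ-+ ε ½ ½)) (ℚ.*-identityˡ ε)

  ½ε<ε : ∀ {ε} → 0ℚ ℚ.< ε → ½ ℚ.* ε ℚ.< ε
  ½ε<ε {ε} 0<ε = subst₂ ℚ._<_ (ℚ.+-identityʳ (½ ℚ.* ε)) (½ε+½ε≡ε ε) (ℚ.+-monoʳ-< (½ ℚ.* ε) (0<½ε 0<ε))

  0<p*q : ∀ {p q} → 0ℚ ℚ.< p → 0ℚ ℚ.< q → 0ℚ ℚ.< p ℚ.* q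
  0<p*q {p} {q} hp hq = subst (ℚ._< p ℚ.* q) (ℚ.*-zeroʳ p)
    (ℚ.*-monoʳ-<-pos p {{ℚ.positive hp}} hq)

  0<p+q : ∀ {p q} → 0ℚ ℚ.< p → 0ℚ ℚ.≤ q → 0ℚ ℚ.< p ℚ.+ q
  0<p+q 0<p 0≤q = ℚ.+-mono-<-≤ 0<p 0≤q

  *-monoˡ : ∀ {r p q} → 0ℚ ℚ.≤ r → p ℚ.≤ q → r ℚ.* p ℚ.≤ r ℚ.* q
  *-monoˡ {r} 0≤r = ℚ.*-monoˡ-≤-nonNeg r {{ℚ.nonNegative 0≤r}}

  *-monoʳ : ∀ {r p q} → 0ℚ ℚ.≤ r → p ℚ.≤ q → p ℚ.* r ℚ.≤ q ℚ.* r
  *-monoʳ {r} 0≤r = ℚ.*-monoʳ-≤-nonNeg r {{ℚ.nonNegative 0≤r}}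

  0≤p*q : ∀ {p q} → 0ℚ ℚ.≤ p → 0ℚ ℚ.≤ q → 0ℚ ℚ.≤ p ℚ.* q
  0≤p*q {p} {q} hp hq = subst (ℚ._≤ p ℚ.* q) (ℚ.*-zeroʳ p) (*-monoˡ hp hq)

  *-mono : ∀ {p q r s} → 0ℚ ℚ.≤ p → 0ℚ ℚ.≤ s → p ℚ.≤ q → r ℚ.≤ s → p ℚ.* r ℚ.≤ q ℚ.* s
  *-mono 0≤p 0≤s p≤q r≤s = ℚ.≤-trans (*-monoˡ 0≤p r≤s) (*-monoʳ 0≤s p≤q)

  ∣p∣*∣p∣≡p*p : ∀ p → ℚ.∣ p ∣ ℚ.* ℚ.∣ p ∣ ≡ p ℚ.* p
  ∣p∣*∣p∣≡p*p p with ℚ.∣p∣≡p∨∣p∣≡-p p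
  ... | inj₁ eq = cong₂ ℚ._*_ eq eq
  ... | inj₂ eq = trans (cong₂ ℚ._*_ eq eq) (solve 1 (λ p → (:- p) :* (:- p) := p :* p) refl p)

  0≤p² : ∀ p → 0ℚ ℚ.≤ p ℚ.* p
  0≤p² p = subst (0ℚ ℚ.≤_) (∣p∣*∣p∣≡p*p p) (0≤p*q (ℚ.0≤∣p∣ p) (ℚ.0≤∣p∣ p))

  p≤∣p∣ : ∀ p → p ℚ.≤ ℚ.∣ p ∣
  p≤∣p∣ p with ℚ.≤-total 0ℚ p
  ... | inj₁ 0≤p = ℚ.≤-reflexive (sym (ℚ.0≤p⇒∣p∣≡p 0≤p))
  ... | inj₂ p≤0 = ℚ.≤-trans p≤0 (ℚ.0≤∣p∣ p)

  p²≤s²⇒∣p∣≤s : ∀ {p s} → 0ℚ ℚ.≤ s → p ℚ.* p ℚ.≤ s ℚ.* s → ℚ.∣ p ∣ ℚ.≤ s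
  p²≤s²⇒∣p∣≤s {p} {s} 0≤s h with ℚ.∣ p ∣ ℚ.≤? s
  ... | yes ∣p∣≤s = ∣p∣≤s
  ... | no ∣p∣≰s = contradiction
    (ℚ.<-≤-trans (ℚ.≤-<-trans (*-monoˡ 0≤s (ℚ.<⇒≤ s<∣p∣)) (ℚ.*-monoˡ-<-pos ℚ.∣ p ∣ {{ℚ.positive (ℚ.≤-<-trans 0≤s s<∣p∣)}} s<∣p∣))
                 (ℚ.≤-trans (ℚ.≤-reflexive (∣p∣*∣p∣≡p*p p)) h))
    (ℚ.<-irrefl refl)
    where
    s<∣p∣ : s ℚ.< ℚ.∣ p ∣
    s<∣p∣ = ℚ.≰⇒> ∣p∣≰s

  quotient : ∀ K ε → 0ℚ ℚ.< K → 0ℚ ℚ.< ε → Σ[ δ ∈ ℚ ] (0ℚ ℚ.< δ) × K ℚ.* δ ≡ ε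
  quotient K ε 0<K 0<ε = ε ℚ.* K⁻¹ , 0<p*q 0<ε (ℚ.positive⁻¹ K⁻¹ {{ℚ.1/pos⇒pos K}})
    , trans (solve 3 (λ k e i → k :* (e :* i) := e :* (k :* i)) refl K ε K⁻¹)
        (trans (cong (ε ℚ.*_) (ℚ.*-inverseʳ K)) (ℚ.*-identityʳ ε))
    where
    instance
      K-pos : ℚ.Positive K
      K-pos = ℚ.positive 0<K
      K-nonZero : ℚ.NonZero K
      K-nonZero = ℚ.pos⇒nonZero K
    K⁻¹ : ℚ
    K⁻¹ = ℚ.1/ K

  -- Given directly in lowest terms, so that numerator and denominator compute for a variable n.
  fromℕ : ℕ → ℚ
  fromℕ n = mkℚ (+ n) 0 (Coprime.sym (Coprime.1-coprimeTo n))

  fromℕ-suc : ∀ n → fromℕ (suc n) ≡ 1ℚ ℚ.+ fromℕ n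
  fromℕ-suc n = ℚ.toℚᵘ-injective (ℚᵘ.≃-trans
    (*≡* (cong (ℤ._* + 1) (cong (λ i → + 1 ℤ.+ i) (sym (ℤ.*-identityʳ (+ n))))))
    (ℚᵘ.≃-sym (ℚ.toℚᵘ-homo-+ 1ℚ (fromℕ n))))

  ×ℚ≡fromℕ* : ∀ n p → n ×ℚ p ≡ fromℕ n ℚ.* p
  ×ℚ≡fromℕ* zero    p = sym (ℚ.*-zeroˡ p)
  ×ℚ≡fromℕ* (suc n) p = trans (cong (p ℚ.+_) (×ℚ≡fromℕ* n p))
    (trans (solve 2 (λ p k → p :+ k :* p := (con 1ℚ :+ k) :* p) refl p (fromℕ n))
      (cong (ℚ._* p) (sym (fromℕ-suc n))))

  -- The denominator of p is a witness: multiplied by it, p becomes its numerator, a positive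
  -- integer.
  archimedean : ∀ p → 0ℚ ℚ.< p → ∃[ n ] 1ℚ ℚ.≤ n ×ℚ p
  archimedean p@(mkℚ (+ suc a) d-1 _) _ = suc d-1 , subst (1ℚ ℚ.≤_) (sym (×ℚ≡fromℕ* (suc d-1) p))
    (ℚ.toℚᵘ-cancel-≤ (ℚᵘ.≤-trans
      (*≤* (ℤ.+≤+ (subst₂ ℕ._≤_ (sym (trans (ℕ.*-identityˡ _) (ℕ.*-identityˡ _))) (sym (ℕ.*-identityʳ _)) (ℕ.m≤m*n (suc d-1) (suc a)))))
      (ℚᵘ.≤-reflexive (ℚᵘ.≃-sym (ℚ.toℚᵘ-homo-* (fromℕ (suc d-1)) p)))))
  archimedean (mkℚ (+ zero) d-1 _)  h = contradiction h (λ { (ℚ.*<* (ℤ.+<+ ())) })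
  archimedean (mkℚ -[1+ _ ] d-1 _) (ℚ.*<* ())

module Geometric (r : ℚ) (0<r : 0ℚ ℚ.< r) (r<1 : r ℚ.< 1ℚ) where

  abstract
    0<1-r : 0ℚ ℚ.< 1ℚ ℚ.- r
    0<1-r = subst (ℚ._< 1ℚ ℚ.- r) (ℚ.+-inverseʳ r) (ℚ.+-monoˡ-< (ℚ.- r) r<1)

    0<r^ : ∀ n → 0ℚ ℚ.< r ^ℚ n
    0<r^ zero    = ℚ.positive⁻¹ 1ℚ
    0<r^ (suc n) = 0<p*q 0<r (0<r^ n)

    0≤r^ : ∀ n → 0ℚ ℚ.≤ r ^ℚ n
    0≤r^ n = ℚ.<⇒≤ (0<r^ n)

    r^-anti : ∀ {m n} → m ℕ.≤ n → r ^ℚ n ℚ.≤ r ^ℚ m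
    r^-anti {zero}  {zero}  _ = ℚ.≤-refl
    r^-anti {zero}  {suc n} _ = ℚ.≤-trans (*-mono (ℚ.<⇒≤ 0<r) (ℚ.<⇒≤ (ℚ.positive⁻¹ 1ℚ)) (ℚ.<⇒≤ r<1) (r^-anti {zero} {n} ℕ.z≤n)) (ℚ.≤-reflexive (ℚ.*-identityˡ 1ℚ))
    r^-anti {suc m} {suc n} (ℕ.s≤s m≤n) = *-monoˡ (ℚ.<⇒≤ 0<r) (r^-anti m≤n)

    0≤n× : ∀ n {p} → 0ℚ ℚ.≤ p → 0ℚ ℚ.≤ n ×ℚ p
    0≤n× zero    _   = ℚ.≤-refl
    0≤n× (suc n) 0≤p = ℚ.+-mono-≤ 0≤p (0≤n× n 0≤p)

    -- The left side decreases in n, by r^n (n+1)(1-r)² from n to n + 1. It is Bernoulli's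
    -- inequality arranged so that r is never inverted.
    bernoulli : ∀ n → r ^ℚ n ℚ.* (1ℚ ℚ.+ n ×ℚ (1ℚ ℚ.- r)) ℚ.≤ 1ℚ
    bernoulli zero = ℚ.≤-reflexive (trans (ℚ.*-identityˡ _) (ℚ.+-identityʳ 1ℚ))
    bernoulli (suc n) = ℚ.≤-trans
      (difference {d = r ^ℚ n ℚ.* ((1ℚ ℚ.- r) ℚ.* ((1ℚ ℚ.- r) ℚ.+ n ×ℚ (1ℚ ℚ.- r)))}
        (0≤p*q (0≤r^ n) (0≤p*q (ℚ.<⇒≤ 0<1-r) (0≤n× (suc n) (ℚ.<⇒≤ 0<1-r))))
        (solve 3 (λ r p m → let d = con 1ℚ :- r in
            p :* (d :* (d :+ m)) := p :* (con 1ℚ :+ m) :- r :* p :* (con 1ℚ :+ (d :+ m)))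
          refl r (r ^ℚ n) (n ×ℚ (1ℚ ℚ.- r))))
      (bernoulli n)

    r^-null : ∀ ε → 0ℚ ℚ.< ε → ∃[ M ] r ^ℚ M ℚ.≤ ε
    r^-null ε 0<ε = n , ℚ.≤-trans
      (subst (ℚ._≤ r ^ℚ n ℚ.* D ℚ.* ε) (ℚ.*-identityʳ (r ^ℚ n))
        (subst (r ^ℚ n ℚ.* 1ℚ ℚ.≤_) (sym (ℚ.*-assoc (r ^ℚ n) D ε)) (*-monoˡ {r ^ℚ n} {1ℚ} {D ℚ.* ε} (0≤r^ n) 1≤D*ε)))
      (subst (r ^ℚ n ℚ.* D ℚ.* ε ℚ.≤_) (ℚ.*-identityˡ ε) (*-monoʳ {ε} {r ^ℚ n ℚ.* D} {1ℚ} (ℚ.<⇒≤ 0<ε) (bernoulli n)))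
      where
      -- From n (1-r) ε ≥ 1 follows D ε ≥ 1, hence r^n ≤ r^n D ε ≤ ε by `bernoulli`.
      n : ℕ
      n = proj₁ (archimedean ((1ℚ ℚ.- r) ℚ.* ε) (0<p*q 0<1-r 0<ε))
      D : ℚ
      D = 1ℚ ℚ.+ n ×ℚ (1ℚ ℚ.- r)
      ×-*-assoc : ∀ n → n ×ℚ ((1ℚ ℚ.- r) ℚ.* ε) ≡ n ×ℚ (1ℚ ℚ.- r) ℚ.* ε
      ×-*-assoc zero    = sym (ℚ.*-zeroˡ ε)
      ×-*-assoc (suc n) = trans (cong (((1ℚ ℚ.- r) ℚ.* ε) ℚ.+_) (×-*-assoc n)) (sym (ℚ.*-distribʳ-+ ε (1ℚ ℚ.- r) (n ×ℚ (1ℚ ℚ.- r))))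
      1≤D*ε : 1ℚ ℚ.≤ D ℚ.* ε
      1≤D*ε = ℚ.≤-trans (subst (1ℚ ℚ.≤_) (×-*-assoc n) (proj₂ (archimedean ((1ℚ ℚ.- r) ℚ.* ε) (0<p*q 0<1-r 0<ε))))
        (*-monoʳ {ε} {n ×ℚ (1ℚ ℚ.- r)} {D} (ℚ.<⇒≤ 0<ε) (difference {d = 1ℚ} (ℚ.<⇒≤ (ℚ.positive⁻¹ 1ℚ))
          (solve 1 (λ m → con 1ℚ := con 1ℚ :+ m :- m) refl (n ×ℚ (1ℚ ℚ.- r)))))

    r^-scaled-null : ∀ K ε → 0ℚ ℚ.< K → 0ℚ ℚ.< ε → ∃[ M ] (∀ n → M ℕ.≤ n → K ℚ.* r ^ℚ n ℚ.≤ ε)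
    r^-scaled-null K ε 0<K 0<ε =
      let δ , 0<δ , Kδ≡ε = quotient K ε 0<K 0<ε
          M , hM         = r^-null δ 0<δ
      in M , λ n M≤n → subst (K ℚ.* r ^ℚ n ℚ.≤_) Kδ≡ε
           (*-monoˡ {K} {r ^ℚ n} {δ} (ℚ.<⇒≤ 0<K) (ℚ.≤-trans (r^-anti M≤n) hM))

-- Bounds and convergence for complex sequences.

infix 4 _≗_ _≼_ _⇝_

-- The ℓ¹ norm of the n-th approximant: rational, subadditive and submultiplicative, so estimates
-- avoid square roots.
‖_‖ : ℂ → ℕ → ℚ
‖ z ‖ n = ℚ.∣ seq (re z) n ∣ ℚ.+ ℚ.∣ seq (im z) n ∣

-- Rational identities between approximants hold at every index, and such agreement transports
-- bounds at no cost in ε. As a record it lets unification recover `z` and `w`, and the same holds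
-- for the two records below.
record _≗_ (z w : ℂ) : Set where
  constructor mk≗
  field
    re≡ : ∀ n → seq (re z) n ≡ seq (re w) n
    im≡ : ∀ n → seq (im z) n ≡ seq (im w) n

Eventually : (ℕ → Set) → Set
Eventually P = ∃[ N ] (∀ n → N ℕ.≤ n → P n)

record _≼_ (z : ℂ) (K : ℚ) : Set where
  constructor mk≼
  field
    bounds : Eventually (λ n → ‖ z ‖ n ℚ.≤ K)

-- Convergence tested on rational ε in the ℓ¹ norm. All limits are taken in this sense and
-- translated to `⟶` by `⇝⇒⟶`.
record _⇝_ (f : ℕ → ℂ) (L : ℂ) : Set where
  constructor mk⇝
  field
    tends : ∀ ε → 0ℚ ℚ.< ε → Eventually (λ n → f n - L ≼ ε)

open _≼_ public
open _⇝_ public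

eventually-map : ∀ {P Q : ℕ → Set} → (∀ n → P n → Q n) → Eventually P → Eventually Q
eventually-map h (N , p) = N , λ n N≤n → h n (p n N≤n)

eventually-zip : ∀ {P Q R : ℕ → Set} → (∀ n → P n → Q n → R n) →
  Eventually P → Eventually Q → Eventually R
eventually-zip h (M , p) (N , q) = M ℕ.⊔ N , λ n n≥ →
  h n (p n (ℕ.≤-trans (ℕ.m≤m⊔n M N) n≥)) (q n (ℕ.≤-trans (ℕ.m≤n⊔m M N) n≥))

abstract
  0≤‖‖ : ∀ z n → 0ℚ ℚ.≤ ‖ z ‖ n
  0≤‖‖ z n = ℚ.+-mono-≤ (ℚ.0≤∣p∣ (seq (re z) n)) (ℚ.0≤∣p∣ (seq (im z) n))

  ∣re∣≤‖‖ : ∀ z n → ℚ.∣ seq (re z) n ∣ ℚ.≤ ‖ z ‖ n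
  ∣re∣≤‖‖ z n = subst (ℚ._≤ ‖ z ‖ n) (ℚ.+-identityʳ ℚ.∣ seq (re z) n ∣) (ℚ.+-monoʳ-≤ ℚ.∣ seq (re z) n ∣ (ℚ.0≤∣p∣ (seq (im z) n)))

  ∣im∣≤‖‖ : ∀ z n → ℚ.∣ seq (im z) n ∣ ℚ.≤ ‖ z ‖ n
  ∣im∣≤‖‖ z n = subst (ℚ._≤ ‖ z ‖ n) (ℚ.+-identityˡ ℚ.∣ seq (im z) n ∣) (ℚ.+-monoˡ-≤ ℚ.∣ seq (im z) n ∣ (ℚ.0≤∣p∣ (seq (re z) n)))

  ‖‖-+ : ∀ z w n → ‖ z + w ‖ n ℚ.≤ ‖ z ‖ n ℚ.+ ‖ w ‖ n
  ‖‖-+ z w n = ℚ.≤-trans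
    (ℚ.+-mono-≤ (ℚ.∣p+q∣≤∣p∣+∣q∣ (seq (re z) n) (seq (re w) n)) (ℚ.∣p+q∣≤∣p∣+∣q∣ (seq (im z) n) (seq (im w) n)))
    (ℚ.≤-reflexive (solve 4 (λ a b c d → (a :+ b) :+ (c :+ d) := (a :+ c) :+ (b :+ d)) refl
      ℚ.∣ seq (re z) n ∣ ℚ.∣ seq (re w) n ∣ ℚ.∣ seq (im z) n ∣ ℚ.∣ seq (im w) n ∣))

  ‖‖-neg : ∀ z n → ‖ - z ‖ n ≡ ‖ z ‖ n
  ‖‖-neg z n = cong₂ ℚ._+_ (ℚ.∣-p∣≡∣p∣ (seq (re z) n)) (ℚ.∣-p∣≡∣p∣ (seq (im z) n))

  ‖‖-* : ∀ z w n → ‖ z * w ‖ n ℚ.≤ ‖ z ‖ n ℚ.* ‖ w ‖ n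
  ‖‖-* z w n = ℚ.≤-trans
    (ℚ.+-mono-≤
      (subst (ℚ.∣ a ℚ.* c ℚ.+ ℚ.- (b ℚ.* d) ∣ ℚ.≤_)
        (cong₂ ℚ._+_ (ℚ.∣p*q∣≡∣p∣*∣q∣ a c) (trans (ℚ.∣-p∣≡∣p∣ (b ℚ.* d)) (ℚ.∣p*q∣≡∣p∣*∣q∣ b d)))
        (ℚ.∣p+q∣≤∣p∣+∣q∣ (a ℚ.* c) (ℚ.- (b ℚ.* d))))
      (subst (ℚ.∣ a ℚ.* d ℚ.+ b ℚ.* c ∣ ℚ.≤_)
        (cong₂ ℚ._+_ (ℚ.∣p*q∣≡∣p∣*∣q∣ a d) (ℚ.∣p*q∣≡∣p∣*∣q∣ b c))
        (ℚ.∣p+q∣≤∣p∣+∣q∣ (a ℚ.* d) (b ℚ.* c))))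
    (ℚ.≤-reflexive (solve 4 (λ a b c d → (a :* c :+ b :* d) :+ (a :* d :+ b :* c) := (a :+ b) :* (c :+ d)) refl
      ℚ.∣ a ∣ ℚ.∣ b ∣ ℚ.∣ c ∣ ℚ.∣ d ∣))
    where
    a b c d : ℚ
    a = seq (re z) n
    b = seq (im z) n
    c = seq (re w) n
    d = seq (im w) n

  ≼-≗ : ∀ {z w K} → z ≗ w → z ≼ K → w ≼ K
  ≼-≗ {K = K} (mk≗ re≡ im≡) (mk≼ h) = mk≼ (eventually-map
    (λ n → subst (ℚ._≤ K) (cong₂ (λ a b → ℚ.∣ a ∣ ℚ.+ ℚ.∣ b ∣) (re≡ n) (im≡ n))) h)

  ≼-weaken : ∀ {z K L} → K ℚ.≤ L → z ≼ K → z ≼ L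
  ≼-weaken K≤L (mk≼ h) = mk≼ (eventually-map (λ n z≤ → ℚ.≤-trans z≤ K≤L) h)

  ≼-+ : ∀ {z w K L} → z ≼ K → w ≼ L → z + w ≼ K ℚ.+ L
  ≼-+ {z} {w} (mk≼ h) (mk≼ k) = mk≼ (eventually-zip
    (λ n z≤ w≤ → ℚ.≤-trans (‖‖-+ z w n) (ℚ.+-mono-≤ z≤ w≤)) h k)

  ≼-neg : ∀ {z K} → z ≼ K → - z ≼ K
  ≼-neg {z} {K} (mk≼ h) = mk≼ (eventually-map (λ n → subst (ℚ._≤ K) (sym (‖‖-neg z n))) h)

  ≼-* : ∀ {z w K L} → z ≼ K → w ≼ L → z * w ≼ K ℚ.* L
  ≼-* {z} {w} (mk≼ h) (mk≼ k) = mk≼ (eventually-zip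
    (λ n z≤ w≤ → ℚ.≤-trans (‖‖-* z w n)
      (*-mono (0≤‖‖ z n) (ℚ.≤-trans (0≤‖‖ w n) w≤) z≤ w≤)) h k)

  0≤K : ∀ {z K} → z ≼ K → 0ℚ ℚ.≤ K
  0≤K {z} (mk≼ (N , h)) = ℚ.≤-trans (0≤‖‖ z N) (h N ℕ.≤-refl)

  ℝ-bounded : ∀ x → Σ[ K ∈ ℚ ] Eventually (λ n → ℚ.∣ seq x n ∣ ℚ.≤ K)
  ℝ-bounded x =
    let N , h = cauchy x 1ℚ (ℚ.positive⁻¹ 1ℚ)
    in 1ℚ ℚ.+ ℚ.∣ seq x N ∣ , N , λ n n≥ → ℚ.≤-trans
      (subst (λ p → ℚ.∣ p ∣ ℚ.≤ ℚ.∣ seq x n ℚ.- seq x N ∣ ℚ.+ ℚ.∣ seq x N ∣)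
        (solve 2 (λ a b → (a :- b) :+ b := a) refl (seq x n) (seq x N))
        (ℚ.∣p+q∣≤∣p∣+∣q∣ (seq x n ℚ.- seq x N) (seq x N)))
      (ℚ.+-monoˡ-≤ ℚ.∣ seq x N ∣ (ℚ.<⇒≤ (h n N n≥ ℕ.≤-refl)))

  ≼-exists : ∀ z → Σ[ K ∈ ℚ ] (0ℚ ℚ.< K) × z ≼ K
  ≼-exists z =
    let K , h = ℝ-bounded (re z)
        L , k = ℝ-bounded (im z)
        z≼ : z ≼ K ℚ.+ L
        z≼ = mk≼ (eventually-zip (λ n → ℚ.+-mono-≤) h k)
    in 1ℚ ℚ.+ (K ℚ.+ L) , 0<p+q (ℚ.positive⁻¹ 1ℚ) (0≤K z≼)
       , ≼-weaken (difference {d = 1ℚ} (ℚ.<⇒≤ (ℚ.positive⁻¹ 1ℚ))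
           (solve 2 (λ o s → o := o :+ s :- s) refl 1ℚ (K ℚ.+ L))) z≼

  ≼-halves : ∀ {z w ε} → z ≼ ½ ℚ.* ε → w ≼ ½ ℚ.* ε → z + w ≼ ε
  ≼-halves {z} {w} {ε} z≼ w≼ = subst (z + w ≼_) (½ε+½ε≡ε ε) (≼-+ {z} {w} {½ ℚ.* ε} {½ ℚ.* ε} z≼ w≼)

  ≼⇒≈ : ∀ {z w} → (∀ ε → 0ℚ ℚ.< ε → z - w ≼ ε) → z ≈ w
  ≼⇒≈ {z} {w} h = part re (∣re∣≤‖‖ (z - w)) , part im (∣im∣≤‖‖ (z - w))
    where
    part : (c : ℂ → ℝ) → (∀ n → ℚ.∣ seq (c z) n ℚ.- seq (c w) n ∣ ℚ.≤ ‖ z - w ‖ n) → c z ≈ℝ c w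
    part c le ε 0<ε = eventually-map
      (λ n ≤½ε → ℚ.≤-<-trans (ℚ.≤-trans (le n) ≤½ε) (½ε<ε 0<ε))
      (bounds (h (½ ℚ.* ε) (0<½ε 0<ε)))

  ≈⇒≼ : ∀ {z w} → z ≈ w → ∀ ε → 0ℚ ℚ.< ε → z - w ≼ ε
  ≈⇒≼ {z} {w} (re≈ , im≈) ε 0<ε = mk≼ (eventually-zip
    (λ n r i → subst (‖ z - w ‖ n ℚ.≤_) (½ε+½ε≡ε ε) (ℚ.+-mono-≤ (ℚ.<⇒≤ r) (ℚ.<⇒≤ i)))
    (re≈ (½ ℚ.* ε) (0<½ε 0<ε)) (im≈ (½ ℚ.* ε) (0<½ε 0<ε)))

  ≗⇒≈ : ∀ {z w} → z ≗ w → z ≈ w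
  ≗⇒≈ {z} {w} (mk≗ re≡ im≡) = part (re z) (re w) re≡ , part (im z) (im w) im≡
    where
    part : ∀ x y → (∀ n → seq x n ≡ seq y n) → x ≈ℝ y
    part x y eq ε 0<ε = 0 , λ n _ → subst (ℚ._< ε)
      (cong ℚ.∣_∣ (sym (trans (cong (ℚ._- seq y n) (eq n)) (ℚ.+-inverseʳ (seq y n))))) 0<ε

  -- Equality is convergence of a constant sequence, so the limit laws for sums and products yield
  -- the congruences of `+` and `*`, and `⇝-cong` yields transitivity.
  ⇝⇒≈ : ∀ {z w} → (λ _ → z) ⇝ w → z ≈ w
  ⇝⇒≈ {z} {w} (mk⇝ h) = ≼⇒≈ {z} {w} λ ε 0<ε → let N , k = h ε 0<ε in k N ℕ.≤-refl

  ≈⇒⇝ : ∀ {z w} → z ≈ w → (λ _ → z) ⇝ w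
  ≈⇒⇝ {z} {w} z≈w = mk⇝ λ ε 0<ε → 0 , λ _ _ → ≈⇒≼ {z} {w} z≈w ε 0<ε

  ⇝-+ : ∀ {f g L M} → f ⇝ L → g ⇝ M → (λ n → f n + g n) ⇝ (L + M)
  ⇝-+ {f} {g} {L} {M} (mk⇝ h) (mk⇝ k) = mk⇝ λ ε 0<ε → eventually-zip
    (λ n p q → ≼-≗ (regroup n) (≼-halves {f n - L} {g n - M} {ε} p q))
    (h (½ ℚ.* ε) (0<½ε 0<ε)) (k (½ ℚ.* ε) (0<½ε 0<ε))
    where
    eq : ∀ a b c d → (a ℚ.- c) ℚ.+ (b ℚ.- d) ≡ (a ℚ.+ b) ℚ.- (c ℚ.+ d)
    eq = solve 4 (λ a b c d → (a :- c) :+ (b :- d) := (a :+ b) :- (c :+ d)) refl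
    regroup : ∀ n → (f n - L) + (g n - M) ≗ (f n + g n) - (L + M)
    regroup n = mk≗ (λ j → eq (seq (re (f n)) j) (seq (re (g n)) j) (seq (re L) j) (seq (re M) j))
                    (λ j → eq (seq (im (f n)) j) (seq (im (g n)) j) (seq (im L) j) (seq (im M) j))

  z-w+w≗z : ∀ z w → (z - w) + w ≗ z
  z-w+w≗z z w = mk≗ (λ n → eq (seq (re z) n) (seq (re w) n)) (λ n → eq (seq (im z) n) (seq (im w) n))
    where
    eq : ∀ a b → (a ℚ.- b) ℚ.+ b ≡ a
    eq = solve 2 (λ a b → (a :- b) :+ b := a) refl

  ⇝-bounded : ∀ {f L} → f ⇝ L → Σ[ K ∈ ℚ ] (0ℚ ℚ.< K) × Eventually (λ n → f n ≼ K)
  ⇝-bounded {f} {L} (mk⇝ h) =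
    let K , 0<K , L≼K = ≼-exists L
    in 1ℚ ℚ.+ K , 0<p+q (ℚ.positive⁻¹ 1ℚ) (ℚ.<⇒≤ 0<K)
       , eventually-map (λ n p → ≼-≗ (z-w+w≗z (f n) L) (≼-+ p L≼K)) (h 1ℚ (ℚ.positive⁻¹ 1ℚ))

  leibniz : ∀ a b c d → a ℚ.* (b ℚ.- d) ℚ.+ d ℚ.* (a ℚ.- c) ≡ a ℚ.* b ℚ.- c ℚ.* d
  leibniz = solve 4 (λ a b c d → a :* (b :- d) :+ d :* (a :- c) := a :* b :- c :* d) refl
  interchange : ∀ a b c d → (a ℚ.- b) ℚ.+ (c ℚ.- d) ≡ (a ℚ.+ c) ℚ.- (b ℚ.+ d)
  interchange = solve 4 (λ a b c d → (a :- b) :+ (c :- d) := (a :+ c) :- (b :+ d)) refl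
  interchange₂ : ∀ a b c d → (a ℚ.- b) ℚ.- (c ℚ.- d) ≡ (a ℚ.- c) ℚ.- (b ℚ.- d)
  interchange₂ = solve 4 (λ a b c d → (a :- b) :- (c :- d) := (a :- c) :- (b :- d)) refl
  interchange₃ : ∀ a b c d → (a ℚ.+ b) ℚ.+ (c ℚ.+ d) ≡ (a ℚ.+ d) ℚ.+ (b ℚ.+ c)
  interchange₃ = solve 4 (λ a b c d → (a :+ b) :+ (c :+ d) := (a :+ d) :+ (b :+ c)) refl
  regroup-re : ∀ a a′ b b′ c c′ d d′ →
    (a ℚ.* (b ℚ.- d) ℚ.- a′ ℚ.* (b′ ℚ.- d′)) ℚ.+ (d ℚ.* (a ℚ.- c) ℚ.- d′ ℚ.* (a′ ℚ.- c′))
    ≡ (a ℚ.* b ℚ.- a′ ℚ.* b′) ℚ.- (c ℚ.* d ℚ.- c′ ℚ.* d′)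
  regroup-re a a′ b b′ c c′ d d′ = trans
    (interchange (a ℚ.* (b ℚ.- d)) (a′ ℚ.* (b′ ℚ.- d′)) (d ℚ.* (a ℚ.- c)) (d′ ℚ.* (a′ ℚ.- c′)))
    (trans (cong₂ ℚ._-_ (leibniz a b c d) (leibniz a′ b′ c′ d′))
      (interchange₂ (a ℚ.* b) (c ℚ.* d) (a′ ℚ.* b′) (c′ ℚ.* d′)))
  regroup-im : ∀ a a′ b b′ c c′ d d′ →
    (a ℚ.* (b′ ℚ.- d′) ℚ.+ a′ ℚ.* (b ℚ.- d)) ℚ.+ (d ℚ.* (a′ ℚ.- c′) ℚ.+ d′ ℚ.* (a ℚ.- c))
    ≡ (a ℚ.* b′ ℚ.+ a′ ℚ.* b) ℚ.- (c ℚ.* d′ ℚ.+ c′ ℚ.* d)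
  regroup-im a a′ b b′ c c′ d d′ = trans
    (interchange₃ (a ℚ.* (b′ ℚ.- d′)) (a′ ℚ.* (b ℚ.- d)) (d ℚ.* (a′ ℚ.- c′)) (d′ ℚ.* (a ℚ.- c)))
    (trans (cong₂ ℚ._+_ (leibniz a b′ c d′) (leibniz a′ b c′ d))
      (interchange (a ℚ.* b′) (c ℚ.* d′) (a′ ℚ.* b) (c′ ℚ.* d)))

  ≼-*+* : ∀ {z w u v A B δ η ε} → A ℚ.* δ ≡ ½ ℚ.* ε → B ℚ.* η ≡ ½ ℚ.* ε →
    z ≼ A → w ≼ δ → u ≼ B → v ≼ η → z * w + u * v ≼ ε
  ≼-*+* {z} {w} {u} {v} {A} {B} {δ} {η} {ε} Aδ≡ Bη≡ z≼ w≼ u≼ v≼ = subst (z * w + u * v ≼_)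
    (trans (cong₂ ℚ._+_ Aδ≡ Bη≡) (½ε+½ε≡ε ε))
    (≼-+ {z * w} {u * v} {A ℚ.* δ} {B ℚ.* η} (≼-* {z} {w} {A} {δ} z≼ w≼) (≼-* {u} {v} {B} {η} u≼ v≼))

  ⇝-* : ∀ {f g L M} → f ⇝ L → g ⇝ M → (λ n → f n * g n) ⇝ (L * M)
  ⇝-* {f} {g} {L} {M} f⇝L g⇝M = mk⇝ λ ε 0<ε →
    -- In f g - L M = f (g - M) + M (f - L) the factor f is eventually bounded by `A` and M by `B`;
    -- each product gets half of ε.
    let A , 0<A , f≼A = ⇝-bounded f⇝L
        B , 0<B , M≼B = ≼-exists M
        δ , 0<δ , Aδ≡ = quotient A (½ ℚ.* ε) 0<A (0<½ε 0<ε)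
        η , 0<η , Bη≡ = quotient B (½ ℚ.* ε) 0<B (0<½ε 0<ε)
    in eventually-zip {λ n → f n ≼ A} {λ n → (f n - L ≼ η) × (g n - M ≼ δ)}
      (λ n f≼ p → ≼-≗ (regroup n)
        (≼-*+* {f n} {g n - M} {M} {f n - L} {A} {B} {δ} {η} {ε} Aδ≡ Bη≡ f≼ (proj₂ p) M≼B (proj₁ p)))
      f≼A
      (eventually-zip {λ n → f n - L ≼ η} {λ n → g n - M ≼ δ} (λ n → _,_) (tends f⇝L η 0<η) (tends g⇝M δ 0<δ))
    where
    regroup : ∀ n → f n * (g n - M) + M * (f n - L) ≗ f n * g n - L * M
    regroup n = mk≗
      (λ j → regroup-re (seq (re (f n)) j) (seq (im (f n)) j) (seq (re (g n)) j) (seq (im (g n)) j)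
                        (seq (re L) j) (seq (im L) j) (seq (re M) j) (seq (im M) j))
      (λ j → regroup-im (seq (re (f n)) j) (seq (im (f n)) j) (seq (re (g n)) j) (seq (im (g n)) j)
                        (seq (re L) j) (seq (im L) j) (seq (re M) j) (seq (im M) j))

  ⇝-suc : ∀ {f L} → f ⇝ L → (λ n → f (suc n)) ⇝ L
  ⇝-suc (mk⇝ h) = mk⇝ λ ε 0<ε → let N , k = h ε 0<ε in N , λ n n≥ → k (suc n) (ℕ.m≤n⇒m≤1+n n≥)

  ⇝-unshift : ∀ {f L} k → (λ n → f (k ℕ.+ n)) ⇝ L → f ⇝ L
  ⇝-unshift {f} {L} k (mk⇝ h) = mk⇝ λ ε 0<ε → let N , p = h ε 0<ε in k ℕ.+ N , λ n n≥ →
    subst (λ j → f j - L ≼ ε) (ℕ.m+[n∸m]≡n (ℕ.≤-trans (ℕ.m≤m+n k N) n≥))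
      (p (n ∸ k) (subst (ℕ._≤ n ∸ k) (ℕ.m+n∸m≡n k N) (ℕ.∸-monoˡ-≤ k n≥)))

  ≈-refl : ∀ {z} → z ≈ z
  ≈-refl {z} = ≗⇒≈ {z} {z} (mk≗ (λ _ → refl) (λ _ → refl))

  ≈-sym : ∀ {z w} → z ≈ w → w ≈ z
  ≈-sym {z} {w} z≈w = ≼⇒≈ {w} {z} λ ε 0<ε → ≼-≗
    (mk≗ (λ n → eq (seq (re z) n) (seq (re w) n)) (λ n → eq (seq (im z) n) (seq (im w) n)))
    (≼-neg (≈⇒≼ {z} {w} z≈w ε 0<ε))
    where
    eq : ∀ a b → ℚ.- (a ℚ.- b) ≡ b ℚ.- a
    eq = solve 2 (λ a b → :- (a :- b) := b :- a) refl

  ⇝-cong : ∀ {f g L} → (∀ n → f n ≈ g n) → f ⇝ L → g ⇝ L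
  ⇝-cong {f} {g} {L} f≈g (mk⇝ h) = mk⇝ λ ε 0<ε → eventually-map
    (λ n p → ≼-≗ (regroup n) (≼-halves {g n - f n} {f n - L} {ε}
      (≈⇒≼ {g n} {f n} (≈-sym {f n} {g n} (f≈g n)) (½ ℚ.* ε) (0<½ε 0<ε)) p))
    (h (½ ℚ.* ε) (0<½ε 0<ε))
    where
    eq : ∀ a b c → (b ℚ.- a) ℚ.+ (a ℚ.- c) ≡ b ℚ.- c
    eq = solve 3 (λ a b c → (b :- a) :+ (a :- c) := b :- c) refl
    regroup : ∀ n → (g n - f n) + (f n - L) ≗ g n - L
    regroup n = mk≗ (λ j → eq (seq (re (f n)) j) (seq (re (g n)) j) (seq (re L) j))
                    (λ j → eq (seq (im (f n)) j) (seq (im (g n)) j) (seq (im L) j))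

  ≈-trans : ∀ {z w u} → z ≈ w → w ≈ u → z ≈ u
  ≈-trans {z} {w} {u} z≈w w≈u = ⇝⇒≈ {z} {u}
    (⇝-cong {λ _ → w} {λ _ → z} {u} (λ _ → ≈-sym {z} {w} z≈w) (≈⇒⇝ {w} {u} w≈u))

  ⇝-congʳ : ∀ {f L M} → L ≈ M → f ⇝ L → f ⇝ M
  ⇝-congʳ {f} {L} {M} L≈M (mk⇝ h) = mk⇝ λ ε 0<ε → eventually-map
    (λ n p → ≼-≗ (regroup n) (≼-halves {f n - L} {L - M} {ε} p
      (≈⇒≼ {L} {M} L≈M (½ ℚ.* ε) (0<½ε 0<ε))))
    (h (½ ℚ.* ε) (0<½ε 0<ε))
    where
    eq : ∀ a b c → (a ℚ.- b) ℚ.+ (b ℚ.- c) ≡ a ℚ.- c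
    eq = solve 3 (λ a b c → (a :- b) :+ (b :- c) := a :- c) refl
    regroup : ∀ n → (f n - L) + (L - M) ≗ f n - M
    regroup n = mk≗ (λ j → eq (seq (re (f n)) j) (seq (re L) j) (seq (re M) j))
                    (λ j → eq (seq (im (f n)) j) (seq (im L) j) (seq (im M) j))

-- The complex numbers as a commutative ring.

abstract
  ℂ-+-cong : ∀ {z z′ w w′} → z ≈ z′ → w ≈ w′ → z + w ≈ z′ + w′
  ℂ-+-cong {z} {z′} {w} {w′} z≈ w≈ = ⇝⇒≈ {z + w} {z′ + w′}
    (⇝-+ {λ _ → z} {λ _ → w} {z′} {w′} (≈⇒⇝ {z} {z′} z≈) (≈⇒⇝ {w} {w′} w≈))

  ℂ-*-cong : ∀ {z z′ w w′} → z ≈ z′ → w ≈ w′ → z * w ≈ z′ * w′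
  ℂ-*-cong {z} {z′} {w} {w′} z≈ w≈ = ⇝⇒≈ {z * w} {z′ * w′}
    (⇝-* {λ _ → z} {λ _ → w} {z′} {w′} (≈⇒⇝ {z} {z′} z≈) (≈⇒⇝ {w} {w′} w≈))

  ℂ-neg-cong : ∀ {z w} → z ≈ w → - z ≈ - w
  ℂ-neg-cong {z} {w} z≈w = ≼⇒≈ { - z} { - w} λ ε 0<ε → ≼-≗
    (mk≗ (λ n → eq (seq (re z) n) (seq (re w) n)) (λ n → eq (seq (im z) n) (seq (im w) n)))
    (≼-neg (≈⇒≼ {z} {w} z≈w ε 0<ε))
    where
    eq : ∀ a b → ℚ.- (a ℚ.- b) ≡ ℚ.- a ℚ.- ℚ.- b
    eq = solve 2 (λ a b → :- (a :- b) := (:- a) :- (:- b)) refl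

  ℂ-+-assoc : ∀ z w u → (z + w) + u ≈ z + (w + u)
  ℂ-+-assoc z w u = ≗⇒≈ {(z + w) + u} {z + (w + u)} (mk≗
    (λ n → ℚ.+-assoc (seq (re z) n) (seq (re w) n) (seq (re u) n))
    (λ n → ℚ.+-assoc (seq (im z) n) (seq (im w) n) (seq (im u) n)))

  ℂ-+-comm : ∀ z w → z + w ≈ w + z
  ℂ-+-comm z w = ≗⇒≈ {z + w} {w + z} (mk≗
    (λ n → ℚ.+-comm (seq (re z) n) (seq (re w) n)) (λ n → ℚ.+-comm (seq (im z) n) (seq (im w) n)))

  ℂ-+-identityˡ : ∀ z → 0ℂ + z ≈ z
  ℂ-+-identityˡ z = ≗⇒≈ {0ℂ + z} {z} (mk≗
    (λ n → ℚ.+-identityˡ (seq (re z) n)) (λ n → ℚ.+-identityˡ (seq (im z) n)))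

  ℂ-+-inverseˡ : ∀ z → - z + z ≈ 0ℂ
  ℂ-+-inverseˡ z = ≗⇒≈ { - z + z} {0ℂ} (mk≗
    (λ n → ℚ.+-inverseˡ (seq (re z) n)) (λ n → ℚ.+-inverseˡ (seq (im z) n)))

  ℂ-*-comm : ∀ z w → z * w ≈ w * z
  ℂ-*-comm z w = ≗⇒≈ {z * w} {w * z} (mk≗
    (λ n → eq-re (seq (re z) n) (seq (im z) n) (seq (re w) n) (seq (im w) n))
    (λ n → eq-im (seq (re z) n) (seq (im z) n) (seq (re w) n) (seq (im w) n)))
    where
    eq-re : ∀ a b c d → a ℚ.* c ℚ.- b ℚ.* d ≡ c ℚ.* a ℚ.- d ℚ.* b
    eq-re = solve 4 (λ a b c d → a :* c :- b :* d := c :* a :- d :* b) refl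
    eq-im : ∀ a b c d → a ℚ.* d ℚ.+ b ℚ.* c ≡ c ℚ.* b ℚ.+ d ℚ.* a
    eq-im = solve 4 (λ a b c d → a :* d :+ b :* c := c :* b :+ d :* a) refl

  ℂ-*-identityˡ : ∀ z → 1ℂ * z ≈ z
  ℂ-*-identityˡ z = ≗⇒≈ {1ℂ * z} {z} (mk≗
    (λ n → eq-re (seq (re z) n) (seq (im z) n)) (λ n → eq-im (seq (re z) n) (seq (im z) n)))
    where
    eq-re : ∀ a b → 1ℚ ℚ.* a ℚ.- 0ℚ ℚ.* b ≡ a
    eq-re = solve 2 (λ a b → con 1ℚ :* a :- con 0ℚ :* b := a) refl
    eq-im : ∀ a b → 1ℚ ℚ.* b ℚ.+ 0ℚ ℚ.* a ≡ b
    eq-im = solve 2 (λ a b → con 1ℚ :* b :+ con 0ℚ :* a := b) refl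

  ℂ-*-assoc : ∀ z w u → (z * w) * u ≈ z * (w * u)
  ℂ-*-assoc z w u = ≗⇒≈ {(z * w) * u} {z * (w * u)} (mk≗
    (λ n → eq-re (seq (re z) n) (seq (im z) n) (seq (re w) n) (seq (im w) n) (seq (re u) n) (seq (im u) n))
    (λ n → eq-im (seq (re z) n) (seq (im z) n) (seq (re w) n) (seq (im w) n) (seq (re u) n) (seq (im u) n)))
    where
    eq-re : ∀ a b c d e f → (a ℚ.* c ℚ.- b ℚ.* d) ℚ.* e ℚ.- (a ℚ.* d ℚ.+ b ℚ.* c) ℚ.* f
      ≡ a ℚ.* (c ℚ.* e ℚ.- d ℚ.* f) ℚ.- b ℚ.* (c ℚ.* f ℚ.+ d ℚ.* e)
    eq-re = solve 6 (λ a b c d e f → (a :* c :- b :* d) :* e :- (a :* d :+ b :* c) :* f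
      := a :* (c :* e :- d :* f) :- b :* (c :* f :+ d :* e)) refl
    eq-im : ∀ a b c d e f → (a ℚ.* c ℚ.- b ℚ.* d) ℚ.* f ℚ.+ (a ℚ.* d ℚ.+ b ℚ.* c) ℚ.* e
      ≡ a ℚ.* (c ℚ.* f ℚ.+ d ℚ.* e) ℚ.+ b ℚ.* (c ℚ.* e ℚ.- d ℚ.* f)
    eq-im = solve 6 (λ a b c d e f → (a :* c :- b :* d) :* f :+ (a :* d :+ b :* c) :* e
      := a :* (c :* f :+ d :* e) :+ b :* (c :* e :- d :* f)) refl

  ℂ-distribˡ : ∀ z w u → z * (w + u) ≈ z * w + z * u
  ℂ-distribˡ z w u = ≗⇒≈ {z * (w + u)} {z * w + z * u} (mk≗
    (λ n → eq-re (seq (re z) n) (seq (im z) n) (seq (re w) n) (seq (im w) n) (seq (re u) n) (seq (im u) n))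
    (λ n → eq-im (seq (re z) n) (seq (im z) n) (seq (re w) n) (seq (im w) n) (seq (re u) n) (seq (im u) n)))
    where
    eq-re : ∀ a b c d e f → a ℚ.* (c ℚ.+ e) ℚ.- b ℚ.* (d ℚ.+ f)
      ≡ (a ℚ.* c ℚ.- b ℚ.* d) ℚ.+ (a ℚ.* e ℚ.- b ℚ.* f)
    eq-re = solve 6 (λ a b c d e f → a :* (c :+ e) :- b :* (d :+ f)
      := (a :* c :- b :* d) :+ (a :* e :- b :* f)) refl
    eq-im : ∀ a b c d e f → a ℚ.* (d ℚ.+ f) ℚ.+ b ℚ.* (c ℚ.+ e)
      ≡ (a ℚ.* d ℚ.+ b ℚ.* c) ℚ.+ (a ℚ.* f ℚ.+ b ℚ.* e)
    eq-im = solve 6 (λ a b c d e f → a :* (d :+ f) :+ b :* (c :+ e)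
      := (a :* d :+ b :* c) :+ (a :* f :+ b :* e)) refl

  ℂ-+-identityʳ : ∀ z → z + 0ℂ ≈ z
  ℂ-+-identityʳ z = ≈-trans {z + 0ℂ} {0ℂ + z} {z} (ℂ-+-comm z 0ℂ) (ℂ-+-identityˡ z)

  ℂ-+-inverseʳ : ∀ z → z + - z ≈ 0ℂ
  ℂ-+-inverseʳ z = ≈-trans {z + - z} { - z + z} {0ℂ} (ℂ-+-comm z (- z)) (ℂ-+-inverseˡ z)

  ℂ-*-identityʳ : ∀ z → z * 1ℂ ≈ z
  ℂ-*-identityʳ z = ≈-trans {z * 1ℂ} {1ℂ * z} {z} (ℂ-*-comm z 1ℂ) (ℂ-*-identityˡ z)

  ℂ-distribʳ : ∀ z w u → (w + u) * z ≈ w * z + u * z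
  ℂ-distribʳ z w u = ≈-trans {(w + u) * z} {z * (w + u)} {w * z + u * z} (ℂ-*-comm (w + u) z)
    (≈-trans {z * (w + u)} {z * w + z * u} {w * z + u * z} (ℂ-distribˡ z w u)
      (ℂ-+-cong {z * w} {w * z} {z * u} {u * z} (ℂ-*-comm z w) (ℂ-*-comm z u)))

ℂ-commutativeRing : CommutativeRing 0ℓ 0ℓ
ℂ-commutativeRing = record
  { Carrier = ℂ ; _≈_ = _≈_ ; _+_ = _+_ ; _*_ = _*_ ; -_ = -_ ; 0# = 0ℂ ; 1# = 1ℂ
  ; isCommutativeRing = record
    { isRing = record
      { +-isAbelianGroup = record
        { isGroup = record
          { isMonoid = record
            { isSemigroup = record
              { isMagma = record
                { isEquivalence = record
                  { refl  = λ {z} → ≈-refl {z}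
                  ; sym   = λ {z} {w} → ≈-sym {z} {w}
                  ; trans = λ {z} {w} {u} → ≈-trans {z} {w} {u}
                  }
                ; ∙-cong = λ {z} {z′} {w} {w′} → ℂ-+-cong {z} {z′} {w} {w′}
                }
              ; assoc = ℂ-+-assoc
              }
            ; identity = ℂ-+-identityˡ , ℂ-+-identityʳ
            }
          ; inverse = ℂ-+-inverseˡ , ℂ-+-inverseʳ
          ; ⁻¹-cong = λ {z} {w} → ℂ-neg-cong {z} {w}
          }
        ; comm = ℂ-+-comm
        }
      ; *-cong     = λ {z} {z′} {w} {w′} → ℂ-*-cong {z} {z′} {w} {w′}
      ; *-assoc    = ℂ-*-assoc
      ; *-identity = ℂ-*-identityˡ , ℂ-*-identityʳ
      ; distrib    = ℂ-distribˡ , ℂ-distribʳ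
      }
    ; *-comm = ℂ-*-comm
    }
  }

-- Comparison with the squared modulus, and inverses.

abstract
  0≤∣∣² : ∀ z n → 0ℚ ℚ.≤ seq ∣ z ∣² n
  0≤∣∣² z n = ℚ.+-mono-≤ (0≤p² (seq (re z) n)) (0≤p² (seq (im z) n))

  ∣∣²≤‖‖² : ∀ z n → seq ∣ z ∣² n ℚ.≤ ‖ z ‖ n ℚ.* ‖ z ‖ n
  ∣∣²≤‖‖² z n = difference {d = d} (ℚ.+-mono-≤ 0≤ab 0≤ab)
    (trans (solve 4 (λ a b s t → a :* b :+ a :* b := (a :+ b) :* (a :+ b) :- (a :* a :+ b :* b)) refl a b a b)
      (cong (λ t → (a ℚ.+ b) ℚ.* (a ℚ.+ b) ℚ.- t) (cong₂ ℚ._+_ (∣p∣*∣p∣≡p*p (seq (re z) n)) (∣p∣*∣p∣≡p*p (seq (im z) n)))))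
    where
    a b d : ℚ
    a = ℚ.∣ seq (re z) n ∣
    b = ℚ.∣ seq (im z) n ∣
    d = a ℚ.* b ℚ.+ a ℚ.* b
    0≤ab : 0ℚ ℚ.≤ a ℚ.* b
    0≤ab = 0≤p*q (ℚ.0≤∣p∣ (seq (re z) n)) (ℚ.0≤∣p∣ (seq (im z) n))

  -- Some rational e > 0 lies eventually below ε. With δ = e/2 the squared modulus is at most δ²,
  -- and δ² + δ² ≤ e² leaves a second δ² as the rational gap that `<ℝ` asks for.
  ⇝⇒⟶ : ∀ {f L} → f ⇝ L → f ⟶ L
  ⇝⇒⟶ {f} {L} f⇝L ε 0<ε@(e , 0<e , M , e≤ε) =
    eventually-map {λ n → f n - L ≼ ½ ℚ.* e} {λ n → ∣ f n - L ∣< ε}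
      (λ n p → 0<ε , δ ℚ.* δ , 0<p*q 0<δ 0<δ ,
        eventually-zip {λ m → ‖ f n - L ‖ m ℚ.≤ δ} {λ m → e ℚ.≤ seq ε m}
          {λ m → seq ∣ f n - L ∣² m ℚ.+ δ ℚ.* δ ℚ.≤ seq (ε *ℝ ε) m}
          (λ m b e≤ → ℚ.≤-trans
            (ℚ.+-monoˡ-≤ (δ ℚ.* δ) (ℚ.≤-trans (∣∣²≤‖‖² (f n - L) m)
              (*-mono {‖ f n - L ‖ m} {δ} {‖ f n - L ‖ m} {δ} (0≤‖‖ (f n - L) m) (ℚ.<⇒≤ 0<δ) b b)))
            (ℚ.≤-trans 2δ²≤e² (*-mono {e} {seq ε m} {e} {seq ε m} (ℚ.<⇒≤ 0<e) (ℚ.≤-trans (ℚ.<⇒≤ 0<e) e≤) e≤ e≤)))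
          (bounds p) (M , λ m m≥ → subst (ℚ._≤ seq ε m) (ℚ.+-identityˡ e) (e≤ε m m≥)))
      (tends f⇝L δ 0<δ)
    where
    δ : ℚ
    δ = ½ ℚ.* e
    0<δ : 0ℚ ℚ.< δ
    0<δ = 0<½ε 0<e
    2δ²≤e² : δ ℚ.* δ ℚ.+ δ ℚ.* δ ℚ.≤ e ℚ.* e
    2δ²≤e² = subst (λ t → δ ℚ.* δ ℚ.+ δ ℚ.* δ ℚ.≤ t ℚ.* t) (½ε+½ε≡ε e)
      (difference {d = δ ℚ.* δ ℚ.+ δ ℚ.* δ} (ℚ.+-mono-≤ (0≤p² δ) (0≤p² δ))
        (solve 1 (λ δ → δ :* δ :+ δ :* δ := (δ :+ δ) :* (δ :+ δ) :- (δ :* δ :+ δ :* δ)) refl δ))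

  -- Within 3/4 of 1 the real part is at least 1/4. The 3/4 is the 1/2 by which partial products may
  -- stray from 1, plus 1/4 between the limit and one of them.
  ≼⇒#0 : ∀ {z} → z - 1ℂ ≼ ½ ℚ.+ ½ ℚ.* ½ → z #0
  ≼⇒#0 {z} h = κ ℚ.* κ , 0<p*q 0<κ 0<κ , eventually-map
    {λ n → ‖ z - 1ℂ ‖ n ℚ.≤ ½ ℚ.+ κ} {λ n → 0ℚ ℚ.+ κ ℚ.* κ ℚ.≤ seq ∣ z ∣² n}
    (λ n p → subst (ℚ._≤ seq ∣ z ∣² n) (sym (ℚ.+-identityˡ (κ ℚ.* κ))) (bound n p)) (bounds h)
    where
    κ : ℚ
    κ = ½ ℚ.* ½
    0<κ : 0ℚ ℚ.< κ
    0<κ = ℚ.positive⁻¹ κ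
    bound : ∀ n → ‖ z - 1ℂ ‖ n ℚ.≤ ½ ℚ.+ κ → κ ℚ.* κ ℚ.≤ seq ∣ z ∣² n
    bound n p = ℚ.≤-trans (*-mono {κ} {a} {κ} {a} (ℚ.<⇒≤ 0<κ) (ℚ.≤-trans (ℚ.<⇒≤ 0<κ) κ≤a) κ≤a κ≤a)
        (difference {d = b ℚ.* b} (0≤p² b) (solve 2 (λ a b → b := a :+ b :- a) refl (a ℚ.* a) (b ℚ.* b)))
      where
      a b : ℚ
      a = seq (re z) n
      b = seq (im z) n
      1-a≤ : 1ℚ ℚ.- a ℚ.≤ ½ ℚ.+ κ
      1-a≤ = ℚ.≤-trans (p≤∣p∣ (1ℚ ℚ.- a)) (ℚ.≤-trans
        (ℚ.≤-reflexive (trans (sym (ℚ.∣-p∣≡∣p∣ (1ℚ ℚ.- a)))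
          (cong ℚ.∣_∣ (solve 2 (λ o a → :- (o :- a) := a :- o) refl 1ℚ a))))
        (ℚ.≤-trans (∣re∣≤‖‖ (z - 1ℂ) n) p))
      κ≤a : κ ℚ.≤ a
      κ≤a = difference (0≤q-p 1-a≤) (solve 1 (λ a → con (½ ℚ.+ κ) :- (con 1ℚ :- a) := a :- con κ) refl a)

-- The second factor in the definition of `/`, so `z / w [ w#0 ]` is `z * inv w w#0` by computation.
inv : (w : ℂ) → w #0 → ℂ
inv w w#0 = (re w *ℝ r) +i (-ℝ im w *ℝ r)
  where
  r : ℝ
  r = 1/ℝ ∣ w ∣² w#0

abstract
  p≤1+p : ∀ p → p ℚ.≤ 1ℚ ℚ.+ p
  p≤1+p p = difference {d = 1ℚ} (ℚ.<⇒≤ (ℚ.positive⁻¹ 1ℚ)) (solve 2 (λ o s → o := o :+ s :- s) refl 1ℚ p)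

  -- The reciprocal is shifted by N, so the product is not 1 term by term. It misses 1 by ρ_n (x_n -
  -- x_(N+n)), a bounded factor times a Cauchy difference.
  x*1/x≈1 : ∀ x 0<x → x *ℝ 1/ℝ x 0<x ≈ℝ 1ℝ
  x*1/x≈1 x 0<x@(ε , 0<ε , N , ε≤x) η 0<η =
    eventually-zip {λ n → ℚ.∣ ρ n ∣ ℚ.≤ proj₁ ρ-bounded} {λ n → ℚ.∣ seq x n ℚ.- seq x (N ℕ.+ n) ∣ ℚ.< δ}
      {λ n → ℚ.∣ seq x n ℚ.* ρ n ℚ.- 1ℚ ∣ ℚ.< η}
      (λ n ρ≤K Δ<δ → ℚ.≤-<-trans
        (ℚ.≤-trans (ℚ.≤-reflexive (trans (cong ℚ.∣_∣ (eq n)) (ℚ.∣p*q∣≡∣p∣*∣q∣ (ρ n) (Δ n))))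
          (subst (ℚ.∣ ρ n ∣ ℚ.* ℚ.∣ Δ n ∣ ℚ.≤_) (proj₂ (proj₂ δ-exists))
            (*-mono {ℚ.∣ ρ n ∣} {K} {ℚ.∣ Δ n ∣} {δ} (ℚ.0≤∣p∣ (ρ n)) (ℚ.<⇒≤ 0<δ) (ℚ.≤-trans ρ≤K (p≤1+p (proj₁ ρ-bounded))) (ℚ.<⇒≤ Δ<δ))))
        (½ε<ε 0<η))
      (proj₂ ρ-bounded)
      (let M , h = cauchy x δ 0<δ in M , λ n n≥ → h n (N ℕ.+ n) n≥ (ℕ.≤-trans n≥ (ℕ.m≤n+m n N)))
    where
    open Reciprocal (seq x) (cauchy x) ε 0<ε N ε≤x
    ρ Δ : ℕ → ℚ
    ρ = seq (1/ℝ x 0<x)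
    Δ n = seq x n ℚ.- seq x (N ℕ.+ n)
    ρ-bounded : Σ[ K ∈ ℚ ] Eventually (λ n → ℚ.∣ ρ n ∣ ℚ.≤ K)
    ρ-bounded = ℝ-bounded (1/ℝ x 0<x)
    K : ℚ
    K = 1ℚ ℚ.+ proj₁ ρ-bounded
    0<K : 0ℚ ℚ.< K
    0<K = 0<p+q (ℚ.positive⁻¹ 1ℚ)
      (ℚ.≤-trans (ℚ.0≤∣p∣ (ρ (proj₁ (proj₂ ρ-bounded)))) (proj₂ (proj₂ ρ-bounded) _ ℕ.≤-refl))
    δ-exists : Σ[ δ ∈ ℚ ] (0ℚ ℚ.< δ) × K ℚ.* δ ≡ ½ ℚ.* η
    δ-exists = quotient K (½ ℚ.* η) 0<K (0<½ε 0<η)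
    δ : ℚ
    δ = proj₁ δ-exists
    0<δ : 0ℚ ℚ.< δ
    0<δ = proj₁ (proj₂ δ-exists)
    eq : ∀ n → seq x n ℚ.* ρ n ℚ.- 1ℚ ≡ ρ n ℚ.* Δ n
    eq n = trans (cong (λ t → seq x n ℚ.* ρ n ℚ.- t) (sym (recip-inverse n)))
      (solve 3 (λ s t r → s :* r :- t :* r := r :* (s :- t)) refl (seq x n) (seq x (N ℕ.+ n)) (ρ n))

  inv-inverse : ∀ w w#0 → w * inv w w#0 ≈ 1ℂ
  inv-inverse w w#0 = ≈-trans {w * inv w w#0} {u} {1ℂ}
    (≗⇒≈ {w * inv w w#0} {u} (mk≗
      (λ n → eq-re (seq (re w) n) (seq (im w) n) (seq (1/ℝ ∣ w ∣² w#0) n))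
      (λ n → eq-im (seq (re w) n) (seq (im w) n) (seq (1/ℝ ∣ w ∣² w#0) n))))
    (x*1/x≈1 ∣ w ∣² w#0 , proj₂ (≈-refl {1ℂ}))
    where
    u : ℂ
    u = (∣ w ∣² *ℝ 1/ℝ ∣ w ∣² w#0) +i 0ℝ
    eq-re : ∀ a b r → a ℚ.* (a ℚ.* r) ℚ.- b ℚ.* (ℚ.- b ℚ.* r) ≡ (a ℚ.* a ℚ.+ b ℚ.* b) ℚ.* r
    eq-re = solve 3 (λ a b r → a :* (a :* r) :- b :* ((:- b) :* r) := (a :* a :+ b :* b) :* r) refl
    eq-im : ∀ a b r → a ℚ.* (ℚ.- b ℚ.* r) ℚ.+ b ℚ.* (a ℚ.* r) ≡ 0ℚ
    eq-im = solve 3 (λ a b r → a :* ((:- b) :* r) :+ b :* (a :* r) := con 0ℚ) refl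

  -- The bound depends on κ and K alone and not on the gap and index stored in `w#0`, so it is
  -- uniform along a sequence of inverses.
  inv-≼ : ∀ {w w#0 κ e K} → 0ℚ ℚ.< κ → 0ℚ ℚ.≤ e → κ ℚ.* e ≡ 1ℚ →
    Eventually (λ n → κ ℚ.≤ seq ∣ w ∣² n) → w ≼ K → inv w w#0 ≼ K ℚ.* e
  inv-≼ {w} {w#0@(ε , 0<ε , N , ε≤)} {κ} {e} {K} 0<κ 0≤e κe≡1 (M , κ≤) w≼K = mk≼
    (eventually-zip {λ n → κ ℚ.≤ s (N ℕ.+ n)} {λ n → ‖ w ‖ n ℚ.≤ K} {λ n → ‖ inv w w#0 ‖ n ℚ.≤ K ℚ.* e}
      (λ n κ≤s w≤K → ℚ.≤-trans (ℚ.≤-reflexive (norm n))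
        (*-mono {‖ w ‖ n} {K} {ℚ.∣ ρ n ∣} {e} (0≤‖‖ w n) 0≤e w≤K
          (ℚ.≤-trans (ℚ.≤-reflexive (ℚ.0≤p⇒∣p∣≡p (0≤ρ n κ≤s))) (ρ≤e n κ≤s))))
      (M , λ n n≥ → κ≤ (N ℕ.+ n) (ℕ.≤-trans n≥ (ℕ.m≤n+m n N)))
      (bounds w≼K))
    where
    open Reciprocal (seq ∣ w ∣²) (cauchy ∣ w ∣²) ε 0<ε N ε≤
    s ρ : ℕ → ℚ
    s = seq ∣ w ∣²
    ρ = recip
    0≤ρ : ∀ n → κ ℚ.≤ s (N ℕ.+ n) → 0ℚ ℚ.≤ ρ n
    0≤ρ n κ≤s = subst (0ℚ ℚ.≤_)
      (trans (solve 2 (λ r s → r :* r :* s := r :* (s :* r)) refl (ρ n) (s (N ℕ.+ n)))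
        (trans (cong (ρ n ℚ.*_) (recip-inverse n)) (ℚ.*-identityʳ (ρ n))))
      (0≤p*q (0≤p² (ρ n)) (ℚ.≤-trans (ℚ.<⇒≤ 0<κ) κ≤s))
    ρ≤e : ∀ n → κ ℚ.≤ s (N ℕ.+ n) → ρ n ℚ.≤ e
    ρ≤e n κ≤s = subst₂ ℚ._≤_
      (trans (solve 3 (λ k r e → k :* (r :* e) := r :* (k :* e)) refl κ (ρ n) e)
        (trans (cong (ρ n ℚ.*_) κe≡1) (ℚ.*-identityʳ (ρ n))))
      (trans (sym (ℚ.*-assoc (s (N ℕ.+ n)) (ρ n) e)) (trans (cong (ℚ._* e) (recip-inverse n)) (ℚ.*-identityˡ e)))
      (*-monoʳ {ρ n ℚ.* e} {κ} {s (N ℕ.+ n)} (0≤p*q (0≤ρ n κ≤s) 0≤e) κ≤s)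
    norm : ∀ n → ‖ inv w w#0 ‖ n ≡ ‖ w ‖ n ℚ.* ℚ.∣ ρ n ∣
    norm n = trans
      (cong₂ ℚ._+_ (ℚ.∣p*q∣≡∣p∣*∣q∣ (seq (re w) n) (ρ n))
        (trans (ℚ.∣p*q∣≡∣p∣*∣q∣ (ℚ.- seq (im w) n) (ρ n)) (cong (ℚ._* ℚ.∣ ρ n ∣) (ℚ.∣-p∣≡∣p∣ (seq (im w) n)))))
      (sym (ℚ.*-distribʳ-+ ℚ.∣ ρ n ∣ ℚ.∣ seq (re w) n ∣ ℚ.∣ seq (im w) n ∣))

  -- A difference of squares in each coordinate; the cross terms of the product of norms only
  -- enlarge the right side.
  ∣∣²-lipschitz : ∀ z w n → seq ∣ z ∣² n ℚ.≤ seq ∣ w ∣² n ℚ.+ ‖ w - z ‖ n ℚ.* ‖ w + z ‖ n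
  ∣∣²-lipschitz z w n = subst₂ ℚ._≤_
    (solve 4 (λ a b c d → c :* c :+ d :* d :+ :- ((c :- a) :* (c :+ a) :+ (d :- b) :* (d :+ b)) := a :* a :+ b :* b)
      refl a b c d)
    refl
    (ℚ.+-monoʳ-≤ (c ℚ.* c ℚ.+ d ℚ.* d) bound)
    where
    a b c d : ℚ
    a = seq (re z) n
    b = seq (im z) n
    c = seq (re w) n
    d = seq (im w) n
    Δ : ℚ
    Δ = (c ℚ.- a) ℚ.* (c ℚ.+ a) ℚ.+ (d ℚ.- b) ℚ.* (d ℚ.+ b)
    cross : ∀ p q r s → 0ℚ ℚ.≤ p → 0ℚ ℚ.≤ q → 0ℚ ℚ.≤ r → 0ℚ ℚ.≤ s → p ℚ.* q ℚ.+ r ℚ.* s ℚ.≤ (p ℚ.+ r) ℚ.* (q ℚ.+ s)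
    cross p q r s 0≤p 0≤q 0≤r 0≤s = difference {d = p ℚ.* s ℚ.+ r ℚ.* q}
      (ℚ.+-mono-≤ (0≤p*q 0≤p 0≤s) (0≤p*q 0≤r 0≤q))
      (solve 4 (λ p q r s → p :* s :+ r :* q := (p :+ r) :* (q :+ s) :- (p :* q :+ r :* s)) refl p q r s)
    bound : ℚ.- Δ ℚ.≤ ‖ w - z ‖ n ℚ.* ‖ w + z ‖ n
    bound = ℚ.≤-trans (p≤∣p∣ (ℚ.- Δ)) (ℚ.≤-trans (ℚ.≤-reflexive (ℚ.∣-p∣≡∣p∣ Δ))
      (ℚ.≤-trans (ℚ.∣p+q∣≤∣p∣+∣q∣ ((c ℚ.- a) ℚ.* (c ℚ.+ a)) ((d ℚ.- b) ℚ.* (d ℚ.+ b)))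
      (ℚ.≤-trans (ℚ.≤-reflexive (cong₂ ℚ._+_ (ℚ.∣p*q∣≡∣p∣*∣q∣ (c ℚ.- a) (c ℚ.+ a)) (ℚ.∣p*q∣≡∣p∣*∣q∣ (d ℚ.- b) (d ℚ.+ b))))
        (cross ℚ.∣ c ℚ.- a ∣ ℚ.∣ c ℚ.+ a ∣ ℚ.∣ d ℚ.- b ∣ ℚ.∣ d ℚ.+ b ∣
          (ℚ.0≤∣p∣ (c ℚ.- a)) (ℚ.0≤∣p∣ (c ℚ.+ a)) (ℚ.0≤∣p∣ (d ℚ.- b)) (ℚ.0≤∣p∣ (d ℚ.+ b))))))

  ⇝-bounded-below : ∀ {g B} → g ⇝ B → B #0 →
    Σ[ κ ∈ ℚ ] (0ℚ ℚ.< κ) × Eventually (λ n → Eventually (λ m → κ ℚ.≤ seq ∣ g n ∣² m))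
  ⇝-bounded-below {g} {B} g⇝B (κ , 0<κ , N , κ≤) =
    let A , 0<A , g≼A = ⇝-bounded g⇝B
        C , 0<C , B≼C = ≼-exists B
        -- This δ makes the error allowed by `∣∣²-lipschitz` equal to κ/2, which leaves κ/2 of the
        -- lower bound κ for B.
        δ , 0<δ , Kδ≡ = quotient (A ℚ.+ C) (½ ℚ.* κ) (0<p+q 0<A (ℚ.<⇒≤ 0<C)) (0<½ε 0<κ)
    in ½ ℚ.* κ , 0<½ε 0<κ ,
       eventually-zip {λ n → g n ≼ A} {λ n → g n - B ≼ δ} {λ n → Eventually (λ m → ½ ℚ.* κ ℚ.≤ seq ∣ g n ∣² m)}
         (λ n g≼ g-B≼ →
           eventually-zip {λ m → ‖ g n + B ‖ m ℚ.≤ A ℚ.+ C} {λ m → (‖ g n - B ‖ m ℚ.≤ δ) × (κ ℚ.≤ seq ∣ B ∣² m)}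
             {λ m → ½ ℚ.* κ ℚ.≤ seq ∣ g n ∣² m}
             (λ m p q → bound A C δ n m Kδ≡ (ℚ.≤-trans (0≤‖‖ (g n + B) m) p) p (proj₁ q) (proj₂ q))
             (bounds (≼-+ {g n} {B} {A} {C} g≼ B≼C))
             (eventually-zip {λ m → ‖ g n - B ‖ m ℚ.≤ δ} {λ m → κ ℚ.≤ seq ∣ B ∣² m} (λ _ → _,_) (bounds g-B≼)
               (N , λ m m≥ → subst (ℚ._≤ seq ∣ B ∣² m) (ℚ.+-identityˡ κ) (κ≤ m m≥))))
         g≼A (tends g⇝B δ 0<δ)
    where
    bound : ∀ A C δ n m → (A ℚ.+ C) ℚ.* δ ≡ ½ ℚ.* κ → 0ℚ ℚ.≤ A ℚ.+ C →
      ‖ g n + B ‖ m ℚ.≤ A ℚ.+ C → ‖ g n - B ‖ m ℚ.≤ δ → κ ℚ.≤ seq ∣ B ∣² m → ½ ℚ.* κ ℚ.≤ seq ∣ g n ∣² m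
    bound A C δ n m Kδ≡ 0≤K p q κ≤ = difference (0≤q-p κ≤s+½κ)
      (trans (cong (λ t → s ℚ.+ ½ ℚ.* κ ℚ.- t) (sym (½ε+½ε≡ε κ)))
        (solve 2 (λ s h → s :+ h :- (h :+ h) := s :- h) refl s (½ ℚ.* κ)))
      where
      s : ℚ
      s = seq ∣ g n ∣² m
      κ≤s+½κ : κ ℚ.≤ s ℚ.+ ½ ℚ.* κ
      κ≤s+½κ = ℚ.≤-trans κ≤ (ℚ.≤-trans (∣∣²-lipschitz B (g n) m) (ℚ.+-monoʳ-≤ s
        (subst (‖ g n - B ‖ m ℚ.* ‖ g n + B ‖ m ℚ.≤_) (trans (ℚ.*-comm δ (A ℚ.+ C)) Kδ≡)
          (*-mono {‖ g n - B ‖ m} {δ} {‖ g n + B ‖ m} {A ℚ.+ C} (0≤‖‖ (g n - B) m) 0≤K q p))))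

  bounded-*-null : ∀ {u f : ℕ → ℂ} {K} → 0ℚ ℚ.< K → Eventually (λ n → u n ≼ K) → f ⇝ 0ℂ → (λ n → u n * f n) ⇝ 0ℂ
  bounded-*-null {u} {f} {K} 0<K u≼K f⇝0 = mk⇝ λ ε 0<ε →
    let δ , 0<δ , Kδ≡ε = quotient K ε 0<K 0<ε
    in eventually-zip {λ n → u n ≼ K} {λ n → f n - 0ℂ ≼ δ} {λ n → u n * f n - 0ℂ ≼ ε}
         (λ n u≼ f≼ → ≼-≗ {u n * f n} {u n * f n - 0ℂ} (z≗z-0 (u n * f n))
           (subst (u n * f n ≼_) Kδ≡ε (≼-* {u n} {f n} {K} {δ} u≼ (≼-≗ {f n - 0ℂ} {f n} (z-0≗z (f n)) f≼))))
         u≼K (tends f⇝0 δ 0<δ)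
    where
    z-0≗z : ∀ z → z - 0ℂ ≗ z
    z-0≗z z = mk≗ (λ n → ℚ.+-identityʳ (seq (re z) n)) (λ n → ℚ.+-identityʳ (seq (im z) n))
    z≗z-0 : ∀ z → z ≗ z - 0ℂ
    z≗z-0 z = mk≗ (λ n → sym (ℚ.+-identityʳ (seq (re z) n))) (λ n → sym (ℚ.+-identityʳ (seq (im z) n)))

  ⇝-const : ∀ z → (λ _ → z) ⇝ z
  ⇝-const z = ≈⇒⇝ {z} {z} (≈-refl {z})

  -- Beforehand the inverses are known only to be bounded, so `inverse-difference` is combined with
  -- `bounded-*-null` in place of the product rule.
  inv-⇝ : ∀ {g B} (g#0 : ∀ n → g n #0) (B#0 : B #0) → g ⇝ B → (λ n → inv (g n) (g#0 n)) ⇝ inv B B#0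
  inv-⇝ {g} {B} g#0 B#0 g⇝B =
    let κ , 0<κ , κ≤ = ⇝-bounded-below g⇝B B#0
        e , 0<e , κe≡1 = quotient κ 1ℚ 0<κ (ℚ.positive⁻¹ 1ℚ)
        A , 0<A , g≼A = ⇝-bounded g⇝B
        u≼ : Eventually (λ n → u n ≼ A ℚ.* e)
        u≼ = eventually-zip {λ n → Eventually (λ m → κ ℚ.≤ seq ∣ g n ∣² m)} {λ n → g n ≼ A} {λ n → u n ≼ A ℚ.* e}
          (λ n κ≤g g≼ → inv-≼ {g n} {g#0 n} {κ} {e} {A} 0<κ (ℚ.<⇒≤ 0<e) κe≡1 κ≤g g≼) κ≤ g≼A
    in ⇝-cong {λ n → u n * (w * (B - g n)) + w} {u} {w}
         (λ n → inverse-difference {B} {w} {g n} {u n} (inv-inverse B B#0) (inv-inverse (g n) (g#0 n)))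
         (⇝-congʳ {λ n → u n * (w * (B - g n)) + w} {0ℂ + w} {w} (ℂ-+-identityˡ w)
           (⇝-+ {λ n → u n * (w * (B - g n))} {λ _ → w} {0ℂ} {w}
             (bounded-*-null {u} {λ n → w * (B - g n)} {A ℚ.* e} (0<p*q 0<A 0<e) u≼ w[B-g]⇝0)
             (⇝-const w)))
    where
    open RingLemmas ℂ-commutativeRing
    u : ℕ → ℂ
    u n = inv (g n) (g#0 n)
    w : ℂ
    w = inv B B#0
    w[B-g]⇝0 : (λ n → w * (B - g n)) ⇝ 0ℂ
    w[B-g]⇝0 = ⇝-cong {λ n → w * (B + (- 1ℂ) * g n)} {λ n → w * (B - g n)} {0ℂ} (λ n → w*[b+-1*g]≈w*[b-g] B w (g n))
      (⇝-congʳ {λ n → w * (B + (- 1ℂ) * g n)} {w * (B + (- 1ℂ) * B)} {0ℂ} (w*[b+-1*b]≈0 B w)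
        (⇝-* {λ _ → w} {λ n → B + (- 1ℂ) * g n} {w} {B + (- 1ℂ) * B} (⇝-const w)
          (⇝-+ {λ _ → B} {λ n → (- 1ℂ) * g n} {B} {(- 1ℂ) * B} (⇝-const B)
            (⇝-* {λ _ → - 1ℂ} {g} { - 1ℂ} {B} (⇝-const (- 1ℂ)) g⇝B))))

-- Completeness, for sequences with an explicit rate.

3* : ℚ → ℚ
3* e = e ℚ.+ e ℚ.+ e

module Completeness (e : ℕ → ℚ) (0<e : ∀ n → 0ℚ ℚ.< e n)
  (e-anti : ∀ {m n} → m ℕ.≤ n → e n ℚ.≤ e m) (e-null : ∀ ε → 0ℚ ℚ.< ε → ∃[ M ] e M ℚ.≤ ε) where

  abstract
    3e-null : ∀ ε → 0ℚ ℚ.< ε → ∃[ M ] 3* (e M) ℚ.< ½ ℚ.* ε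
    3e-null ε 0<ε =
      let M , e≤η = e-null η 0<η
      in M , ℚ.≤-<-trans {3* (e M)} {3* η} {½ ℚ.* ε} (ℚ.+-mono-≤ (ℚ.+-mono-≤ e≤η e≤η) e≤η)
        (subst₂ ℚ._<_ (ℚ.+-identityʳ (3* η)) 4η≡ (ℚ.+-monoʳ-< (3* η) 0<η))
      where
      -- One eighth of ε: 3η < 4η = ε/2 keeps the inequality strict.
      η : ℚ
      η = ½ ℚ.* (½ ℚ.* (½ ℚ.* ε))
      0<η : 0ℚ ℚ.< η
      0<η = 0<½ε (0<½ε (0<½ε 0<ε))
      4η≡ : 3* η ℚ.+ η ≡ ½ ℚ.* ε
      4η≡ = trans (solve 1 (λ η → η :+ η :+ η :+ η := (η :+ η) :+ (η :+ η)) refl η)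
        (trans (cong₂ ℚ._+_ (½ε+½ε≡ε (½ ℚ.* (½ ℚ.* ε))) (½ε+½ε≡ε (½ ℚ.* (½ ℚ.* ε)))) (½ε+½ε≡ε (½ ℚ.* ε)))

  -- The limit is the diagonal m ↦ x m (ν m), where ν m is a modulus at which x m is known up to e m.
  module Diagonal (x : ℕ → ℝ)
    (close : ∀ m n → m ℕ.≤ n → Eventually (λ i → ℚ.∣ seq (x m) i ℚ.- seq (x n) i ∣ ℚ.≤ e m)) where

    ν : ℕ → ℕ
    ν m = proj₁ (cauchy (x m) (e m) (0<e m))

    diagonal : ℕ → ℚ
    diagonal m = seq (x m) (ν m)

    abstract
      -- Three legs through a common late index i: from j to i within x_m, across from x_m to x_n at
      -- i, and from i back to ν n within x_n. Each costs at most e m.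
      diagonal-close : ∀ m n j → m ℕ.≤ n → ν m ℕ.≤ j → ℚ.∣ seq (x m) j ℚ.- diagonal n ∣ ℚ.≤ 3* (e m)
      diagonal-close m n j m≤n νm≤j = ℚ.≤-trans
        (subst (λ t → ℚ.∣ t ∣ ℚ.≤ ℚ.∣ a ∣ ℚ.+ ℚ.∣ b ∣ ℚ.+ ℚ.∣ c ∣)
          (solve 4 (λ p q r s → (p :- q) :+ (q :- r) :+ (r :- s) := p :- s) refl
            (seq (x m) j) (seq (x m) i) (seq (x n) i) (diagonal n))
          (ℚ.≤-trans (ℚ.∣p+q∣≤∣p∣+∣q∣ (a ℚ.+ b) c) (ℚ.+-monoˡ-≤ ℚ.∣ c ∣ (ℚ.∣p+q∣≤∣p∣+∣q∣ a b))))
        (ℚ.+-mono-≤ (ℚ.+-mono-≤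
          (ℚ.<⇒≤ (proj₂ (cauchy (x m) (e m) (0<e m)) j i νm≤j (ℕ.≤-trans (ℕ.m≤m⊔n (ν m) (ν n)) (ℕ.m≤m⊔n (ν m ℕ.⊔ ν n) N))))
          (proj₂ (close m n m≤n) i (ℕ.m≤n⊔m (ν m ℕ.⊔ ν n) N)))
          (ℚ.≤-trans (ℚ.<⇒≤ (proj₂ (cauchy (x n) (e n) (0<e n)) i (ν n)
            (ℕ.≤-trans (ℕ.m≤n⊔m (ν m) (ν n)) (ℕ.m≤m⊔n (ν m ℕ.⊔ ν n) N)) ℕ.≤-refl)) (e-anti m≤n)))
        where
        N i : ℕ
        N = proj₁ (close m n m≤n)
        i = ν m ℕ.⊔ ν n ℕ.⊔ N
        a b c : ℚ
        a = seq (x m) j ℚ.- seq (x m) i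
        b = seq (x m) i ℚ.- seq (x n) i
        c = seq (x n) i ℚ.- diagonal n

      diagonal-cauchy : IsCauchy diagonal
      diagonal-cauchy ε 0<ε =
        let M , 3e< = 3e-null ε 0<ε
        in M , λ m n m≥ n≥ → ℚ.≤-<-trans
          (subst (λ t → ℚ.∣ t ∣ ℚ.≤ 3* (e M) ℚ.+ 3* (e M))
            (solve 3 (λ u v w → :- (u :- v) :+ (u :- w) := v :- w) refl (diagonal M) (diagonal m) (diagonal n))
            (ℚ.≤-trans (ℚ.∣p+q∣≤∣p∣+∣q∣ (ℚ.- (diagonal M ℚ.- diagonal m)) (diagonal M ℚ.- diagonal n))
              (ℚ.+-mono-≤
                (subst (ℚ._≤ 3* (e M)) (sym (ℚ.∣-p∣≡∣p∣ (diagonal M ℚ.- diagonal m))) (diagonal-close M m (ν M) m≥ ℕ.≤-refl))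
                (diagonal-close M n (ν M) n≥ ℕ.≤-refl))))
          (subst (3* (e M) ℚ.+ 3* (e M) ℚ.<_) (½ε+½ε≡ε ε) (ℚ.+-mono-< 3e< 3e<))

    limit : ℝ
    limit = mkℝ diagonal diagonal-cauchy

    abstract
      limit-close : ∀ m → Eventually (λ j → ℚ.∣ seq (x m) j ℚ.- seq limit j ∣ ℚ.≤ 3* (e m))
      limit-close m = m ℕ.⊔ ν m , λ j j≥ →
        diagonal-close m j j (ℕ.≤-trans (ℕ.m≤m⊔n m (ν m)) j≥) (ℕ.≤-trans (ℕ.m≤n⊔m m (ν m)) j≥)

  abstract
    complete : ∀ f → (∀ m n → m ℕ.≤ n → f m - f n ≼ e m) → Σ[ L ∈ ℂ ] f ⇝ L
    complete f close = L , mk⇝ λ ε 0<ε →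
      let M , 3e< = 3e-null ε 0<ε
      in M , λ n n≥ → mk≼ (eventually-zip
           {λ j → ℚ.∣ seq (re (f n)) j ℚ.- seq (re L) j ∣ ℚ.≤ 3* (e n)}
           {λ j → ℚ.∣ seq (im (f n)) j ℚ.- seq (im L) j ∣ ℚ.≤ 3* (e n)}
           {λ j → ‖ f n - L ‖ j ℚ.≤ ε}
           (λ j p q → subst (‖ f n - L ‖ j ℚ.≤_) (½ε+½ε≡ε ε)
             (ℚ.+-mono-≤ (ℚ.≤-trans p (3e≤ n M ε n≥ 3e<)) (ℚ.≤-trans q (3e≤ n M ε n≥ 3e<))))
           (Re.limit-close n) (Im.limit-close n))
      where
      module Re = Diagonal (λ n → re (f n))
        (λ m n m≤n → eventually-map {λ i → ‖ f m - f n ‖ i ℚ.≤ e m}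
          (λ i → ℚ.≤-trans (∣re∣≤‖‖ (f m - f n) i)) (bounds (close m n m≤n)))
      module Im = Diagonal (λ n → im (f n))
        (λ m n m≤n → eventually-map {λ i → ‖ f m - f n ‖ i ℚ.≤ e m}
          (λ i → ℚ.≤-trans (∣im∣≤‖‖ (f m - f n) i)) (bounds (close m n m≤n)))
      L : ℂ
      L = Re.limit +i Im.limit
      3e≤ : ∀ n M ε → M ℕ.≤ n → 3* (e M) ℚ.< ½ ℚ.* ε → 3* (e n) ℚ.≤ ½ ℚ.* ε
      3e≤ n M ε M≤n 3e< = ℚ.≤-trans
        (ℚ.+-mono-≤ (ℚ.+-mono-≤ (e-anti M≤n) (e-anti M≤n)) (e-anti M≤n)) (ℚ.<⇒≤ 3e<)

-- Decay of powers and convergence of infinite products.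

2ℚ : ℚ
2ℚ = 1ℚ ℚ.+ 1ℚ

abstract
  0<2 : 0ℚ ℚ.< 2ℚ
  0<2 = ℚ.positive⁻¹ 2ℚ

  ∣∣²-* : ∀ z w n → seq ∣ z * w ∣² n ≡ seq ∣ z ∣² n ℚ.* seq ∣ w ∣² n
  ∣∣²-* z w n = solve 4
    (λ a b c d → (a :* c :+ :- (b :* d)) :* (a :* c :+ :- (b :* d)) :+ (a :* d :+ b :* c) :* (a :* d :+ b :* c)
      := (a :* a :+ b :* b) :* (c :* c :+ d :* d))
    refl (seq (re z) n) (seq (im z) n) (seq (re w) n) (seq (im w) n)

  ‖‖≤2s : ∀ z n {s} → 0ℚ ℚ.≤ s → seq ∣ z ∣² n ℚ.≤ s ℚ.* s → ‖ z ‖ n ℚ.≤ 2ℚ ℚ.* s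
  ‖‖≤2s z n {s} 0≤s h = subst (‖ z ‖ n ℚ.≤_) (solve 1 (λ s → s :+ s := con 2ℚ :* s) refl s)
    (ℚ.+-mono-≤
      (p²≤s²⇒∣p∣≤s {a} {s} 0≤s (ℚ.≤-trans (difference {d = b ℚ.* b} (0≤p² b)
        (solve 2 (λ a b → b := a :+ b :- a) refl (a ℚ.* a) (b ℚ.* b))) h))
      (p²≤s²⇒∣p∣≤s {b} {s} 0≤s (ℚ.≤-trans (difference {d = a ℚ.* a} (0≤p² a)
        (solve 2 (λ a b → a := a :+ b :- b) refl (a ℚ.* a) (b ℚ.* b))) h)))
    where
    a b : ℚ
    a = seq (re z) n
    b = seq (im z) n

  -- The ℓ¹ norm can exceed 1 although the modulus is below 1, so powers are estimated through the
  -- multiplicative squared modulus and converted only at the end, at the price of the factor 2. One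
  -- index N serves all powers.
  geometric-decay : ∀ z → ∣ z ∣< 1ℝ →
    Σ[ r ∈ ℚ ] (0ℚ ℚ.< r) × (r ℚ.< 1ℚ) × (∀ n → z ^ n ≼ 2ℚ ℚ.* r ^ℚ n)
  geometric-decay z (_ , ε , 0<ε , N , hN) = r , 0<r , r<1 , λ n →
      mk≼ (N , λ m m≥ → ‖‖≤2s (z ^ n) m {r ^ℚ n} (0≤r^ n) (power n m m≥))
    where
    -- A rational bound for the modulus without a square root: (1 - ε/2)² ≥ 1 - ε, which bounds the
    -- squared modulus.
    r : ℚ
    r = 1ℚ ℚ.- ½ ℚ.* ε
    ε≤1 : ε ℚ.≤ 1ℚ
    ε≤1 = ℚ.≤-trans (subst (ℚ._≤ seq ∣ z ∣² N ℚ.+ ε) (ℚ.+-identityˡ ε) (ℚ.+-monoˡ-≤ ε (0≤∣∣² z N))) (hN N ℕ.≤-refl)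
    0<r : 0ℚ ℚ.< r
    0<r = ℚ.<-≤-trans (ℚ.positive⁻¹ ½) (difference {½} {r} {½ ℚ.* (1ℚ ℚ.- ε)}
      (0≤p*q {½} (ℚ.<⇒≤ (ℚ.positive⁻¹ ½)) (0≤q-p ε≤1))
      (solve 1 (λ ε → con ½ :* (con 1ℚ :- ε) := con 1ℚ :- con ½ :* ε :- con ½) refl ε))
    r<1 : r ℚ.< 1ℚ
    r<1 = subst (r ℚ.<_) (ℚ.+-identityʳ 1ℚ) (ℚ.+-monoʳ-< 1ℚ (ℚ.neg-antimono-< (0<½ε 0<ε)))
    open Geometric r 0<r r<1
    base : ∀ m → N ℕ.≤ m → seq ∣ z ∣² m ℚ.≤ r ℚ.* r
    base m m≥ = ℚ.≤-trans
      (difference (0≤q-p (hN m m≥)) (solve 2 (λ s ε → con 1ℚ :- (s :+ ε) := (con 1ℚ :- ε) :- s) refl (seq ∣ z ∣² m) ε))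
      (difference (0≤p² (½ ℚ.* ε)) (solve 1 (λ ε → (con ½ :* ε) :* (con ½ :* ε)
        := (con 1ℚ :- con ½ :* ε) :* (con 1ℚ :- con ½ :* ε) :- (con 1ℚ :- ε)) refl ε))
    power : ∀ n m → N ℕ.≤ m → seq ∣ z ^ n ∣² m ℚ.≤ r ^ℚ n ℚ.* r ^ℚ n
    power zero    m m≥ = ℚ.≤-refl
    power (suc n) m m≥ = subst₂ ℚ._≤_ (sym (∣∣²-* z (z ^ n) m))
      (solve 2 (λ r s → (r :* r) :* (s :* s) := (r :* s) :* (r :* s)) refl r (r ^ℚ n))
      (*-mono {seq ∣ z ∣² m} {r ℚ.* r} {seq ∣ z ^ n ∣² m} {r ^ℚ n ℚ.* r ^ℚ n} (0≤∣∣² z m) (0≤p² (r ^ℚ n)) (base m m≥) (power n m m≥))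

  z^⇝0 : ∀ z → ∣ z ∣< 1ℝ → (z ^_) ⇝ 0ℂ
  z^⇝0 z ∣z∣<1 = mk⇝ λ ε 0<ε →
    let r , 0<r , r<1 , z^≼ = geometric-decay z ∣z∣<1
        M , h = Geometric.r^-scaled-null r 0<r r<1 2ℚ ε 0<2 0<ε
    in M , λ n n≥ → ≼-≗ {z ^ n} {z ^ n - 0ℂ}
      (mk≗ (λ j → sym (ℚ.+-identityʳ (seq (re (z ^ n)) j))) (λ j → sym (ℚ.+-identityʳ (seq (im (z ^ n)) j))))
      (≼-weaken {z ^ n} (h n n≥) (z^≼ n))

  1≼1 : 1ℂ ≼ 1ℚ
  1≼1 = mk≼ (0 , λ _ _ → ℚ.≤-refl)

-- As long as the partial product is bounded by 2, the next factor moves it by at most 2 c r^n ≤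
-- (r^n - r^(n+1))/2. These bounds telescope to a total of at most 1/2, which keeps the product near
-- 1 and away from 0.
module SmallProduct (r : ℚ) (0<r : 0ℚ ℚ.< r) (r<1 : r ℚ.< 1ℚ) (c : ℚ) (2c≤ : 2ℚ ℚ.* c ℚ.≤ ½ ℚ.* (1ℚ ℚ.- r))
  (f : ℕ → ℂ) (f≼ : ∀ n → f n - 1ℂ ≼ c ℚ.* r ^ℚ n) where
  open Geometric r 0<r r<1

  abstract
    -- The reference point `z` is free: 1 gives the distance from 1, an earlier partial product
    -- gives the Cauchy estimate.
    step : ∀ n {z K} → ∏< n f ≼ 2ℚ → ∏< n f - z ≼ K → ∏< (suc n) f - z ≼ K ℚ.+ ½ ℚ.* (r ^ℚ n ℚ.- r ^ℚ suc n)
    step n {z} {K} Q≼2 Q-z≼ = ≼-≗ {(∏< n f - z) + ∏< n f * (f n - 1ℂ)} {∏< (suc n) f - z}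
      (mk≗
        (λ j → eq-re (seq (re (∏< n f)) j) (seq (im (∏< n f)) j) (seq (re (f n)) j) (seq (im (f n)) j) (seq (re z) j))
        (λ j → eq-im (seq (re (∏< n f)) j) (seq (im (∏< n f)) j) (seq (re (f n)) j) (seq (im (f n)) j) (seq (im z) j)))
      (≼-+ {∏< n f - z} {∏< n f * (f n - 1ℂ)} {K} {½ ℚ.* (r ^ℚ n ℚ.- r ^ℚ suc n)} Q-z≼
        (≼-weaken {∏< n f * (f n - 1ℂ)} bound (≼-* {∏< n f} {f n - 1ℂ} {2ℚ} {c ℚ.* r ^ℚ n} Q≼2 (f≼ n))))
      where
      eq-re : ∀ a b c d z → (a ℚ.- z) ℚ.+ (a ℚ.* (c ℚ.- 1ℚ) ℚ.- b ℚ.* (d ℚ.- 0ℚ)) ≡ (a ℚ.* c ℚ.- b ℚ.* d) ℚ.- z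
      eq-re = solve 5 (λ a b c d z → (a :- z) :+ (a :* (c :- con 1ℚ) :- b :* (d :- con 0ℚ)) := (a :* c :- b :* d) :- z) refl
      eq-im : ∀ a b c d z → (b ℚ.- z) ℚ.+ (a ℚ.* (d ℚ.- 0ℚ) ℚ.+ b ℚ.* (c ℚ.- 1ℚ)) ≡ (a ℚ.* d ℚ.+ b ℚ.* c) ℚ.- z
      eq-im = solve 5 (λ a b c d z → (b :- z) :+ (a :* (d :- con 0ℚ) :+ b :* (c :- con 1ℚ)) := (a :* d :+ b :* c) :- z) refl
      bound : 2ℚ ℚ.* (c ℚ.* r ^ℚ n) ℚ.≤ ½ ℚ.* (r ^ℚ n ℚ.- r ^ℚ suc n)
      bound = subst₂ ℚ._≤_
        (ℚ.*-assoc 2ℚ c (r ^ℚ n))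
        (solve 2 (λ r s → con ½ :* (con 1ℚ :- r) :* s := con ½ :* (s :- r :* s)) refl r (r ^ℚ n))
        (*-monoʳ {r ^ℚ n} {2ℚ ℚ.* c} {½ ℚ.* (1ℚ ℚ.- r)} (0≤r^ n) 2c≤)

    shrink : ∀ m n → ½ ℚ.* (r ^ℚ m ℚ.- r ^ℚ n) ℚ.≤ r ^ℚ m
    shrink m n = difference {d = ½ ℚ.* r ^ℚ m ℚ.+ ½ ℚ.* r ^ℚ n}
      (ℚ.+-mono-≤ (0≤p*q {½} (ℚ.<⇒≤ (ℚ.positive⁻¹ ½)) (0≤r^ m)) (0≤p*q {½} (ℚ.<⇒≤ (ℚ.positive⁻¹ ½)) (0≤r^ n)))
      (solve 2 (λ a b → con ½ :* a :+ con ½ :* b := a :- con ½ :* (a :- b)) refl (r ^ℚ m) (r ^ℚ n))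

    telescope : ∀ a b c → ½ ℚ.* (a ℚ.- b) ℚ.+ ½ ℚ.* (b ℚ.- c) ≡ ½ ℚ.* (a ℚ.- c)
    telescope = solve 3 (λ a b c → con ½ :* (a :- b) :+ con ½ :* (b :- c) := con ½ :* (a :- c)) refl

    z-z≼0 : ∀ z → z - z ≼ 0ℚ
    z-z≼0 z = mk≼ (0 , λ j _ → vanishes (ℚ.+-inverseʳ (seq (re z) j)) (ℚ.+-inverseʳ (seq (im z) j)))
      where
      vanishes : ∀ {a b} → a ≡ 0ℚ → b ≡ 0ℚ → ℚ.∣ a ∣ ℚ.+ ℚ.∣ b ∣ ℚ.≤ 0ℚ
      vanishes refl refl = ℚ.≤-refl

    -- A mutual induction: closeness to 1 implies the bound 2, and the bound 2 controls the next
    -- step.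
    Q-1≼ : ∀ n → ∏< n f - 1ℂ ≼ ½ ℚ.* (1ℚ ℚ.- r ^ℚ n)
    Q≼2 : ∀ n → ∏< n f ≼ 2ℚ
    Q-1≼ zero    = z-z≼0 1ℂ
    Q-1≼ (suc n) = subst (∏< (suc n) f - 1ℂ ≼_) (telescope 1ℚ (r ^ℚ n) (r ^ℚ suc n)) (step n {1ℂ} (Q≼2 n) (Q-1≼ n))
    Q≼2 n = ≼-≗ {(∏< n f - 1ℂ) + 1ℂ} {∏< n f} (z-w+w≗z (∏< n f) 1ℂ)
      (≼-weaken {(∏< n f - 1ℂ) + 1ℂ} {½ ℚ.* (1ℚ ℚ.- r ^ℚ n) ℚ.+ 1ℚ} {2ℚ} (ℚ.+-monoˡ-≤ 1ℚ (shrink 0 n)) (≼-+ {∏< n f - 1ℂ} {1ℂ} {½ ℚ.* (1ℚ ℚ.- r ^ℚ n)} {1ℚ} (Q-1≼ n) 1≼1))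

    Q-Q≼ : ∀ m d → ∏< (d ℕ.+ m) f - ∏< m f ≼ ½ ℚ.* (r ^ℚ m ℚ.- r ^ℚ (d ℕ.+ m))
    Q-Q≼ m zero    = ≼-weaken {∏< m f - ∏< m f}
      (ℚ.≤-reflexive (solve 1 (λ a → con 0ℚ := con ½ :* (a :- a)) refl (r ^ℚ m))) (z-z≼0 (∏< m f))
    Q-Q≼ m (suc d) = subst (∏< (suc d ℕ.+ m) f - ∏< m f ≼_)
      (telescope (r ^ℚ m) (r ^ℚ (d ℕ.+ m)) (r ^ℚ suc (d ℕ.+ m)))
      (step (d ℕ.+ m) {∏< m f} (Q≼2 (d ℕ.+ m)) (Q-Q≼ m d))

    neg-difference : ∀ z w → - (z - w) ≗ w - z
    neg-difference z w = mk≗ (λ j → eq (seq (re z) j) (seq (re w) j)) (λ j → eq (seq (im z) j) (seq (im w) j))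
      where
      eq : ∀ a b → ℚ.- (a ℚ.- b) ≡ b ℚ.- a
      eq = solve 2 (λ a b → :- (a :- b) := b :- a) refl

    close : ∀ m n → m ℕ.≤ n → ∏< m f - ∏< n f ≼ r ^ℚ m
    close m n m≤n = ≼-≗ { - (∏< n f - ∏< m f)} {∏< m f - ∏< n f} (neg-difference (∏< n f) (∏< m f))
      (≼-neg {∏< n f - ∏< m f} (≼-weaken {∏< n f - ∏< m f} (shrink m n)
        (subst (λ k → ∏< k f - ∏< m f ≼ ½ ℚ.* (r ^ℚ m ℚ.- r ^ℚ k)) (ℕ.m∸n+n≡m m≤n) (Q-Q≼ m (n ∸ m)))))

    converges : Σ[ L ∈ ℂ ] (λ n → ∏< n f) ⇝ L × L #0
    converges =
      let L , Q⇝L = Completeness.complete (r ^ℚ_) 0<r^ r^-anti r^-null (λ n → ∏< n f) close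
          N , h   = tends Q⇝L (½ ℚ.* ½) (ℚ.positive⁻¹ (½ ℚ.* ½))
      in L , Q⇝L , ≼⇒#0 {L} (≼-≗ {(∏< N f - 1ℂ) + - (∏< N f - L)} {L - 1ℂ} (regroup L (∏< N f))
           (≼-+ {∏< N f - 1ℂ} { - (∏< N f - L)} {½} {½ ℚ.* ½} (≼-weaken {∏< N f - 1ℂ} (≤½ N) (Q-1≼ N)) (≼-neg {∏< N f - L} (h N ℕ.≤-refl))))
      where
      ≤½ : ∀ n → ½ ℚ.* (1ℚ ℚ.- r ^ℚ n) ℚ.≤ ½
      ≤½ n = difference {d = ½ ℚ.* r ^ℚ n} (0≤p*q {½} (ℚ.<⇒≤ (ℚ.positive⁻¹ ½)) (0≤r^ n))
        (solve 1 (λ s → con ½ :* s := con ½ :- con ½ :* (con 1ℚ :- s)) refl (r ^ℚ n))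
      eq : ∀ l q o → (q ℚ.- o) ℚ.+ (ℚ.- (q ℚ.- l)) ≡ l ℚ.- o
      eq = solve 3 (λ l q o → (q :- o) :+ (:- (q :- l)) := l :- o) refl
      regroup : ∀ L Q → (Q - 1ℂ) + - (Q - L) ≗ L - 1ℂ
      regroup L Q = mk≗ (λ j → eq (seq (re L) j) (seq (re Q) j) 1ℚ) (λ j → eq (seq (im L) j) (seq (im Q) j) 0ℚ)

abstract
  ∏<-split : ∀ k n f → ∏< k f * ∏< n (λ i → f (k ℕ.+ i)) ≈ ∏< (k ℕ.+ n) f
  ∏<-split k zero f = subst (λ j → ∏< k f * 1ℂ ≈ ∏< j f) (sym (ℕ.+-identityʳ k)) (ℂ-*-identityʳ (∏< k f))
  ∏<-split k (suc n) f = subst (λ j → ∏< k f * (∏< n g * f (k ℕ.+ n)) ≈ ∏< j f) (sym (ℕ.+-suc k n))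
    (≈-trans {∏< k f * (∏< n g * f (k ℕ.+ n))} {∏< k f * ∏< n g * f (k ℕ.+ n)} {∏< (suc (k ℕ.+ n)) f}
      (≈-sym {∏< k f * ∏< n g * f (k ℕ.+ n)} {∏< k f * (∏< n g * f (k ℕ.+ n))} (ℂ-*-assoc (∏< k f) (∏< n g) (f (k ℕ.+ n))))
      (ℂ-*-cong {∏< k f * ∏< n g} {∏< (k ℕ.+ n) f} {f (k ℕ.+ n)} {f (k ℕ.+ n)} (∏<-split k n f) (≈-refl {f (k ℕ.+ n)})))
    where
    g : ℕ → ℂ
    g i = f (k ℕ.+ i)

  -- Past an index M with 2 C r^M ≤ (1-r)/2 the tail is a `SmallProduct` with constant C r^M. The
  -- limit is the finite head times the limit of the tail, and is apart from zero once every factor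
  -- is.
  ∏-converges : ∀ {r C} → 0ℚ ℚ.< r → r ℚ.< 1ℚ → 0ℚ ℚ.< C → (f : ℕ → ℂ) → (∀ n → f n - 1ℂ ≼ C ℚ.* r ^ℚ n) →
    Σ[ L ∈ ℂ ] (λ n → ∏< n f) ⇝ L × ((∀ n → f n #0) → L #0)
  ∏-converges {r} {C} 0<r r<1 0<C f f≼ =
    let M , h = r^-scaled-null (2ℚ ℚ.* C) (½ ℚ.* (1ℚ ℚ.- r)) (0<p*q 0<2 0<C) (0<½ε 0<1-r)
        g : ℕ → ℂ
        g i = f (M ℕ.+ i)
        L , Q⇝L , L#0 = SmallProduct.converges r 0<r r<1 (C ℚ.* r ^ℚ M)
          (subst (ℚ._≤ ½ ℚ.* (1ℚ ℚ.- r)) (ℚ.*-assoc 2ℚ C (r ^ℚ M)) (h M ℕ.≤-refl))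
          g (λ n → subst (g n - 1ℂ ≼_) (eq M n) (f≼ (M ℕ.+ n)))
    in ∏< M f * L
       , ⇝-unshift {λ n → ∏< n f} {∏< M f * L} M
           (⇝-cong {λ n → ∏< M f * ∏< n g} {λ n → ∏< (M ℕ.+ n) f} {∏< M f * L} (λ n → ∏<-split M n f)
             (⇝-* {λ _ → ∏< M f} {λ n → ∏< n g} {∏< M f} {L} (⇝-const (∏< M f)) Q⇝L))
       , λ f#0 → *-#0 (∏< M f) L (∏<-#0 M f f#0) L#0
    where
    open Geometric r 0<r r<1
    r^-+ : ∀ m n → r ^ℚ (m ℕ.+ n) ≡ r ^ℚ m ℚ.* r ^ℚ n
    r^-+ zero    n = sym (ℚ.*-identityˡ (r ^ℚ n))
    r^-+ (suc m) n = trans (cong (r ℚ.*_) (r^-+ m n)) (sym (ℚ.*-assoc r (r ^ℚ m) (r ^ℚ n)))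
    eq : ∀ M n → C ℚ.* r ^ℚ (M ℕ.+ n) ≡ C ℚ.* r ^ℚ M ℚ.* r ^ℚ n
    eq M n = trans (cong (C ℚ.*_) (r^-+ M n)) (sym (ℚ.*-assoc C (r ^ℚ M) (r ^ℚ n)))

abstract
  ⟨⨾⟩-converges : ∀ u x → ∣ x ∣< 1ℝ →
    Σ[ L ∈ ℂ ] (⟨ u ⨾ x ⟩_) ⇝ L × ((∀ n → 1ℂ - u * x ^ n #0) → L #0)
  ⟨⨾⟩-converges u x ∣x∣<1 =
    let r , 0<r , r<1 , x^≼ = geometric-decay x ∣x∣<1
        K , 0<K , u≼K = ≼-exists u
    in ∏-converges {r} {K ℚ.* 2ℚ} 0<r r<1 (0<p*q 0<K 0<2) (λ n → 1ℂ - u * x ^ n)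
         (λ n → ≼-≗ { - (u * x ^ n)} {1ℂ - u * x ^ n - 1ℂ} (cancel (u * x ^ n))
           (subst (- (u * x ^ n) ≼_) (sym (ℚ.*-assoc K 2ℚ (r ^ℚ n)))
             (≼-neg {u * x ^ n} (≼-* {u} {x ^ n} {K} {2ℚ ℚ.* r ^ℚ n} u≼K (x^≼ n)))))
    where
    eq : ∀ o a → ℚ.- a ≡ (o ℚ.- a) ℚ.- o
    eq = solve 2 (λ o a → :- a := (o :- a) :- o) refl
    cancel : ∀ z → - z ≗ 1ℂ - z - 1ℂ
    cancel z = mk≗ (λ j → eq 1ℚ (seq (re z) j)) (λ j → eq 0ℚ (seq (im z) j))

-- The complex instance of the abstract argument.

-- x and Q stand for q ^ 2 and q ^_.  Keeping them abstract stops the type checker from comparing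
-- complex numbers by unfolding their real and imaginary parts.
module Instance (q x : ℂ) (q^2≡x : q ^ 2 ≡ x) (Q : ℕ → ℂ) (q^≡Q : ∀ n → q ^ n ≡ Q n) (∣x∣<1 : ∣ x ∣< 1ℝ) where
  ι : ℕ → ℂ
  ι n = inv (⟨ x ⨾ x ⟩ n) (⟨x⨾x⟩#0 x ∣x∣<1 n)

  A B : ℂ
  A = proj₁ (⟨⨾⟩-converges (- q) x ∣x∣<1)
  B = proj₁ (⟨⨾⟩-converges x x ∣x∣<1)

  ⟨-q⨾x⟩⇝A : (⟨ - q ⨾ x ⟩_) ⇝ A
  ⟨-q⨾x⟩⇝A = proj₁ (proj₂ (⟨⨾⟩-converges (- q) x ∣x∣<1))

  ⟨x⨾x⟩⇝B : (⟨ x ⨾ x ⟩_) ⇝ B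
  ⟨x⨾x⟩⇝B = proj₁ (proj₂ (⟨⨾⟩-converges x x ∣x∣<1))

  B#0 : B #0
  B#0 = proj₂ (proj₂ (⟨⨾⟩-converges x x ∣x∣<1)) (λ n → 1-z#0 (x * x ^ n) (∣z^1+n∣<1 x n ∣x∣<1))

  ≡⇒≈ : ∀ {z w : ℂ} → z ≡ w → z ≈ w
  ≡⇒≈ {z} refl = ≈-refl {z}

  open Powers ℂ-commutativeRing
  open QSeries q x (≡⇒≈ q^2≡x) (⟨ - q ⨾ x ⟩_) (⟨ x ⨾ x ⟩_) ι
    (≈-refl {1ℂ}) (λ n → ≈-refl {⟨ - q ⨾ x ⟩ suc n}) (≈-refl {1ℂ}) (λ n → ≈-refl {⟨ x ⨾ x ⟩ suc n})
    (λ n → inv-inverse (⟨ x ⨾ x ⟩ n) (⟨x⨾x⟩#0 x ∣x∣<1 n))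

  abstract
    p⇝A/B : p ⇝ (A / B [ B#0 ])
    p⇝A/B = ⇝-* {⟨ - q ⨾ x ⟩_} {ι} {A} {inv B B#0} ⟨-q⨾x⟩⇝A
      (inv-⇝ {⟨ x ⨾ x ⟩_} {B} (⟨x⨾x⟩#0 x ∣x∣<1) B#0 ⟨x⨾x⟩⇝B)

  open Limits _⇝_ (λ {f} {g} {L} → ⇝-cong {f} {g} {L}) (λ {f} {L} {M} → ⇝-congʳ {f} {L} {M})
    ⇝-const (λ {f} {g} {L} {M} → ⇝-+ {f} {g} {L} {M}) (λ {f} {g} {L} {M} → ⇝-* {f} {g} {L} {M})
    (λ {f} {L} → ⇝-suc {f} {L}) (A / B [ B#0 ]) p⇝A/B (z^⇝0 x ∣x∣<1)

  ∑<≈Σ< : ∀ N {f g} → (∀ n → f n ≈ g n) → Σ< N f ≈ ∑< N g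
  ∑<≈Σ< zero    f≈g = ≈-refl {0ℂ}
  ∑<≈Σ< (suc N) {f} {g} f≈g = ℂ-+-cong {Σ< N f} {∑< N g} {f N} {g N} (∑<≈Σ< N {f} {g} f≈g) (f≈g N)

  S : ℕ → ℂ
  S k = s (suc k)

  abstract
    -- The inverse of the denominator is passed on with its defining equation alone, which is the
    -- form `term≈t` takes.
    gauss≈ : ∀ M N → Σ[ w ∈ ℂ ]
      (gauss x ∣x∣<1 M N ≈ ⟨ x ⨾ x ⟩ M * w) × (⟨ x ⨾ x ⟩ N * ⟨ x ⨾ x ⟩ (M ∸ N) * w ≈ 1ℂ)
    gauss≈ M N = inv (⟨ x ⨾ x ⟩ N * ⟨ x ⨾ x ⟩ (M ∸ N)) D#0
      , ≈-refl {gauss x ∣x∣<1 M N} , inv-inverse (⟨ x ⨾ x ⟩ N * ⟨ x ⨾ x ⟩ (M ∸ N)) D#0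
      where
      D#0 : ⟨ x ⨾ x ⟩ N * ⟨ x ⨾ x ⟩ (M ∸ N) #0
      D#0 = *-#0 (⟨ x ⨾ x ⟩ N) (⟨ x ⨾ x ⟩ (M ∸ N)) (⟨x⨾x⟩#0 x ∣x∣<1 N) (⟨x⨾x⟩#0 x ∣x∣<1 (M ∸ N))

    /≈*inv : ∀ z w w#0 → z / w [ w#0 ] ≈ z * inv w w#0
    /≈*inv z w w#0 = ≈-refl {z * inv w w#0}

    quotient*≈t : ∀ k i {R l l′ n M N v w} (D#0 : ⟨ x ⨾ x ⟩ n #0) →
      q ^ (2 ℕ.* (suc k ℕ.+ 1) ℕ.* (suc k ℕ.+ i) ∸ suc k) ≈ R →
      l ≡ i → l′ ≡ i → n ≡ suc k ℕ.+ i → M ≡ k ℕ.+ i → N ≡ k →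
      v ≈ ⟨ x ⨾ x ⟩ M * w → ⟨ x ⨾ x ⟩ N * ⟨ x ⨾ x ⟩ l′ * w ≈ 1ℂ →
      (⟨ - q ⨾ x ⟩ suc k * ⟨ - q ⨾ x ⟩ l * R) / ⟨ x ⨾ x ⟩ n [ D#0 ] * v ≈ t (suc k) i
    quotient*≈t k i {R} {l} {l′} {n} {M} {N} {v} {w} D#0 q^≈R l≡ l′≡ n≡ M≡ N≡ v≈ bbw =
      ≈-trans {z / ⟨ x ⨾ x ⟩ n [ D#0 ] * v} {z * inv (⟨ x ⨾ x ⟩ n) D#0 * (⟨ x ⨾ x ⟩ M * w)} {t (suc k) i}
        (ℂ-*-cong {z / ⟨ x ⨾ x ⟩ n [ D#0 ]} {z * inv (⟨ x ⨾ x ⟩ n) D#0} {v} {⟨ x ⨾ x ⟩ M * w}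
          (/≈*inv z (⟨ x ⨾ x ⟩ n) D#0) v≈)
        (term≈t k i {R} {l} {l′} {n} {M} {N} {inv (⟨ x ⨾ x ⟩ n) D#0} {w} q^≈R l≡ l′≡ n≡ M≡ N≡
          (inv-inverse (⟨ x ⨾ x ⟩ n) D#0) bbw)
      where
      z : ℂ
      z = ⟨ - q ⨾ x ⟩ suc k * ⟨ - q ⨾ x ⟩ l * R

    summand≈t : ∀ k i →
      (⟨ - q ⨾ x ⟩ suc k * ⟨ - q ⨾ x ⟩ (suc k ℕ.+ i ∸ suc k) * Q (2 ℕ.* (suc k ℕ.+ 1) ℕ.* (suc k ℕ.+ i) ∸ suc k))
        / ⟨ x ⨾ x ⟩ (suc k ℕ.+ i) [ ⟨x⨾x⟩#0 x ∣x∣<1 (suc k ℕ.+ i) ]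
        * gauss x ∣x∣<1 (suc k ℕ.+ i ∸ 1) (suc k ∸ 1) ≈ t (suc k) i
    summand≈t k i =
      let w , g≈ , bbw≈1 = gauss≈ (suc k ℕ.+ i ∸ 1) (suc k ∸ 1)
      in quotient*≈t k i {Q (2 ℕ.* (suc k ℕ.+ 1) ℕ.* (suc k ℕ.+ i) ∸ suc k)}
           {suc k ℕ.+ i ∸ suc k} {suc k ℕ.+ i ∸ 1 ∸ (suc k ∸ 1)} {suc k ℕ.+ i} {suc k ℕ.+ i ∸ 1} {suc k ∸ 1}
           {gauss x ∣x∣<1 (suc k ℕ.+ i ∸ 1) (suc k ∸ 1)} {w}
           (⟨x⨾x⟩#0 x ∣x∣<1 (suc k ℕ.+ i)) (≡⇒≈ (q^≡Q (2 ℕ.* (suc k ℕ.+ 1) ℕ.* (suc k ℕ.+ i) ∸ suc k)))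
           (ℕ.m+n∸m≡n k i) (ℕ.m+n∸m≡n k i) refl refl refl g≈ bbw≈1

    ∑⟶ : ∀ k f → (∀ i → f (suc k ℕ.+ i) ≈ t (suc k) i) → ∑[ suc k ≤∞] f ⟶ S k
    ∑⟶ k f f≈t = ⇝⇒⟶ {λ N → ∑< N (λ i → f (suc k ℕ.+ i))} {S k}
      (⇝-cong {λ N → Σ< N (t (suc k))} {λ N → ∑< N (λ i → f (suc k ℕ.+ i))} {S k}
        (λ N → ∑<≈Σ< N {t (suc k)} {λ i → f (suc k ℕ.+ i)}
          (λ i → ≈-sym {f (suc k ℕ.+ i)} {t (suc k) i} (f≈t i))) (Σt⇝s k))

    series-converges : ∀ k → ∑[ suc k ≤∞]
      (λ n → (⟨ - q ⨾ x ⟩ suc k * ⟨ - q ⨾ x ⟩ (n ∸ suc k) * Q (2 ℕ.* (suc k ℕ.+ 1) ℕ.* n ∸ suc k))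
               / ⟨ x ⨾ x ⟩ n [ ⟨x⨾x⟩#0 x ∣x∣<1 n ] * gauss x ∣x∣<1 (n ∸ 1) (suc k ∸ 1)) ⟶ S k
    series-converges k = ∑⟶ k
      (λ n → (⟨ - q ⨾ x ⟩ suc k * ⟨ - q ⨾ x ⟩ (n ∸ suc k) * Q (2 ℕ.* (suc k ℕ.+ 1) ℕ.* n ∸ suc k))
               / ⟨ x ⨾ x ⟩ n [ ⟨x⨾x⟩#0 x ∣x∣<1 n ] * gauss x ∣x∣<1 (n ∸ 1) (suc k ∸ 1))
      (summand≈t k)

    identity : ∀ k →
      (A / B [ B#0 ]) * ∑< (suc k) (λ j → (- 1ℂ) ^ j * q ^ (j ℕ.* (2 ℕ.* j ℕ.+ 1)) * (1ℂ - q ^ (2 ℕ.* j ℕ.+ 1)))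
        ≈ 1ℂ + (- 1ℂ) ^ k * S k
    identity k = ≈-trans {P * ∑< (suc k) c} {P * Σ< (suc k) c} {1ℂ + (- 1ℂ) ^ k * S k}
      (ℂ-*-cong {P} {P} {∑< (suc k) c} {Σ< (suc k) c} (≈-refl {P})
        (≈-sym {Σ< (suc k) c} {∑< (suc k) c} (∑<≈Σ< (suc k) {c} {c} (λ j → ≈-refl {c j}))))
      (sum-identity k)
      where
      P : ℂ
      P = A / B [ B#0 ]
      c : ℕ → ℂ
      c j = (- 1ℂ) ^ j * q ^ (j ℕ.* (2 ℕ.* j ℕ.+ 1)) * (1ℂ - q ^ (2 ℕ.* j ℕ.+ 1))

identity-from-base : ∀ q x → q ^ 2 ≡ x → (Q : ℕ → ℂ) → (∀ n → q ^ n ≡ Q n) → (∣x∣<1 : ∣ x ∣< 1ℝ) → ∀ k →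
  Σ[ A ∈ ℂ ] Σ[ B ∈ ℂ ] Σ[ S ∈ ℂ ] Σ[ B#0 ∈ B #0 ]
    (⟨ - q ⨾ x ⟩∞⟶ A)
    × (⟨ x ⨾ x ⟩∞⟶ B)
    × (∑[ suc k ≤∞]
         (λ n →
            (⟨ - q ⨾ x ⟩ suc k * ⟨ - q ⨾ x ⟩ (n ∸ suc k) * Q (2 ℕ.* (suc k ℕ.+ 1) ℕ.* n ∸ suc k))
              / ⟨ x ⨾ x ⟩ n [ ⟨x⨾x⟩#0 x ∣x∣<1 n ]
            * gauss x ∣x∣<1 (n ∸ 1) (suc k ∸ 1))
       ⟶ S)
    × ((A / B [ B#0 ])
         * ∑< (suc k) (λ j → (- 1ℂ) ^ j * q ^ (j ℕ.* (2 ℕ.* j ℕ.+ 1)) * (1ℂ - q ^ (2 ℕ.* j ℕ.+ 1)))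
       ≈ 1ℂ + (- 1ℂ) ^ k * S)
identity-from-base q x q^2≡x Q q^≡Q ∣x∣<1 k =
  A , B , S k , B#0 , ⇝⇒⟶ {⟨ - q ⨾ x ⟩_} {A} ⟨-q⨾x⟩⇝A , ⇝⇒⟶ {⟨ x ⨾ x ⟩_} {B} ⟨x⨾x⟩⇝B , series-converges k , identity k
  where open Instance q x q^2≡x Q q^≡Q ∣x∣<1

theorem1p3 : (q : ℂ) (∣q∣<1 : ∣ q ∣< 1ℝ) (k : ℕ) → 1 ℕ.≤ k →
    Σ[ A ∈ ℂ ] Σ[ B ∈ ℂ ] Σ[ S ∈ ℂ ] Σ[ B#0 ∈ B #0 ]
    (⟨ - q ⨾ q ^ 2 ⟩∞⟶ A)
    × (⟨ q ^ 2 ⨾ q ^ 2 ⟩∞⟶ B)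
    × (∑[ k ≤∞]
    (λ n →
    (⟨ - q ⨾ q ^ 2 ⟩ k * ⟨ - q ⨾ q ^ 2 ⟩ (n ∸ k) * q ^ (2 ℕ.* (k ℕ.+ 1) ℕ.* n ∸ k))
    / ⟨ q ^ 2 ⨾ q ^ 2 ⟩ n [ ⟨x⨾x⟩#0 (q ^ 2) (∣z^1+n∣<1 q 1 ∣q∣<1) n ]
    * gauss (q ^ 2) (∣z^1+n∣<1 q 1 ∣q∣<1) (n ∸ 1) (k ∸ 1))
    ⟶ S)
    × ((A / B [ B#0 ])
    * ∑< k (λ j → (- 1ℂ) ^ j * q ^ (j ℕ.* (2 ℕ.* j ℕ.+ 1)) * (1ℂ - q ^ (2 ℕ.* j ℕ.+ 1)))
    ≈ 1ℂ + (- 1ℂ) ^ (k ∸ 1) * S)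
theorem1p3 q ∣q∣<1 (suc k) _ = identity-from-base q _ refl _ (λ _ → refl) (∣z^1+n∣<1 q 1 ∣q∣<1) k
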